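{- For every prime $p$ there are constants $c>0$ and $C>0$ (depending only on $p$) such that the following holds. If $A\subseteq \mathbb{F}_p^n$ is restricted $3$-AP free, then $\mu(A)\leq \frac{C}{(\log\log\log n)^{c}}$, where $\mu(A)=|A|/p^n$.
   Context: A restricted $3$-arithmetic progression ($3$-AP) in $\mathbb{F}_p^n$ is a triple of vectors $x, x+a, x+2a$ with $x\in\mathbb{F}_p^n$ and common difference $a\in\{0,1,2\}^n\setminus\{\vec 0\}$ (entries of $a$ viewed as elements of $\mathbb{F}_p$). A set $A\subseteq\mathbb{F}_p^n$ is restricted $3$-AP free if there are no $x\in\mathbb{F}_p^n$ and $a\in\{0,1,2\}^n\setminus\{\vec 0\}$ with $x,x+a,x+2a\in A$. -}

module Defs where

open import Data.Nat using (ℕ; zero; suc; _+_; NonZero)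
open import Data.Nat.DivMod using (_mod_)
open import Data.Fin using (Fin; toℕ)
open import Data.Vec using (Vec; []; _∷_; zipWith; replicate)
open import Data.List using (List; [_]; map; concatMap; allFin)
open import Data.Nat.ListAction using (sum)
open import Data.Bool using (Bool; true; false; if_then_else_)
open import Data.Product using (_×_)
open import Relation.Binary.PropositionalEquality using (_≡_; _≢_)
open import Relation.Nullary using (¬_)

-- Vectors in F_p^n are represented as Vec (Fin p) n, with F_p = Fin p
-- (arithmetic mod p).  A subset A ⊆ F_p^n is a Bool-valued predicate.

module _ (p : ℕ) .{{_ : NonZero p}} where

  addF : Fin p → Fin p → Fin p
  addF i j = (toℕ i + toℕ j) mod p

  shift : ∀ {n} → Vec (Fin p) n → Vec (Fin 3) n → Vec (Fin p) n
  shift x a = zipWith (λ xi ai → addF xi (toℕ ai mod p)) x a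

  RestrictedAPFree : ∀ {n} → (Vec (Fin p) n → Bool) → Set
  RestrictedAPFree {n} A =
    ∀ (x : Vec (Fin p) n) (a : Vec (Fin 3) n) → a ≢ replicate n Fin.zero →
    ¬ (A x ≡ true × A (shift x a) ≡ true × A (shift (shift x a) a) ≡ true)

allVecs : (p n : ℕ) → List (Vec (Fin p) n)
allVecs p zero = [ [] ]
allVecs p (suc n) = concatMap (λ i → map (i ∷_) (allVecs p n)) (allFin p)

card : ∀ {p n} → (Vec (Fin p) n → Bool) → ℕ
card {p} {n} A = sum (map (λ v → if A v then 1 else 0) (allVecs p n))

{-# OPTIONS --safe #-}
-- Let A be restricted 3-AP free of density δ, f = 1_A − δ, and write the difference as a = b + c
-- with b, c independent and uniform in {0,1}^n.  Since A contains almost none of these progressions,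
-- two applications of Cauchy–Schwarz give E_d E_z (E_e f(z+e) f(z+e+d))² ≥ δ^O(1), where d and e have
-- independent coordinates d_i ∈ {−1,0,1}, e_i ∈ {0,2}.  Further applications replace these step
-- distributions by iterated difference distributions, which charge every element of F_p when p is odd;
-- so every coordinate of d and e is uniform with constant probability, and on a random subcube f has
-- large U² norm, hence a large Fourier coefficient at some linear form ℓ.  Among any p coefficients of
-- ℓ some consecutive ones sum to zero, and shifting those coordinates simultaneously preserves both ℓ
-- and the shape of restricted progressions.  Thus A is denser by δ^O(1) on a subspace that is a copy
-- of F_p^N with N linear in n, and iterating δ^(−O(1)) times gives even n ≤ 2^(K m^k) for δ ≥ 1/m.
module Submission where

open import Defs
open import Algebra.Bundles using (CommutativeMonoid)
open import Algebra.Structures using (IsCommutativeMonoid)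
import Algebra.Properties.CommutativeMonoid.Sum as CMSum
import Algebra.Solver.CommutativeMonoid as CMSolver
open import Data.Bool using (Bool; true; false; if_then_else_)
open import Data.Empty using (⊥-elim)
open import Data.Fin as Fin using (Fin; toℕ)
open import Data.Fin.Permutation using (Permutation; permutation)
import Data.Fin.Properties as Finₚ
import Data.Integer as ℤ
open import Data.List as List using (List; []; _∷_)
import Data.List.Properties as Listₚ
open import Data.List.Relation.Unary.All as All using (All; []; _∷_)
import Data.List.Relation.Unary.All.Properties as Allₚ
open import Data.Maybe using (Maybe; just; nothing; maybe)
open import Data.Nat as ℕ using (ℕ; zero; suc)
open import Data.Nat.Coprimality using (prime⇒coprime; coprime-Bézout)
open import Data.Nat.DivMod using (_mod_; m<n⇒m%n≡m; m%n<n; %-distribˡ-+; %-distribˡ-*; [m+kn]%n≡m%n; [m+n]%n≡m%n)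
open import Data.Nat.GCD using (module Bézout)
import Data.Nat.ListAction as ListAction
import Data.Nat.ListAction.Properties as ListActionₚ
open import Data.Nat.Primality using (Prime; prime⇒nonTrivial)
import Data.Nat.Properties as ℕₚ
open import Data.Nat.Tactic.RingSolver using () renaming (solve-∀ to solveℕ-∀)
open import Data.Product using (_×_; _,_; proj₁; proj₂; ∃; ∃-syntax)
open import Data.Rational hiding (truncate)
open import Data.Rational.Properties
open import Data.Sum using (_⊎_; inj₁; inj₂)
open import Data.Vec as Vec using (Vec; []; _∷_; _++_; zipWith; replicate)
import Data.Vec.Properties as Vecₚ
open import Data.Vec.Relation.Unary.All as Allᵥ using ([]; _∷_)
open import Function using (_∘_; id)
open import Level using (0ℓ)
open import Relation.Binary.PropositionalEquality hiding ([_])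
open import Relation.Nullary using (¬_; yes; no; does)
open import Relation.Nullary.Decidable using (dec⇒maybe; dec-true)
open import Tactic.RingSolver using (solve-∀)
open import Tactic.RingSolver.Core.AlmostCommutativeRing using (AlmostCommutativeRing; fromCommutativeRing)

-- Rational arithmetic

-- The obstacle is that the steps of restricted progressions are far from uniform on F_p, so Fourier
-- analysis does not see the counting form directly. Passing from a step distribution to its
-- difference distribution costs one squaring and never shrinks a support that contains 0. A law
-- charging all of F_p is a mixture with the uniform law, and independence lets the coordinates be
-- treated one at a time. For p = 2 the doubled step 2b vanishes and its law cannot spread, hence
-- the separate treatment. The increment is run in contrapositive form. If every free set in
-- dimension N has density at most δ + κ, then f averages at most κ on the copies of F_p^N in
-- question. Since the mean of f is known, this one-sided bound also controls the mean absolute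
-- value of these averages, and with it every Fourier coefficient of f; no dense subspace has to be
-- located. All bounds stay in ℚ: powers of δ arise as iterated squares, and complex characters
-- enter only through sums over all p-th roots of unity other than 1.

ℚ-ring : AlmostCommutativeRing 0ℓ 0ℓ
ℚ-ring = fromCommutativeRing +-*-commutativeRing (λ x → dec⇒maybe (0ℚ ≟ x))

+-congˡ : ∀ a {b c : ℚ} → b ≡ c → a + b ≡ a + c
+-congˡ a = cong (λ x → a + x)

2ℚ : ℚ
2ℚ = 1ℚ + 1ℚ

sq : ℚ → ℚ
sq x = x * x

0≤1 : 0ℚ ≤ 1ℚ
0≤1 = nonNegative⁻¹ 1ℚ

0≤2 : 0ℚ ≤ 2ℚ
0≤2 = nonNegative⁻¹ 2ℚ

0≤-+ : ∀ {a b} → 0ℚ ≤ a → 0ℚ ≤ b → 0ℚ ≤ a + b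
0≤-+ p q = +-mono-≤ p q

*-mono-≤ : ∀ {a b c d} → 0ℚ ≤ a → 0ℚ ≤ d → a ≤ b → c ≤ d → a * c ≤ b * d
*-mono-≤ {a} {b} {c} {d} 0≤a 0≤d a≤b c≤d =
  ≤-trans (*-monoˡ-≤-nonNeg a {{nonNegative 0≤a}} c≤d) (*-monoʳ-≤-nonNeg d {{nonNegative 0≤d}} a≤b)

0≤-* : ∀ {a b} → 0ℚ ≤ a → 0ℚ ≤ b → 0ℚ ≤ a * b
0≤-* {a} {b} 0≤a 0≤b = ≤-trans (≤-reflexive (sym (*-zeroʳ a))) (*-monoˡ-≤-nonNeg a {{nonNegative 0≤a}} 0≤b)

*-monoˡ : ∀ {a b c} → 0ℚ ≤ a → b ≤ c → a * b ≤ a * c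
*-monoˡ {a} 0≤a = *-monoˡ-≤-nonNeg a {{nonNegative 0≤a}}

0≤-neg : ∀ {a} → a ≤ 0ℚ → 0ℚ ≤ - a
0≤-neg = neg-antimono-≤

neg-*-neg : ∀ a → (- a) * (- a) ≡ a * a
neg-*-neg = solve-∀ ℚ-ring

0≤sq : ∀ a → 0ℚ ≤ sq a
0≤sq a with ≤-total 0ℚ a
... | inj₁ 0≤a = 0≤-* 0≤a 0≤a
... | inj₂ a≤0 = subst (0ℚ ≤_) (neg-*-neg a) (0≤-* (0≤-neg a≤0) (0≤-neg a≤0))

≤-by : ∀ {a b} r → b ≡ a + r → 0ℚ ≤ r → a ≤ b
≤-by {a} {b} r b≡a+r 0≤r =
  ≤-trans (≤-reflexive (sym (+-identityʳ a))) (≤-trans (+-monoʳ-≤ a 0≤r) (≤-reflexive (sym b≡a+r)))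

0≤-sub : ∀ {a b} → a ≤ b → 0ℚ ≤ b - a
0≤-sub {a} {b} a≤b = ≤-trans (≤-reflexive (sym (+-inverseʳ a))) (+-monoˡ-≤ (- a) a≤b)

sq-mono : ∀ {a b} → 0ℚ ≤ a → a ≤ b → sq a ≤ sq b
sq-mono 0≤a a≤b = *-mono-≤ 0≤a (≤-trans 0≤a a≤b) a≤b a≤b

sq-* : ∀ a b → sq (a * b) ≡ sq a * sq b
sq-* = lemma
  where
  lemma : ∀ a b → (a * b) * (a * b) ≡ (a * a) * (b * b)
  lemma = solve-∀ ℚ-ring

sq-*-≤ : ∀ a b → sq a ≤ 1ℚ → sq (a * b) ≤ sq b
sq-*-≤ a b a²≤1 = ≤-trans (≤-reflexive (sq-* a b))
  (≤-trans (*-monoʳ-≤-nonNeg (sq b) {{nonNegative (0≤sq b)}} a²≤1) (≤-reflexive (*-identityˡ (sq b))))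

-- Finitely supported probability measures

-- Points may repeat and come in any order; measures are compared only through their expectations.
Atoms : Set → Set
Atoms X = List (ℚ × X)

∑ : {X : Set} → Atoms X → (X → ℚ) → ℚ
∑ []             f = 0ℚ
∑ ((w , x) ∷ ws) f = w * f x + ∑ ws f

module _ {X : Set} where

  ∑-cong : ∀ (ws : Atoms X) {f g : X → ℚ} → (∀ x → f x ≡ g x) → ∑ ws f ≡ ∑ ws g
  ∑-cong []             f≗g = refl
  ∑-cong ((w , x) ∷ ws) f≗g = cong₂ _+_ (cong (w *_) (f≗g x)) (∑-cong ws f≗g)

  ∑-+ : ∀ (ws : Atoms X) (f g : X → ℚ) → ∑ ws (λ x → f x + g x) ≡ ∑ ws f + ∑ ws g
  ∑-+ []             f g = refl
  ∑-+ ((w , x) ∷ ws) f g = trans (+-congˡ (w * (f x + g x)) (∑-+ ws f g)) (lemma w (f x) (g x) (∑ ws f) (∑ ws g))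
    where
    lemma : ∀ w a b c d → w * (a + b) + (c + d) ≡ (w * a + c) + (w * b + d)
    lemma = solve-∀ ℚ-ring

  ∑-* : ∀ (ws : Atoms X) c (f : X → ℚ) → ∑ ws (λ x → c * f x) ≡ c * ∑ ws f
  ∑-* []             c f = sym (*-zeroʳ c)
  ∑-* ((w , x) ∷ ws) c f = trans (+-congˡ (w * (c * f x)) (∑-* ws c f)) (lemma w c (f x) (∑ ws f))
    where
    lemma : ∀ w c a b → w * (c * a) + c * b ≡ c * (w * a + b)
    lemma = solve-∀ ℚ-ring

  ∑-mono : ∀ {ws : Atoms X} → All (λ a → 0ℚ ≤ proj₁ a) ws →
           ∀ {f g : X → ℚ} → (∀ x → f x ≤ g x) → ∑ ws f ≤ ∑ ws g
  ∑-mono []         f≤g = ≤-refl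
  ∑-mono (0≤w ∷ 0≤) f≤g = +-mono-≤ (*-monoˡ 0≤w (f≤g _)) (∑-mono 0≤ f≤g)

  ∑-++ : ∀ (ws vs : Atoms X) f → ∑ (ws List.++ vs) f ≡ ∑ ws f + ∑ vs f
  ∑-++ []             vs f = sym (+-identityˡ _)
  ∑-++ ((w , x) ∷ ws) vs f = trans (+-congˡ (w * f x) (∑-++ ws vs f)) (sym (+-assoc (w * f x) (∑ ws f) (∑ vs f)))

scale : {X : Set} → ℚ → Atoms X → Atoms X
scale c = List.map (λ (w , x) → c * w , x)

∑-scale : ∀ {X : Set} c (ws : Atoms X) f → ∑ (scale c ws) f ≡ c * ∑ ws f
∑-scale c []             f = sym (*-zeroʳ c)
∑-scale c ((w , x) ∷ ws) f = trans (+-congˡ (c * w * f x) (∑-scale c ws f)) (lemma c w (f x) (∑ ws f))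
  where
  lemma : ∀ c w a b → (c * w) * a + c * b ≡ c * (w * a + b)
  lemma = solve-∀ ℚ-ring

scale-nonneg : ∀ {X : Set} {c} {ws : Atoms X} → 0ℚ ≤ c →
               All (λ a → 0ℚ ≤ proj₁ a) ws → All (λ a → 0ℚ ≤ proj₁ a) (scale c ws)
scale-nonneg 0≤c []         = []
scale-nonneg 0≤c (0≤w ∷ 0≤) = 0≤-* 0≤c 0≤w ∷ scale-nonneg 0≤c 0≤

record Prob (X : Set) : Set where
  no-eta-equality
  field
    atoms  : Atoms X
    nonneg : All (λ a → 0ℚ ≤ proj₁ a) atoms
    mass   : ∑ atoms (λ _ → 1ℚ) ≡ 1ℚ

open Prob

opaque

  E : {X : Set} → Prob X → (X → ℚ) → ℚ
  E μ f = ∑ (atoms μ) f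

  E-∑ : ∀ {X : Set} (μ : Prob X) f → E μ f ≡ ∑ (atoms μ) f
  E-∑ μ f = refl

module _ {X : Set} (μ : Prob X) where

  opaque
    unfolding E

    E-cong : ∀ {f g : X → ℚ} → (∀ x → f x ≡ g x) → E μ f ≡ E μ g
    E-cong = ∑-cong (atoms μ)

    E-+ : ∀ (f g : X → ℚ) → E μ (λ x → f x + g x) ≡ E μ f + E μ g
    E-+ = ∑-+ (atoms μ)

    E-* : ∀ c (f : X → ℚ) → E μ (λ x → c * f x) ≡ c * E μ f
    E-* = ∑-* (atoms μ)

    E-1 : E μ (λ _ → 1ℚ) ≡ 1ℚ
    E-1 = mass μ

    E-mono : ∀ {f g : X → ℚ} → (∀ x → f x ≤ g x) → E μ f ≤ E μ g
    E-mono = ∑-mono (nonneg μ)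

  E-*ʳ : ∀ c (f : X → ℚ) → E μ (λ x → f x * c) ≡ E μ f * c
  E-*ʳ c f = trans (E-cong (λ x → *-comm (f x) c)) (trans (E-* c f) (*-comm c (E μ f)))

  E-const : ∀ c → E μ (λ _ → c) ≡ c
  E-const c = begin
    E μ (λ _ → c)      ≡⟨ E-cong (λ _ → sym (*-identityʳ c)) ⟩
    E μ (λ _ → c * 1ℚ) ≡⟨ E-* c (λ _ → 1ℚ) ⟩
    c * E μ (λ _ → 1ℚ) ≡⟨ cong (c *_) E-1 ⟩
    c * 1ℚ             ≡⟨ *-identityʳ c ⟩
    c                  ∎
    where open ≡-Reasoning

  E-≤-const : ∀ {f : X → ℚ} {c} → (∀ x → f x ≤ c) → E μ f ≤ c
  E-≤-const {c = c} f≤c = ≤-trans (E-mono f≤c) (≤-reflexive (E-const c))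

  0≤E : ∀ {f : X → ℚ} → (∀ x → 0ℚ ≤ f x) → 0ℚ ≤ E μ f
  0≤E 0≤f = ≤-trans (≤-reflexive (sym (E-const 0ℚ))) (E-mono 0≤f)

  E-neg : ∀ (f : X → ℚ) → E μ (λ x → - f x) ≡ - E μ f
  E-neg f = begin
    E μ (λ x → - f x)        ≡⟨ E-cong (λ x → lemma (f x)) ⟩
    E μ (λ x → (- 1ℚ) * f x) ≡⟨ E-* (- 1ℚ) f ⟩
    (- 1ℚ) * E μ f           ≡⟨ lemma (E μ f) ⟨
    - E μ f                  ∎
    where
    open ≡-Reasoning
    lemma : ∀ a → - a ≡ (- 1ℚ) * a
    lemma = solve-∀ ℚ-ring

  E-sub : ∀ (f g : X → ℚ) → E μ (λ x → f x - g x) ≡ E μ f - E μ g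
  E-sub f g = trans (E-+ f (λ x → - g x)) (cong (E μ f +_) (E-neg g))

  -- The gap between the two sides is the variance of `f`.
  jensen : ∀ (f : X → ℚ) → sq (E μ f) ≤ E μ (λ x → sq (f x))
  jensen f = ≤-by (E μ (λ x → sq (f x - c))) variance (0≤E (λ x → 0≤sq (f x - c)))
    where
    open ≡-Reasoning
    c = E μ f
    expand : ∀ a c → (a - c) * (a - c) ≡ a * a + ((- 2ℚ) * c * a + c * c)
    expand = solve-∀ ℚ-ring
    collect : ∀ s c → s ≡ c * c + (s + ((- 2ℚ) * c * c + c * c))
    collect = solve-∀ ℚ-ring
    variance : E μ (λ x → sq (f x)) ≡ sq c + E μ (λ x → sq (f x - c))
    variance = begin
      E μ (λ x → sq (f x))
        ≡⟨ collect _ c ⟩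
      sq c + (E μ (λ x → sq (f x)) + ((- 2ℚ) * c * c + c * c))
        ≡⟨ cong (λ y → sq c + (E μ (λ x → sq (f x)) + y)) (cong₂ _+_ (E-* ((- 2ℚ) * c) f) (E-const (c * c))) ⟨
      sq c + (E μ (λ x → sq (f x)) + (E μ (λ x → (- 2ℚ) * c * f x) + E μ (λ _ → c * c)))
        ≡⟨ cong (λ y → sq c + (E μ (λ x → sq (f x)) + y)) (E-+ (λ x → (- 2ℚ) * c * f x) (λ _ → c * c)) ⟨
      sq c + (E μ (λ x → sq (f x)) + E μ (λ x → (- 2ℚ) * c * f x + c * c))
        ≡⟨ cong (sq c +_) (E-+ (λ x → sq (f x)) (λ x → (- 2ℚ) * c * f x + c * c)) ⟨
      sq c + E μ (λ x → sq (f x) + ((- 2ℚ) * c * f x + c * c))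
        ≡⟨ cong (sq c +_) (E-cong (λ x → expand (f x) c)) ⟨
      sq c + E μ (λ x → sq (f x - c)) ∎

  sq-E : ∀ (f : X → ℚ) → sq (E μ f) ≡ E μ (λ x → E μ (λ y → f x * f y))
  sq-E f = begin
    E μ f * E μ f                        ≡⟨ E-*ʳ (E μ f) f ⟨
    E μ (λ x → f x * E μ f)              ≡⟨ E-cong (λ x → E-* (f x) f) ⟨
    E μ (λ x → E μ (λ y → f x * f y))    ∎
    where open ≡-Reasoning

opaque
  unfolding E

  E-swap : ∀ {X Y : Set} (μ : Prob X) (ν : Prob Y) (f : X → Y → ℚ) →
           E μ (λ x → E ν (f x)) ≡ E ν (λ y → E μ (λ x → f x y))
  E-swap {X} {Y} μ ν f = go (atoms μ)
    where
    go : ∀ (ws : Atoms X) → ∑ ws (λ x → E ν (f x)) ≡ E ν (λ y → ∑ ws (λ x → f x y))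
    go []             = sym (E-const ν 0ℚ)
    go ((w , x) ∷ ws) = begin
      w * E ν (f x) + ∑ ws (λ x → E ν (f x))
        ≡⟨ cong₂ _+_ (sym (E-* ν w (f x))) (go ws) ⟩
      E ν (λ y → w * f x y) + E ν (λ y → ∑ ws (λ x → f x y))
        ≡⟨ E-+ ν (λ y → w * f x y) (λ y → ∑ ws (λ x → f x y)) ⟨
      E ν (λ y → w * f x y + ∑ ws (λ x → f x y)) ∎
      where open ≡-Reasoning

dirac : {X : Set} → X → Prob X
dirac x = record { atoms = (1ℚ , x) ∷ [] ; nonneg = 0≤1 ∷ [] ; mass = refl }

opaque
  unfolding E

  E-dirac : ∀ {X : Set} (x : X) f → E (dirac x) f ≡ f x
  E-dirac x f = lemma (f x)
    where
    lemma : ∀ a → 1ℚ * a + 0ℚ ≡ a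
    lemma = solve-∀ ℚ-ring

module _ {X Y : Set} (κ : X → Prob Y) where

  bindAtoms : Atoms X → Atoms Y
  bindAtoms []             = []
  bindAtoms ((w , x) ∷ ws) = scale w (atoms (κ x)) List.++ bindAtoms ws

  ∑-bindAtoms : ∀ ws f → ∑ (bindAtoms ws) f ≡ ∑ ws (λ x → ∑ (atoms (κ x)) f)
  ∑-bindAtoms []             f = refl
  ∑-bindAtoms ((w , x) ∷ ws) f =
    trans (∑-++ (scale w (atoms (κ x))) (bindAtoms ws) f)
          (cong₂ _+_ (∑-scale w (atoms (κ x)) f) (∑-bindAtoms ws f))

  bindAtoms-nonneg : ∀ {ws} → All (λ a → 0ℚ ≤ proj₁ a) ws → All (λ a → 0ℚ ≤ proj₁ a) (bindAtoms ws)
  bindAtoms-nonneg []                         = []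
  bindAtoms-nonneg (_∷_ {x = _ , x} 0≤w 0≤) = Allₚ.++⁺ (scale-nonneg 0≤w (nonneg (κ x))) (bindAtoms-nonneg 0≤)

opaque

  bind : {X Y : Set} → Prob X → (X → Prob Y) → Prob Y
  bind μ κ = record
    { atoms  = bindAtoms κ (atoms μ)
    ; nonneg = bindAtoms-nonneg κ (nonneg μ)
    ; mass   = trans (∑-bindAtoms κ (atoms μ) (λ _ → 1ℚ)) (trans (∑-cong (atoms μ) (λ x → mass (κ x))) (mass μ))
    }

opaque
  unfolding E bind

  E-bind : ∀ {X Y : Set} (μ : Prob X) (κ : X → Prob Y) f → E (bind μ κ) f ≡ E μ (λ x → E (κ x) f)
  E-bind μ κ = ∑-bindAtoms κ (atoms μ)

push : {X Y : Set} → (X → Y) → Prob X → Prob Y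
push g μ = bind μ (dirac ∘ g)

E-push : ∀ {X Y : Set} (g : X → Y) μ f → E (push g μ) f ≡ E μ (f ∘ g)
E-push g μ f = trans (E-bind μ (dirac ∘ g) f) (E-cong μ (λ x → E-dirac (g x) f))

infixl 8 _^_

_^_ : {X : Set} → Prob X → (n : ℕ) → Prob (Vec X n)
μ ^ zero  = dirac []
μ ^ suc n = bind μ (λ x → push (x ∷_) (μ ^ n))

E-[] : ∀ {X : Set} (μ : Prob X) f → E (μ ^ zero) f ≡ f []
E-[] μ = E-dirac []

E-∷ : ∀ {X : Set} (μ : Prob X) n f → E (μ ^ suc n) f ≡ E μ (λ x → E (μ ^ n) (λ xs → f (x ∷ xs)))
E-∷ μ n f = trans (E-bind μ _ f) (E-cong μ (λ x → E-push (x ∷_) (μ ^ n) f))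

E-map : ∀ {X Y : Set} (g : X → Y) μ n f → E (push g μ ^ n) f ≡ E (μ ^ n) (f ∘ Vec.map g)
E-map g μ zero    f = trans (E-[] (push g μ) f) (sym (E-[] μ (f ∘ Vec.map g)))
E-map g μ (suc n) f = begin
  E (push g μ ^ suc n) f
    ≡⟨ E-∷ (push g μ) n f ⟩
  E (push g μ) (λ y → E (push g μ ^ n) (λ ys → f (y ∷ ys)))
    ≡⟨ E-push g μ _ ⟩
  E μ (λ x → E (push g μ ^ n) (λ ys → f (g x ∷ ys)))
    ≡⟨ E-cong μ (λ x → E-map g μ n (λ ys → f (g x ∷ ys))) ⟩
  E μ (λ x → E (μ ^ n) (λ xs → f (g x ∷ Vec.map g xs)))
    ≡⟨ E-∷ μ n (f ∘ Vec.map g) ⟨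
  E (μ ^ suc n) (f ∘ Vec.map g) ∎
  where open ≡-Reasoning

_⊗_ : {X Y : Set} → Prob X → Prob Y → Prob (X × Y)
μ ⊗ ν = bind μ (λ x → push (x ,_) ν)

E-⊗ : ∀ {X Y : Set} (μ : Prob X) (ν : Prob Y) f → E (μ ⊗ ν) f ≡ E μ (λ x → E ν (λ y → f (x , y)))
E-⊗ μ ν f = trans (E-bind μ _ f) (E-cong μ (λ x → E-push (x ,_) ν f))

E-⊗-^ : ∀ {X Y : Set} (μ : Prob X) (ν : Prob Y) n f →
        E ((μ ⊗ ν) ^ n) f ≡ E (μ ^ n) (λ xs → E (ν ^ n) (λ ys → f (Vec.zip xs ys)))
E-⊗-^ μ ν zero    f = begin
  E ((μ ⊗ ν) ^ zero) f
    ≡⟨ E-[] (μ ⊗ ν) f ⟩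
  f []
    ≡⟨ E-[] ν (λ ys → f (Vec.zip [] ys)) ⟨
  E (ν ^ zero) (λ ys → f (Vec.zip [] ys))
    ≡⟨ E-[] μ (λ xs → E (ν ^ zero) (λ ys → f (Vec.zip xs ys))) ⟨
  E (μ ^ zero) (λ xs → E (ν ^ zero) (λ ys → f (Vec.zip xs ys))) ∎
  where open ≡-Reasoning
E-⊗-^ μ ν (suc n) f = begin
  E ((μ ⊗ ν) ^ suc n) f
    ≡⟨ E-∷ (μ ⊗ ν) n f ⟩
  E (μ ⊗ ν) (λ xy → E ((μ ⊗ ν) ^ n) (λ xys → f (xy ∷ xys)))
    ≡⟨ E-⊗ μ ν _ ⟩
  E μ (λ x → E ν (λ y → E ((μ ⊗ ν) ^ n) (λ xys → f ((x , y) ∷ xys))))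
    ≡⟨ E-cong μ (λ x → E-cong ν (λ y → E-⊗-^ μ ν n (λ xys → f ((x , y) ∷ xys)))) ⟩
  E μ (λ x → E ν (λ y → E (μ ^ n) (λ xs → E (ν ^ n) (λ ys → f ((x , y) ∷ Vec.zip xs ys)))))
    ≡⟨ E-cong μ (λ x → E-swap ν (μ ^ n) _) ⟩
  E μ (λ x → E (μ ^ n) (λ xs → E ν (λ y → E (ν ^ n) (λ ys → f ((x , y) ∷ Vec.zip xs ys)))))
    ≡⟨ E-cong μ (λ x → E-cong (μ ^ n) (λ xs → E-∷ ν n (λ ys → f (Vec.zip (x ∷ xs) ys)))) ⟨
  E μ (λ x → E (μ ^ n) (λ xs → E (ν ^ suc n) (λ ys → f (Vec.zip (x ∷ xs) ys))))
    ≡⟨ E-∷ μ n (λ xs → E (ν ^ suc n) (λ ys → f (Vec.zip xs ys))) ⟨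
  E (μ ^ suc n) (λ xs → E (ν ^ suc n) (λ ys → f (Vec.zip xs ys))) ∎
  where open ≡-Reasoning

diff : {G : Set} → (G → G → G) → Prob G → Prob G
diff _⊖_ μ = push (λ (x , y) → y ⊖ x) (μ ⊗ μ)

E-diff : ∀ {G : Set} (_⊖_ : G → G → G) μ f →
         E (diff _⊖_ μ) f ≡ E μ (λ x → E μ (λ y → f (y ⊖ x)))
E-diff _⊖_ μ f = trans (E-push _ (μ ⊗ μ) f) (E-⊗ μ μ _)

-- Cauchy–Schwarz over an abelian group

module CauchySchwarz
  {G : Set} (_⊕_ _⊖_ : G → G → G) (ε : G)
  (isCommutativeMonoid : IsCommutativeMonoid _≡_ _⊕_ ε)
  (x⊕[y⊖x]≡y : ∀ x y → x ⊕ (y ⊖ x) ≡ y)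
  ([x⊕y]⊖y≡x : ∀ x y → (x ⊕ y) ⊖ y ≡ x)
  (U : Prob G) (U-invariant : ∀ g f → E U (λ u → f (u ⊕ g)) ≡ E U f)
  where

  open IsCommutativeMonoid isCommutativeMonoid using (assoc; comm)
  open ≤-Reasoning

  private
    commutativeMonoid : CommutativeMonoid 0ℓ 0ℓ
    commutativeMonoid = record { isCommutativeMonoid = isCommutativeMonoid }

    open CMSolver commutativeMonoid using (solve; _⊜_) renaming (_⊕_ to _:+_)

  Bounded : (G → ℚ) → Set
  Bounded f = ∀ x → sq (f x) ≤ 1ℚ

  -- A box norm with prescribed step laws: when both laws are uniform and `f` = `g`, it is the
  -- fourth power of the U² norm.
  V : Prob G → Prob G → (G → ℚ) → (G → ℚ) → ℚ
  V γ β f g = E γ (λ d → E U (λ z → sq (E β (λ e → f (z ⊕ e) * g ((z ⊕ e) ⊕ d)))))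

  *-bounded : ∀ f g → Bounded f → Bounded g → Bounded (λ x → f x * g x)
  *-bounded f g bf bg x = ≤-trans (sq-*-≤ (f x) (g x) (bf x)) (bg x)

  -- Expanding the square produces two shifts `e` and `e′`; by invariance of `U` only their
  -- difference matters.
  E-sq-shift : ∀ β (F : G → ℚ) →
    E U (λ z → sq (E β (λ e → F (z ⊕ e)))) ≡ E U (λ z → F z * E (diff _⊖_ β) (λ e → F (z ⊕ e)))
  E-sq-shift β F = begin-equality
    E U (λ z → sq (E β (λ e → F (z ⊕ e))))
      ≡⟨ E-cong U (λ z → sq-E β (λ e → F (z ⊕ e))) ⟩
    E U (λ z → E β (λ e → E β (λ e′ → F (z ⊕ e) * F (z ⊕ e′))))
      ≡⟨ E-swap U β _ ⟩
    E β (λ e → E U (λ z → E β (λ e′ → F (z ⊕ e) * F (z ⊕ e′))))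
      ≡⟨ E-cong β (λ e → E-cong U (λ z → E-cong β (λ e′ → cong (λ t → F (z ⊕ e) * F t) (move z e e′)))) ⟩
    E β (λ e → E U (λ z → E β (λ e′ → F (z ⊕ e) * F ((z ⊕ e) ⊕ (e′ ⊖ e)))))
      ≡⟨ E-cong β (λ e → U-invariant e (λ z → E β (λ e′ → F z * F (z ⊕ (e′ ⊖ e))))) ⟩
    E β (λ e → E U (λ z → E β (λ e′ → F z * F (z ⊕ (e′ ⊖ e)))))
      ≡⟨ E-swap β U _ ⟩
    E U (λ z → E β (λ e → E β (λ e′ → F z * F (z ⊕ (e′ ⊖ e)))))
      ≡⟨ E-cong U (λ z → E-diff _⊖_ β (λ e → F z * F (z ⊕ e))) ⟨
    E U (λ z → E (diff _⊖_ β) (λ e → F z * F (z ⊕ e)))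
      ≡⟨ E-cong U (λ z → E-* (diff _⊖_ β) (F z) (λ e → F (z ⊕ e))) ⟩
    E U (λ z → F z * E (diff _⊖_ β) (λ e → F (z ⊕ e))) ∎
    where
    move : ∀ z e e′ → z ⊕ e′ ≡ (z ⊕ e) ⊕ (e′ ⊖ e)
    move z e e′ = trans (cong (z ⊕_) (sym (x⊕[y⊖x]≡y e e′))) (sym (assoc z e (e′ ⊖ e)))

  sq-E-weighted : ∀ (F H : G → ℚ) → Bounded F → sq (E U (λ z → F z * H z)) ≤ E U (λ z → sq (H z))
  sq-E-weighted F H bF = ≤-trans (jensen U (λ z → F z * H z)) (E-mono U (λ z → sq-*-≤ (F z) (H z) (bF z)))

  -- For fixed `d`, the factor f(z) f(z + d) outside the inner average is bounded, so Cauchy-Schwarz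
  -- removes it and leaves the square of an average over differences from `β`.
  sq-V-≤-diffʳ : ∀ γ β f → Bounded f → sq (V γ β f f) ≤ V γ (diff _⊖_ β) f f
  sq-V-≤-diffʳ γ β f bf = begin
    sq (V γ β f f)
      ≤⟨ jensen γ _ ⟩
    E γ (λ d → sq (E U (λ z → sq (E β (λ e → F d (z ⊕ e))))))
      ≡⟨ E-cong γ (λ d → cong sq (E-sq-shift β (F d))) ⟩
    E γ (λ d → sq (E U (λ z → F d z * E (diff _⊖_ β) (λ e → F d (z ⊕ e)))))
      ≤⟨ E-mono γ (λ d → sq-E-weighted (F d) _ (*-bounded f (λ z → f (z ⊕ d)) bf (λ z → bf (z ⊕ d)))) ⟩
    V γ (diff _⊖_ β) f f ∎
    where
    F : G → G → ℚ
    F d z = f z * f (z ⊕ d)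

  -- The same parallelograms read along their other side. This puts the average over `γ` innermost,
  -- where it can be differenced in its turn.
  V-symm : ∀ γ β f → V γ β f f ≡
    E β (λ e → E β (λ e′ → E U (λ z →
      f (z ⊕ e) * f (z ⊕ e′) * E γ (λ d → f ((z ⊕ d) ⊕ e) * f ((z ⊕ d) ⊕ e′)))))
  V-symm γ β f = begin-equality
    E γ (λ d → E U (λ z → sq (E β (λ e → f (z ⊕ e) * f ((z ⊕ e) ⊕ d)))))
      ≡⟨ E-cong γ (λ d → E-cong U (λ z → sq-E β _)) ⟩
    E γ (λ d → E U (λ z → E β (λ e → E β (λ e′ → (f (z ⊕ e) * f ((z ⊕ e) ⊕ d)) * (f (z ⊕ e′) * f ((z ⊕ e′) ⊕ d))))))
      ≡⟨ E-cong γ (λ d → E-cong U (λ z → E-cong β (λ e → E-cong β (λ e′ →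
           trans (reorder (f (z ⊕ e)) _ (f (z ⊕ e′)) _)
                 (cong₂ (λ s t → f (z ⊕ e) * f (z ⊕ e′) * (f s * f t)) (swap z e d) (swap z e′ d)))))) ⟩
    E γ (λ d → E U (λ z → E β (λ e → E β (λ e′ → f (z ⊕ e) * f (z ⊕ e′) * (f ((z ⊕ d) ⊕ e) * f ((z ⊕ d) ⊕ e′))))))
      ≡⟨ E-swap γ U _ ⟩
    E U (λ z → E γ (λ d → E β (λ e → E β (λ e′ → f (z ⊕ e) * f (z ⊕ e′) * (f ((z ⊕ d) ⊕ e) * f ((z ⊕ d) ⊕ e′))))))
      ≡⟨ E-cong U (λ z → E-swap γ β _) ⟩
    E U (λ z → E β (λ e → E γ (λ d → E β (λ e′ → f (z ⊕ e) * f (z ⊕ e′) * (f ((z ⊕ d) ⊕ e) * f ((z ⊕ d) ⊕ e′))))))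
      ≡⟨ E-cong U (λ z → E-cong β (λ e → trans (E-swap γ β _) (E-cong β (λ e′ → E-* γ (f (z ⊕ e) * f (z ⊕ e′)) _)))) ⟩
    E U (λ z → E β (λ e → E β (λ e′ → f (z ⊕ e) * f (z ⊕ e′) * E γ (λ d → f ((z ⊕ d) ⊕ e) * f ((z ⊕ d) ⊕ e′)))))
      ≡⟨ E-swap U β _ ⟩
    E β (λ e → E U (λ z → E β (λ e′ → f (z ⊕ e) * f (z ⊕ e′) * E γ (λ d → f ((z ⊕ d) ⊕ e) * f ((z ⊕ d) ⊕ e′)))))
      ≡⟨ E-cong β (λ e → E-swap U β _) ⟩
    E β (λ e → E β (λ e′ → E U (λ z → f (z ⊕ e) * f (z ⊕ e′) * E γ (λ d → f ((z ⊕ d) ⊕ e) * f ((z ⊕ d) ⊕ e′))))) ∎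
    where
    reorder : ∀ a b c d → (a * b) * (c * d) ≡ a * c * (b * d)
    reorder = solve-∀ ℚ-ring
    swap : ∀ x y z → (x ⊕ y) ⊕ z ≡ (x ⊕ z) ⊕ y
    swap = solve 3 (λ x y z → (x :+ y) :+ z ⊜ (x :+ z) :+ y) refl

  -- The argument for `β` with the two sides exchanged through `V-symm`; now the pair `e`, `e′` is
  -- fixed and `H e e′` is the bounded factor.
  sq-V-≤-diffˡ : ∀ γ β f → Bounded f → sq (V γ β f f) ≤ V (diff _⊖_ γ) β f f
  sq-V-≤-diffˡ γ β f bf = begin
    sq (V γ β f f)
      ≡⟨ cong sq (V-symm γ β f) ⟩
    sq (E β (λ e → E β (λ e′ → E U (λ z → H e e′ z * E γ (λ d → H e e′ (z ⊕ d))))))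
      ≤⟨ jensen β _ ⟩
    E β (λ e → sq (E β (λ e′ → E U (λ z → H e e′ z * E γ (λ d → H e e′ (z ⊕ d))))))
      ≤⟨ E-mono β (λ e → jensen β _) ⟩
    E β (λ e → E β (λ e′ → sq (E U (λ z → H e e′ z * E γ (λ d → H e e′ (z ⊕ d))))))
      ≤⟨ E-mono β (λ e → E-mono β (λ e′ → sq-E-weighted (H e e′) _
           (*-bounded (λ z → f (z ⊕ e)) (λ z → f (z ⊕ e′)) (λ z → bf (z ⊕ e)) (λ z → bf (z ⊕ e′))))) ⟩
    E β (λ e → E β (λ e′ → E U (λ z → sq (E γ (λ d → H e e′ (z ⊕ d))))))
      ≡⟨ E-cong β (λ e → E-cong β (λ e′ → E-sq-shift γ (H e e′))) ⟩
    E β (λ e → E β (λ e′ → E U (λ z → H e e′ z * E (diff _⊖_ γ) (λ d → H e e′ (z ⊕ d)))))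
      ≡⟨ V-symm (diff _⊖_ γ) β f ⟨
    V (diff _⊖_ γ) β f f ∎
    where
    H : G → G → G → ℚ
    H e e′ z = f (z ⊕ e) * f (z ⊕ e′)

  double : G → G
  double b = b ⊕ b

  apCount : Prob G → Prob G → (G → ℚ) → (G → ℚ) → (G → ℚ) → ℚ
  apCount β γ g h f = E U (λ x → E β (λ b → E γ (λ c →
    g x * h (x ⊕ (b ⊕ c)) * f ((x ⊕ (b ⊕ c)) ⊕ (b ⊕ c)))))

  pairCount : Prob G → Prob G → (G → ℚ) → (G → ℚ) → ℚ
  pairCount β γ g f = E U (λ x → E β (λ b → E γ (λ c → g x * f (x ⊕ (b ⊕ c)))))

  V-diff-double : ∀ β γ f → V (diff _⊖_ γ) (push double β) f f ≡
    E γ (λ c → E γ (λ c′ → E U (λ z → sq (E β (λ b → f (z ⊕ double b) * f ((z ⊕ double b) ⊕ (c′ ⊖ c)))))))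
  V-diff-double β γ f = trans (E-diff _⊖_ γ _)
    (E-cong γ (λ c → E-cong γ (λ c′ → E-cong U (λ z → cong sq (E-push double β _)))))

  -- Centred at the middle term y, the factor `h y` involves neither half of the step, so the first
  -- Cauchy-Schwarz drops `h` and duplicates `c` alone. Recentred at the first term, the two copies
  -- of `g` no longer involve `b`, so the second one drops them. What is left is `f` at two points
  -- that move together by 2b and differ by `c′ ⊖ c`.
  sq-sq-apCount-≤ : ∀ β γ g h f → Bounded g → Bounded h →
    sq (sq (apCount β γ g h f)) ≤ V (diff _⊖_ γ) (push double β) f f
  sq-sq-apCount-≤ β γ g h f bg bh = begin
    sq (sq (apCount β γ g h f))
      ≤⟨ sq-mono (0≤sq (apCount β γ g h f)) first ⟩
    sq (E γ (λ c → E γ (λ c′ → E U (λ u → (g u * g (u ⊕ (c ⊖ c′))) * S c c′ (u ⊕ double c)))))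
      ≤⟨ jensen γ _ ⟩
    E γ (λ c → sq (E γ (λ c′ → E U (λ u → (g u * g (u ⊕ (c ⊖ c′))) * S c c′ (u ⊕ double c)))))
      ≤⟨ E-mono γ (λ c → jensen γ _) ⟩
    E γ (λ c → E γ (λ c′ → sq (E U (λ u → (g u * g (u ⊕ (c ⊖ c′))) * S c c′ (u ⊕ double c)))))
      ≤⟨ E-mono γ (λ c → E-mono γ (λ c′ →
           sq-E-weighted (λ u → g u * g (u ⊕ (c ⊖ c′))) _ (*-bounded g (λ u → g (u ⊕ (c ⊖ c′))) bg (λ u → bg (u ⊕ (c ⊖ c′)))))) ⟩
    E γ (λ c → E γ (λ c′ → E U (λ u → sq (S c c′ (u ⊕ double c)))))
      ≡⟨ E-cong γ (λ c → E-cong γ (λ c′ → U-invariant (double c) (λ u → sq (S c c′ u)))) ⟩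
    E γ (λ c → E γ (λ c′ → E U (λ u → sq (S c c′ u))))
      ≡⟨ V-diff-double β γ f ⟨
    V (diff _⊖_ γ) (push double β) f f ∎
    where
    S : G → G → G → ℚ
    S c c′ z = E β (λ b → f (z ⊕ double b) * f ((z ⊕ double b) ⊕ (c′ ⊖ c)))

    W : G → G → G → ℚ
    W y b c = g (y ⊖ (b ⊕ c)) * f (y ⊕ (b ⊕ c))

    centre : apCount β γ g h f ≡ E U (λ y → E β (λ b → h y * E γ (W y b)))
    centre = begin-equality
      apCount β γ g h f
        ≡⟨ E-swap U β _ ⟩
      E β (λ b → E U (λ x → E γ (λ c → g x * h (x ⊕ (b ⊕ c)) * f ((x ⊕ (b ⊕ c)) ⊕ (b ⊕ c)))))
        ≡⟨ E-cong β (λ b → E-swap U γ _) ⟩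
      E β (λ b → E γ (λ c → E U (λ x → g x * h (x ⊕ (b ⊕ c)) * f ((x ⊕ (b ⊕ c)) ⊕ (b ⊕ c)))))
        ≡⟨ E-cong β (λ b → E-cong γ (λ c → E-cong U (λ x →
             trans (rearr (g x) _ _)
                   (cong (λ t → h (x ⊕ (b ⊕ c)) * (g t * f ((x ⊕ (b ⊕ c)) ⊕ (b ⊕ c)))) (sym ([x⊕y]⊖y≡x x (b ⊕ c))))))) ⟩
      E β (λ b → E γ (λ c → E U (λ x → h (x ⊕ (b ⊕ c)) * W (x ⊕ (b ⊕ c)) b c)))
        ≡⟨ E-cong β (λ b → E-cong γ (λ c → U-invariant (b ⊕ c) (λ y → h y * W y b c))) ⟩
      E β (λ b → E γ (λ c → E U (λ y → h y * W y b c)))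
        ≡⟨ E-cong β (λ b → E-swap γ U _) ⟩
      E β (λ b → E U (λ y → E γ (λ c → h y * W y b c)))
        ≡⟨ E-swap β U _ ⟩
      E U (λ y → E β (λ b → E γ (λ c → h y * W y b c)))
        ≡⟨ E-cong U (λ y → E-cong β (λ b → E-* γ (h y) (W y b))) ⟩
      E U (λ y → E β (λ b → h y * E γ (W y b))) ∎
      where
      rearr : ∀ a b c → a * b * c ≡ b * (a * c)
      rearr = solve-∀ ℚ-ring

    shiftW : ∀ u b c c′ → W (u ⊕ (b ⊕ c)) b c * W (u ⊕ (b ⊕ c)) b c′ ≡
      (g u * g (u ⊕ (c ⊖ c′))) *
        (f ((u ⊕ double c) ⊕ double b) * f (((u ⊕ double c) ⊕ double b) ⊕ (c′ ⊖ c)))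
    shiftW u b c c′ = trans
      (cong₂ _*_ (cong₂ (λ s t → g s * f t) ([x⊕y]⊖y≡x u (b ⊕ c)) eq₂)
                 (cong₂ (λ s t → g s * f t) eq₁ eq₃))
      (rearr (g u) _ _ _)
      where
      rearr : ∀ a b c d → (a * b) * (c * d) ≡ (a * c) * (b * d)
      rearr = solve-∀ ℚ-ring
      eq₁ : (u ⊕ (b ⊕ c)) ⊖ (b ⊕ c′) ≡ u ⊕ (c ⊖ c′)
      eq₁ = trans (cong (_⊖ (b ⊕ c′)) (trans (cong (λ t → u ⊕ (b ⊕ t)) (sym (x⊕[y⊖x]≡y c′ c)))
              (solve 4 (λ u b c′ t → u :+ (b :+ (c′ :+ t)) ⊜ (u :+ t) :+ (b :+ c′)) refl u b c′ (c ⊖ c′))))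
              ([x⊕y]⊖y≡x (u ⊕ (c ⊖ c′)) (b ⊕ c′))
      eq₂ : (u ⊕ (b ⊕ c)) ⊕ (b ⊕ c) ≡ (u ⊕ double c) ⊕ double b
      eq₂ = solve 3 (λ u b c → (u :+ (b :+ c)) :+ (b :+ c) ⊜ (u :+ (c :+ c)) :+ (b :+ b)) refl u b c
      eq₃ : (u ⊕ (b ⊕ c)) ⊕ (b ⊕ c′) ≡ ((u ⊕ double c) ⊕ double b) ⊕ (c′ ⊖ c)
      eq₃ = trans (cong (λ t → (u ⊕ (b ⊕ c)) ⊕ (b ⊕ t)) (sym (x⊕[y⊖x]≡y c c′)))
              (solve 4 (λ u b c t → (u :+ (b :+ c)) :+ (b :+ (c :+ t)) ⊜ ((u :+ (c :+ c)) :+ (b :+ b)) :+ t)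
                refl u b c (c′ ⊖ c))

    first : sq (apCount β γ g h f) ≤
            E γ (λ c → E γ (λ c′ → E U (λ u → (g u * g (u ⊕ (c ⊖ c′))) * S c c′ (u ⊕ double c))))
    first = begin
      sq (apCount β γ g h f)
        ≡⟨ cong sq centre ⟩
      sq (E U (λ y → E β (λ b → h y * E γ (W y b))))
        ≤⟨ jensen U _ ⟩
      E U (λ y → sq (E β (λ b → h y * E γ (W y b))))
        ≤⟨ E-mono U (λ y → jensen β _) ⟩
      E U (λ y → E β (λ b → sq (h y * E γ (W y b))))
        ≤⟨ E-mono U (λ y → E-mono β (λ b → sq-*-≤ (h y) _ (bh y))) ⟩
      E U (λ y → E β (λ b → sq (E γ (W y b))))
        ≡⟨ E-cong U (λ y → E-cong β (λ b → sq-E γ (W y b))) ⟩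
      E U (λ y → E β (λ b → E γ (λ c → E γ (λ c′ → W y b c * W y b c′))))
        ≡⟨ E-swap U β _ ⟩
      E β (λ b → E U (λ y → E γ (λ c → E γ (λ c′ → W y b c * W y b c′))))
        ≡⟨ E-cong β (λ b → trans (E-swap U γ _) (E-cong γ (λ c → E-swap U γ _))) ⟩
      E β (λ b → E γ (λ c → E γ (λ c′ → E U (λ y → W y b c * W y b c′))))
        ≡⟨ E-cong β (λ b → E-cong γ (λ c → E-cong γ (λ c′ →
             U-invariant (b ⊕ c) (λ y → W y b c * W y b c′)))) ⟨
      E β (λ b → E γ (λ c → E γ (λ c′ → E U (λ u → W (u ⊕ (b ⊕ c)) b c * W (u ⊕ (b ⊕ c)) b c′))))
        ≡⟨ E-cong β (λ b → E-cong γ (λ c → E-cong γ (λ c′ → E-cong U (λ u → shiftW u b c c′)))) ⟩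
      E β (λ b → E γ (λ c → E γ (λ c′ → E U (λ u → T b c c′ u))))
        ≡⟨ E-swap β γ _ ⟩
      E γ (λ c → E β (λ b → E γ (λ c′ → E U (λ u → T b c c′ u))))
        ≡⟨ E-cong γ (λ c → E-swap β γ _) ⟩
      E γ (λ c → E γ (λ c′ → E β (λ b → E U (λ u → T b c c′ u))))
        ≡⟨ E-cong γ (λ c → E-cong γ (λ c′ → E-swap β U _)) ⟩
      E γ (λ c → E γ (λ c′ → E U (λ u → E β (λ b → T b c c′ u))))
        ≡⟨ E-cong γ (λ c → E-cong γ (λ c′ → E-cong U (λ u → E-* β (g u * g (u ⊕ (c ⊖ c′))) _))) ⟩
      E γ (λ c → E γ (λ c′ → E U (λ u → (g u * g (u ⊕ (c ⊖ c′))) * S c c′ (u ⊕ double c)))) ∎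
      where
      T : G → G → G → G → ℚ
      T b c c′ u = (g u * g (u ⊕ (c ⊖ c′))) *
        (f ((u ⊕ double c) ⊕ double b) * f (((u ⊕ double c) ⊕ double b) ⊕ (c′ ⊖ c)))

  -- One Cauchy-Schwarz removes `g`, and no trace of `b` is left. Invariance of `U` reintroduces a
  -- shift by 2b, in order to land on the same `V` as for progressions.
  sq-sq-pairCount-≤ : ∀ β γ g f → Bounded g →
    sq (sq (pairCount β γ g f)) ≤ V (diff _⊖_ γ) (push double β) f f
  sq-sq-pairCount-≤ β γ g f bg = begin
    sq (sq (pairCount β γ g f))
      ≤⟨ sq-mono (0≤sq (pairCount β γ g f)) first ⟩
    sq (E γ (λ c → E γ (λ c′ → E U (F c c′))))
      ≤⟨ jensen γ _ ⟩
    E γ (λ c → sq (E γ (λ c′ → E U (F c c′))))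
      ≤⟨ E-mono γ (λ c → jensen γ _) ⟩
    E γ (λ c → E γ (λ c′ → sq (E U (F c c′))))
      ≡⟨ E-cong γ (λ c → E-cong γ (λ c′ → cong sq (spread c c′))) ⟩
    E γ (λ c → E γ (λ c′ → sq (E U (λ u → E β (λ b → F c c′ (u ⊕ double b))))))
      ≤⟨ E-mono γ (λ c → E-mono γ (λ c′ → jensen U _)) ⟩
    E γ (λ c → E γ (λ c′ → E U (λ u → sq (E β (λ b → F c c′ (u ⊕ double b))))))
      ≡⟨ V-diff-double β γ f ⟨
    V (diff _⊖_ γ) (push double β) f f ∎
    where
    F : G → G → G → ℚ
    F c c′ u = f u * f (u ⊕ (c′ ⊖ c))

    spread : ∀ c c′ → E U (F c c′) ≡ E U (λ u → E β (λ b → F c c′ (u ⊕ double b)))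
    spread c c′ = begin-equality
      E U (F c c′)
        ≡⟨ E-const β (E U (F c c′)) ⟨
      E β (λ b → E U (F c c′))
        ≡⟨ E-cong β (λ b → U-invariant (double b) (F c c′)) ⟨
      E β (λ b → E U (λ u → F c c′ (u ⊕ double b)))
        ≡⟨ E-swap β U _ ⟩
      E U (λ u → E β (λ b → F c c′ (u ⊕ double b))) ∎

    move : ∀ x b c c′ → x ⊕ (b ⊕ c′) ≡ (x ⊕ (b ⊕ c)) ⊕ (c′ ⊖ c)
    move x b c c′ = trans (cong (λ t → x ⊕ (b ⊕ t)) (sym (x⊕[y⊖x]≡y c c′)))
      (solve 4 (λ x b c t → x :+ (b :+ (c :+ t)) ⊜ (x :+ (b :+ c)) :+ t) refl x b c (c′ ⊖ c))

    first : sq (pairCount β γ g f) ≤ E γ (λ c → E γ (λ c′ → E U (F c c′)))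
    first = begin
      sq (pairCount β γ g f)
        ≡⟨ cong sq (E-cong U (λ x → E-cong β (λ b → E-* γ (g x) _))) ⟩
      sq (E U (λ x → E β (λ b → g x * E γ (λ c → f (x ⊕ (b ⊕ c))))))
        ≤⟨ jensen U _ ⟩
      E U (λ x → sq (E β (λ b → g x * E γ (λ c → f (x ⊕ (b ⊕ c))))))
        ≤⟨ E-mono U (λ x → jensen β _) ⟩
      E U (λ x → E β (λ b → sq (g x * E γ (λ c → f (x ⊕ (b ⊕ c))))))
        ≤⟨ E-mono U (λ x → E-mono β (λ b → sq-*-≤ (g x) _ (bg x))) ⟩
      E U (λ x → E β (λ b → sq (E γ (λ c → f (x ⊕ (b ⊕ c))))))
        ≡⟨ E-swap U β _ ⟩
      E β (λ b → E U (λ x → sq (E γ (λ c → f (x ⊕ (b ⊕ c))))))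
        ≡⟨ E-cong β (λ b → E-cong U (λ x → sq-E γ _)) ⟩
      E β (λ b → E U (λ x → E γ (λ c → E γ (λ c′ → f (x ⊕ (b ⊕ c)) * f (x ⊕ (b ⊕ c′))))))
        ≡⟨ E-cong β (λ b → trans (E-swap U γ _) (E-cong γ (λ c → E-swap U γ _))) ⟩
      E β (λ b → E γ (λ c → E γ (λ c′ → E U (λ x → f (x ⊕ (b ⊕ c)) * f (x ⊕ (b ⊕ c′))))))
        ≡⟨ E-cong β (λ b → E-cong γ (λ c → E-cong γ (λ c′ → E-cong U (λ x →
             cong (λ t → f (x ⊕ (b ⊕ c)) * f t) (move x b c c′))))) ⟩
      E β (λ b → E γ (λ c → E γ (λ c′ → E U (λ x → F c c′ (x ⊕ (b ⊕ c))))))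
        ≡⟨ E-cong β (λ b → E-cong γ (λ c → E-cong γ (λ c′ → U-invariant (b ⊕ c) (F c c′)))) ⟩
      E β (λ b → E γ (λ c → E γ (λ c′ → E U (F c c′))))
        ≡⟨ E-const β _ ⟩
      E γ (λ c → E γ (λ c′ → E U (F c c′))) ∎

-- Natural numbers as rationals

nat : ℕ → ℚ
nat zero    = 0ℚ
nat (suc n) = 1ℚ + nat n

nat-+ : ∀ m n → nat (m ℕ.+ n) ≡ nat m + nat n
nat-+ zero    n = sym (+-identityˡ (nat n))
nat-+ (suc m) n = trans (cong (1ℚ +_) (nat-+ m n)) (sym (+-assoc 1ℚ (nat m) (nat n)))

nat-* : ∀ m n → nat (m ℕ.* n) ≡ nat m * nat n
nat-* zero    n = sym (*-zeroˡ (nat n))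
nat-* (suc m) n = trans (nat-+ n (m ℕ.* n)) (trans (cong (nat n +_) (nat-* m n)) (lemma (nat m) (nat n)))
  where
  lemma : ∀ a b → b + a * b ≡ (1ℚ + a) * b
  lemma = solve-∀ ℚ-ring

0≤nat : ∀ n → 0ℚ ≤ nat n
0≤nat zero    = ≤-refl
0≤nat (suc n) = 0≤-+ 0≤1 (0≤nat n)

nat-mono : ∀ {m n} → m ℕ.≤ n → nat m ≤ nat n
nat-mono {n = n} ℕ.z≤n = 0≤nat n
nat-mono (ℕ.s≤s m≤n)   = +-monoʳ-≤ 1ℚ (nat-mono m≤n)

nat-pos : ∀ n → 0ℚ < nat (suc n)
nat-pos n = <-≤-trans (positive⁻¹ 1ℚ) (+-monoʳ-≤ 1ℚ (0≤nat n))

recip : ∀ n .{{_ : ℕ.NonZero n}} → ℚ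
recip (suc n) = (1/ nat (suc n)) {{>-nonZero (nat-pos n)}}

nat*recip : ∀ n .{{_ : ℕ.NonZero n}} → nat n * recip n ≡ 1ℚ
nat*recip (suc n) = *-inverseʳ (nat (suc n)) {{>-nonZero (nat-pos n)}}

0≤recip : ∀ n .{{_ : ℕ.NonZero n}} → 0ℚ ≤ recip n
0≤recip (suc n) = <⇒≤ (positive⁻¹ (recip (suc n)) {{1/pos⇒pos (nat (suc n)) {{positive (nat-pos n)}}}})

-- The uniform measure on Fin p

open CMSum +-0-commutativeMonoid public using (sum; sum-permute)

[_≟_]-ind : ∀ {n} → Fin n → Fin n → ℚ
[ a ≟ b ]-ind = if does (a Finₚ.≟ b) then 1ℚ else 0ℚ

∑-tabulate : ∀ {n} (w : Fin n → ℚ) {X : Set} (g : Fin n → X) (f : X → ℚ) →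
             ∑ (List.tabulate (λ i → w i , g i)) f ≡ sum (λ i → w i * f (g i))
∑-tabulate {zero}  w g f = refl
∑-tabulate {suc n} w g f = +-congˡ (w Fin.zero * f (g Fin.zero)) (∑-tabulate (w ∘ Fin.suc) (g ∘ Fin.suc) f)

tabulate-nonneg : ∀ n {X : Set} (w : Fin n → ℚ) (g : Fin n → X) → (∀ i → 0ℚ ≤ w i) →
                  All (λ a → 0ℚ ≤ proj₁ a) (List.tabulate (λ i → w i , g i))
tabulate-nonneg zero    w g 0≤w = []
tabulate-nonneg (suc n) w g 0≤w = 0≤w Fin.zero ∷ tabulate-nonneg n (w ∘ Fin.suc) (g ∘ Fin.suc) (0≤w ∘ Fin.suc)

sum-cong : ∀ {n} {f g : Fin n → ℚ} → (∀ i → f i ≡ g i) → sum f ≡ sum g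
sum-cong {zero}  eq = refl
sum-cong {suc n} eq = cong₂ _+_ (eq Fin.zero) (sum-cong (eq ∘ Fin.suc))

sum-* : ∀ {n} c (f : Fin n → ℚ) → sum (λ i → c * f i) ≡ c * sum f
sum-* {zero}  c f = sym (*-zeroʳ c)
sum-* {suc n} c f = trans (+-congˡ (c * f Fin.zero) (sum-* c (f ∘ Fin.suc)))
                          (sym (*-distribˡ-+ c (f Fin.zero) (sum (f ∘ Fin.suc))))

sum-ones : ∀ n → sum {n} (λ _ → 1ℚ) ≡ nat n
sum-ones zero    = refl
sum-ones (suc n) = cong (1ℚ +_) (sum-ones n)

sum-zeros : ∀ n (f : Fin n → ℚ) → (∀ i → f i ≡ 0ℚ) → sum f ≡ 0ℚ
sum-zeros zero    f f≡0 = refl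
sum-zeros (suc n) f f≡0 = cong₂ _+_ (f≡0 Fin.zero) (sum-zeros n (f ∘ Fin.suc) (f≡0 ∘ Fin.suc))

sum-ind : ∀ {n} (a : Fin n) (φ : Fin n → ℚ) → sum (λ i → [ a ≟ i ]-ind * φ i) ≡ φ a
sum-ind {suc n} Fin.zero φ =
  trans (cong₂ _+_ (*-identityˡ (φ Fin.zero)) (sum-zeros n _ (λ i → *-zeroˡ (φ (Fin.suc i)))))
        (+-identityʳ (φ Fin.zero))
sum-ind {suc n} (Fin.suc a) φ =
  trans (cong₂ _+_ (*-zeroˡ (φ Fin.zero)) (sum-ind a (φ ∘ Fin.suc))) (+-identityˡ (φ (Fin.suc a)))

module _ (p : ℕ) .{{_ : ℕ.NonZero p}} where

  opaque

    unif : Prob (Fin p)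
    unif = record
      { atoms  = List.tabulate (λ i → recip p , i)
      ; nonneg = tabulate-nonneg p (λ _ → recip p) id (λ _ → 0≤recip p)
      ; mass   = trans (∑-tabulate {p} (λ _ → recip p) id (λ _ → 1ℚ))
                       (trans (sum-* {p} (recip p) (λ _ → 1ℚ))
                              (trans (cong (recip p *_) (sum-ones p)) (trans (*-comm (recip p) (nat p)) (nat*recip p))))
      }

    E-unif : ∀ φ → E unif φ ≡ recip p * sum φ
    E-unif φ = trans (E-∑ unif φ) (trans (∑-tabulate {p} (λ _ → recip p) id φ) (sum-* (recip p) φ))

  p*E-unif : ∀ φ → nat p * E unif φ ≡ sum φ
  p*E-unif φ = begin
    nat p * E unif φ          ≡⟨ cong (nat p *_) (E-unif φ) ⟩
    nat p * (recip p * sum φ) ≡⟨ *-assoc (nat p) (recip p) (sum φ) ⟨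
    nat p * recip p * sum φ   ≡⟨ cong (_* sum φ) (nat*recip p) ⟩
    1ℚ * sum φ                ≡⟨ *-identityˡ (sum φ) ⟩
    sum φ                     ∎
    where open ≡-Reasoning

  E-unif-permute : ∀ (φ : Fin p → ℚ) (g h : Fin p → Fin p) → (∀ x → g (h x) ≡ x) → (∀ x → h (g x) ≡ x) →
                   E unif (φ ∘ g) ≡ E unif φ
  E-unif-permute φ g h gh hg = trans (E-unif (φ ∘ g)) (trans (cong (recip p *_) (sym (sum-permute φ π))) (sym (E-unif φ)))
    where
    π : Permutation p p
    π = permutation g h gh hg

-- Arithmetic modulo p

module Arithmetic (p : ℕ) .{{_ : ℕ.NonZero p}} where

  [_] : ℕ → Fin p
  [ a ] = a mod p

  infixl 6 _⊕_ _⊖_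
  infixl 7 _⊙_

  _⊕_ _⊙_ _⊖_ : Fin p → Fin p → Fin p
  i ⊕ j = addF p i j
  i ⊙ j = [ toℕ i ℕ.* toℕ j ]
  i ⊖ j = i ⊕ [ p ℕ.∸ toℕ j ]

  0ₚ 1ₚ : Fin p
  0ₚ = [ 0 ]
  1ₚ = [ 1 ]

  toℕ-[] : ∀ a → toℕ [ a ] ≡ a ℕ.% p
  toℕ-[] a = Finₚ.toℕ-fromℕ< (m%n<n a p)

  []-cong : ∀ {a b} → a ℕ.% p ≡ b ℕ.% p → [ a ] ≡ [ b ]
  []-cong {a} {b} eq = Finₚ.toℕ-injective (trans (toℕ-[] a) (trans eq (sym (toℕ-[] b))))

  [toℕ] : ∀ i → [ toℕ i ] ≡ i
  [toℕ] i = Finₚ.toℕ-injective (trans (toℕ-[] (toℕ i)) (m<n⇒m%n≡m (Finₚ.toℕ<n i)))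

  []-+ : ∀ a b → [ a ] ⊕ [ b ] ≡ [ a ℕ.+ b ]
  []-+ a b = trans (cong₂ (λ s t → [ s ℕ.+ t ]) (toℕ-[] a) (toℕ-[] b)) ([]-cong (sym (%-distribˡ-+ a b p)))

  []-* : ∀ a b → [ a ] ⊙ [ b ] ≡ [ a ℕ.* b ]
  []-* a b = trans (cong₂ (λ s t → [ s ℕ.* t ]) (toℕ-[] a) (toℕ-[] b)) ([]-cong (sym (%-distribˡ-* a b p)))

  []-+ˡ : ∀ a j → [ a ] ⊕ j ≡ [ a ℕ.+ toℕ j ]
  []-+ˡ a j = trans (cong ([ a ] ⊕_) (sym ([toℕ] j))) ([]-+ a (toℕ j))

  []-+ʳ : ∀ i b → i ⊕ [ b ] ≡ [ toℕ i ℕ.+ b ]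
  []-+ʳ i b = trans (cong (_⊕ [ b ]) (sym ([toℕ] i))) ([]-+ (toℕ i) b)

  []-*ˡ : ∀ a j → [ a ] ⊙ j ≡ [ a ℕ.* toℕ j ]
  []-*ˡ a j = trans (cong ([ a ] ⊙_) (sym ([toℕ] j))) ([]-* a (toℕ j))

  []-*ʳ : ∀ i b → i ⊙ [ b ] ≡ [ toℕ i ℕ.* b ]
  []-*ʳ i b = trans (cong (_⊙ [ b ]) (sym ([toℕ] i))) ([]-* (toℕ i) b)

  ⊕-comm : ∀ i j → i ⊕ j ≡ j ⊕ i
  ⊕-comm i j = cong [_] (ℕₚ.+-comm (toℕ i) (toℕ j))

  ⊕-assoc : ∀ i j k → (i ⊕ j) ⊕ k ≡ i ⊕ (j ⊕ k)
  ⊕-assoc i j k = trans ([]-+ˡ _ k) (trans (cong [_] (ℕₚ.+-assoc (toℕ i) (toℕ j) (toℕ k))) (sym ([]-+ʳ i _)))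

  ⊕-identityˡ : ∀ i → 0ₚ ⊕ i ≡ i
  ⊕-identityˡ i = trans ([]-+ˡ 0 i) ([toℕ] i)

  ⊕-identityʳ : ∀ i → i ⊕ 0ₚ ≡ i
  ⊕-identityʳ i = trans (⊕-comm i 0ₚ) (⊕-identityˡ i)

  ⊕-inverseʳ : ∀ i → i ⊖ i ≡ 0ₚ
  ⊕-inverseʳ i = trans ([]-+ʳ i _) (trans (cong [_] (ℕₚ.m+[n∸m]≡n (ℕₚ.<⇒≤ (Finₚ.toℕ<n i)))) ([]-cong ([m+n]%n≡m%n 0 p)))

  x⊕[y⊖x]≡y : ∀ x y → x ⊕ (y ⊖ x) ≡ y
  x⊕[y⊖x]≡y x y = begin
    x ⊕ (y ⊕ nx) ≡⟨ ⊕-comm x (y ⊕ nx) ⟩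
    (y ⊕ nx) ⊕ x ≡⟨ ⊕-assoc y nx x ⟩
    y ⊕ (nx ⊕ x) ≡⟨ cong (y ⊕_) (trans (⊕-comm nx x) (⊕-inverseʳ x)) ⟩
    y ⊕ 0ₚ       ≡⟨ ⊕-identityʳ y ⟩
    y            ∎
    where
    open ≡-Reasoning
    nx = [ p ℕ.∸ toℕ x ]

  [x⊕y]⊖y≡x : ∀ x y → (x ⊕ y) ⊖ y ≡ x
  [x⊕y]⊖y≡x x y = trans (⊕-assoc x y _) (trans (cong (x ⊕_) (⊕-inverseʳ y)) (⊕-identityʳ x))

  [x⊖y]⊕y≡x : ∀ x y → (x ⊖ y) ⊕ y ≡ x
  [x⊖y]⊕y≡x x y = trans (⊕-comm (x ⊖ y) y) (x⊕[y⊖x]≡y y x)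

  ⊕-cancelˡ : ∀ x {y z} → x ⊕ y ≡ x ⊕ z → y ≡ z
  ⊕-cancelˡ x {y} {z} eq = begin
    y           ≡⟨ [x⊕y]⊖y≡x y x ⟨
    (y ⊕ x) ⊖ x ≡⟨ cong (_⊖ x) (trans (⊕-comm y x) (trans eq (⊕-comm x z))) ⟩
    (z ⊕ x) ⊖ x ≡⟨ [x⊕y]⊖y≡x z x ⟩
    z           ∎
    where open ≡-Reasoning

  ⊙-comm : ∀ i j → i ⊙ j ≡ j ⊙ i
  ⊙-comm i j = cong [_] (ℕₚ.*-comm (toℕ i) (toℕ j))

  ⊙-assoc : ∀ i j k → (i ⊙ j) ⊙ k ≡ i ⊙ (j ⊙ k)
  ⊙-assoc i j k = trans ([]-*ˡ _ k) (trans (cong [_] (ℕₚ.*-assoc (toℕ i) (toℕ j) (toℕ k))) (sym ([]-*ʳ i _)))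

  ⊙-identityʳ : ∀ i → i ⊙ 1ₚ ≡ i
  ⊙-identityʳ i = trans ([]-*ʳ i 1) (trans (cong [_] (ℕₚ.*-identityʳ (toℕ i))) ([toℕ] i))

  ⊙-zeroʳ : ∀ i → i ⊙ 0ₚ ≡ 0ₚ
  ⊙-zeroʳ i = trans ([]-*ʳ i 0) (cong [_] (ℕₚ.*-zeroʳ (toℕ i)))

  ⊙-zeroˡ : ∀ i → 0ₚ ⊙ i ≡ 0ₚ
  ⊙-zeroˡ i = trans (⊙-comm 0ₚ i) (⊙-zeroʳ i)

  ⊙-distribˡ : ∀ i j k → i ⊙ (j ⊕ k) ≡ i ⊙ j ⊕ i ⊙ k
  ⊙-distribˡ i j k = trans ([]-*ʳ i _) (trans (cong [_] (ℕₚ.*-distribˡ-+ (toℕ i) (toℕ j) (toℕ k))) (sym ([]-+ _ _)))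

  ⊙-distribʳ : ∀ i j k → (j ⊕ k) ⊙ i ≡ j ⊙ i ⊕ k ⊙ i
  ⊙-distribʳ i j k = trans (⊙-comm (j ⊕ k) i) (trans (⊙-distribˡ i j k) (cong₂ _⊕_ (⊙-comm i j) (⊙-comm i k)))

  -- Bézout for `p` and the representative of `x`, which is positive and below `p`. Over ℕ the
  -- identity comes in two sign patterns; in the second one the coefficient has to be negated.
  inverse : Prime p → ∀ x → x ≢ 0ₚ → ∃[ y ] x ⊙ y ≡ 1ₚ
  inverse pr x x≢0 = go (toℕ x) refl
    where
    go : ∀ t → toℕ x ≡ t → ∃[ y ] x ⊙ y ≡ 1ₚ
    go zero    eq = ⊥-elim (x≢0 (trans (sym ([toℕ] x)) (cong [_] eq)))
    go (suc n) eq with coprime-Bézout (prime⇒coprime pr (subst (ℕ._< p) eq (Finₚ.toℕ<n x)))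
    ...   | Bézout.-+ a b 1+ap≡bx = [ b ] , trans ([]-*ʳ x b) (begin
      [ toℕ x ℕ.* b ]   ≡⟨ cong (λ t → [ t ℕ.* b ]) eq ⟩
      [ suc n ℕ.* b ]   ≡⟨ cong [_] (ℕₚ.*-comm (suc n) b) ⟩
      [ b ℕ.* suc n ]   ≡⟨ cong [_] 1+ap≡bx ⟨
      [ 1 ℕ.+ a ℕ.* p ] ≡⟨ []-cong ([m+kn]%n≡m%n 1 a p) ⟩
      1ₚ                ∎)
      where open ≡-Reasoning
    ...   | Bézout.+- a b 1+bx≡ap = (0ₚ ⊖ [ b ]) , ⊕-cancelˡ (x ⊙ [ b ]) (begin
      x ⊙ [ b ] ⊕ x ⊙ (0ₚ ⊖ [ b ])   ≡⟨ ⊙-distribˡ x [ b ] (0ₚ ⊖ [ b ]) ⟨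
      x ⊙ ([ b ] ⊕ (0ₚ ⊖ [ b ]))     ≡⟨ cong (x ⊙_) (x⊕[y⊖x]≡y [ b ] 0ₚ) ⟩
      x ⊙ 0ₚ                         ≡⟨ ⊙-zeroʳ x ⟩
      0ₚ                             ≡⟨ []-cong ([m+kn]%n≡m%n 0 a p) ⟨
      [ a ℕ.* p ]                    ≡⟨ cong [_] 1+bx≡ap ⟨
      [ 1 ℕ.+ b ℕ.* suc n ]          ≡⟨ cong [_] (trans (ℕₚ.+-comm 1 _) (cong (ℕ._+ 1) (trans (ℕₚ.*-comm b (suc n)) (cong (ℕ._* b) (sym eq))))) ⟩
      [ toℕ x ℕ.* b ℕ.+ 1 ]          ≡⟨ []-+ _ 1 ⟨
      [ toℕ x ℕ.* b ] ⊕ 1ₚ           ≡⟨ cong (_⊕ 1ₚ) ([]-*ʳ x b) ⟨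
      x ⊙ [ b ] ⊕ 1ₚ                 ∎)
      where open ≡-Reasoning

  U : ∀ n → Prob (Vec (Fin p) n)
  U n = unif p ^ n

  unif-invariant : ∀ g f → E (unif p) (λ u → f (u ⊕ g)) ≡ E (unif p) f
  unif-invariant g f = E-unif-permute p f (_⊕ g) (_⊖ g) (λ x → [x⊖y]⊕y≡x x g) (λ x → [x⊕y]⊖y≡x x g)

  infixl 6 _⊞_ _⊟_

  _⊞_ _⊟_ : ∀ {n} → Vec (Fin p) n → Vec (Fin p) n → Vec (Fin p) n
  _⊞_ = zipWith _⊕_
  _⊟_ = zipWith _⊖_

  0ᵥ : ∀ {n} → Vec (Fin p) n
  0ᵥ {n} = replicate n 0ₚ

  ⊞-isCommutativeMonoid : ∀ {n} → IsCommutativeMonoid _≡_ (_⊞_ {n}) 0ᵥ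
  ⊞-isCommutativeMonoid = record
    { isMonoid = record
      { isSemigroup = record
        { isMagma = record { isEquivalence = isEquivalence ; ∙-cong = cong₂ _⊞_ }
        ; assoc   = Vecₚ.zipWith-assoc ⊕-assoc }
      ; identity = Vecₚ.zipWith-identityˡ ⊕-identityˡ , Vecₚ.zipWith-identityʳ ⊕-identityʳ }
    ; comm = Vecₚ.zipWith-comm ⊕-comm }

  x⊞[y⊟x]≡y : ∀ {n} (x y : Vec (Fin p) n) → x ⊞ (y ⊟ x) ≡ y
  x⊞[y⊟x]≡y []       []       = refl
  x⊞[y⊟x]≡y (x ∷ xs) (y ∷ ys) = cong₂ _∷_ (x⊕[y⊖x]≡y x y) (x⊞[y⊟x]≡y xs ys)

  [x⊞y]⊟y≡x : ∀ {n} (x y : Vec (Fin p) n) → (x ⊞ y) ⊟ y ≡ x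
  [x⊞y]⊟y≡x []       []       = refl
  [x⊞y]⊟y≡x (x ∷ xs) (y ∷ ys) = cong₂ _∷_ ([x⊕y]⊖y≡x x y) ([x⊞y]⊟y≡x xs ys)

  U-invariant : ∀ {n} (g : Vec (Fin p) n) f → E (U n) (λ u → f (u ⊞ g)) ≡ E (U n) f
  U-invariant []       f = trans (E-[] (unif p) (λ u → f (u ⊞ []))) (sym (E-[] (unif p) f))
  U-invariant {suc n} (g ∷ gs) f = begin
    E (U (suc n)) (λ u → f (u ⊞ (g ∷ gs)))
      ≡⟨ E-∷ (unif p) n _ ⟩
    E (unif p) (λ x → E (U n) (λ xs → f ((x ⊕ g) ∷ (xs ⊞ gs))))
      ≡⟨ E-cong (unif p) (λ x → U-invariant gs (λ xs → f ((x ⊕ g) ∷ xs))) ⟩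
    E (unif p) (λ x → E (U n) (λ xs → f ((x ⊕ g) ∷ xs)))
      ≡⟨ unif-invariant g (λ x → E (U n) (λ xs → f (x ∷ xs))) ⟩
    E (unif p) (λ x → E (U n) (λ xs → f (x ∷ xs)))
      ≡⟨ E-∷ (unif p) n f ⟨
    E (U (suc n)) f ∎
    where open ≡-Reasoning

-- Bounds on absolute values

Within : ℚ → ℚ → Set
Within b a = a ≤ b × - a ≤ b

2*-cancel-≤ : ∀ {a b} → 2ℚ * a ≤ 2ℚ * b → a ≤ b
2*-cancel-≤ = *-cancelˡ-≤-pos 2ℚ

within-neg : ∀ {b a} → Within b a → Within b (- a)
within-neg {b} {a} (a≤b , -a≤b) = -a≤b , subst (_≤ b) (sym (neg-involutive a)) a≤b
  where
  neg-involutive : ∀ a → - (- a) ≡ a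
  neg-involutive = solve-∀ ℚ-ring

-- Twice the gap is (b - a)(d + c) + (b + a)(d - c), all four factors being nonnegative; no case
-- distinction on signs arises.
within-*-≤ : ∀ {b a d c} → Within b a → Within d c → a * c ≤ b * d
within-*-≤ {b} {a} {d} {c} (a≤b , -a≤b) (c≤d , -c≤d) = 2*-cancel-≤
  (≤-by ((b - a) * (d - (- c)) + (b - (- a)) * (d - c)) (lemma a b c d)
    (0≤-+ (0≤-* (0≤-sub a≤b) (0≤-sub -c≤d)) (0≤-* (0≤-sub -a≤b) (0≤-sub c≤d))))
  where
  lemma : ∀ a b c d → 2ℚ * (b * d) ≡ 2ℚ * (a * c) + ((b - a) * (d - (- c)) + (b - (- a)) * (d - c))
  lemma = solve-∀ ℚ-ring

within-* : ∀ {b a d c} → Within b a → Within d c → Within (b * d) (a * c)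
within-* {b} {a} {d} {c} wa wc = within-*-≤ wa wc , subst (_≤ b * d) (lemma a c) (within-*-≤ (within-neg {b} {a} wa) wc)
  where
  lemma : ∀ a c → (- a) * c ≡ - (a * c)
  lemma = solve-∀ ℚ-ring

within-E : ∀ {X : Set} (μ : Prob X) {b a : X → ℚ} → (∀ x → Within (b x) (a x)) → Within (E μ b) (E μ a)
within-E μ {b} {a} w = E-mono μ (proj₁ ∘ w) ,
  ≤-trans (≤-reflexive (sym (E-neg μ a))) (E-mono μ (proj₂ ∘ w))

within-E-const : ∀ {X : Set} (μ : Prob X) {b} {a : X → ℚ} → (∀ x → Within b (a x)) → Within b (E μ a)
within-E-const μ {b} {a} w = subst (λ t → Within t (E μ a)) (E-const μ b) (within-E μ w)

-- Fourier analysis modulo p, with the nontrivial characters of F_p summed into one rational kernel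

module Fourier (p : ℕ) .{{_ : ℕ.NonZero p}} (pr : Prime p) where

  open Arithmetic p

  dot : ∀ {k} → Vec (Fin p) k → Vec (Fin p) k → Fin p
  dot []      []      = 0ₚ
  dot (c ∷ ℓ) (x ∷ r) = c ⊙ x ⊕ dot ℓ r

  ⊕-interchange : ∀ a b c d → (a ⊕ b) ⊕ (c ⊕ d) ≡ (a ⊕ c) ⊕ (b ⊕ d)
  ⊕-interchange a b c d = begin
    (a ⊕ b) ⊕ (c ⊕ d) ≡⟨ ⊕-assoc a b (c ⊕ d) ⟩
    a ⊕ (b ⊕ (c ⊕ d)) ≡⟨ cong (a ⊕_) (trans (sym (⊕-assoc b c d)) (trans (cong (_⊕ d) (⊕-comm b c)) (⊕-assoc c b d))) ⟩
    a ⊕ (c ⊕ (b ⊕ d)) ≡⟨ ⊕-assoc a c (b ⊕ d) ⟨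
    (a ⊕ c) ⊕ (b ⊕ d) ∎
    where open ≡-Reasoning

  dot-⊞ : ∀ {k} (ℓ x y : Vec (Fin p) k) → dot ℓ (x ⊞ y) ≡ dot ℓ x ⊕ dot ℓ y
  dot-⊞ []      []       []       = sym (⊕-identityˡ 0ₚ)
  dot-⊞ (c ∷ ℓ) (x ∷ xs) (y ∷ ys) = trans (cong₂ _⊕_ (⊙-distribˡ c x y) (dot-⊞ ℓ xs ys))
    (⊕-interchange (c ⊙ x) (c ⊙ y) (dot ℓ xs) (dot ℓ ys))

  dot-0ᵥ : ∀ {k} (ℓ : Vec (Fin p) k) → dot ℓ 0ᵥ ≡ 0ₚ
  dot-0ᵥ []      = refl
  dot-0ᵥ (c ∷ ℓ) = trans (cong₂ _⊕_ (⊙-zeroʳ c) (dot-0ᵥ ℓ)) (⊕-identityˡ 0ₚ)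

  ind-cong : ∀ {a b c d : Fin p} → (a ≡ b → c ≡ d) → (c ≡ d → a ≡ b) → [ a ≟ b ]-ind ≡ [ c ≟ d ]-ind
  ind-cong {a} {b} {c} {d} to from with a Finₚ.≟ b | c Finₚ.≟ d
  ... | yes _   | yes _   = refl
  ... | no _    | no _    = refl
  ... | yes a≡b | no c≢d  = ⊥-elim (c≢d (to a≡b))
  ... | no a≢b  | yes c≡d = ⊥-elim (a≢b (from c≡d))

  -- K α β is the sum of ζ^(α − β) over the p-th roots of unity ζ ≠ 1.
  K : Fin p → Fin p → ℚ
  K α β = nat p * [ α ≟ β ]-ind - 1ℚ

  K-cong : ∀ {a b c d : Fin p} → (a ≡ b → c ≡ d) → (c ≡ d → a ≡ b) → K a b ≡ K c d
  K-cong to from = cong (λ t → nat p * t - 1ℚ) (ind-cong to from)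

  K-symm : ∀ α β → K α β ≡ K β α
  K-symm α β = K-cong {α} {β} {β} {α} sym sym

  K-shift : ∀ γ α β → K (γ ⊕ α) (γ ⊕ β) ≡ K α β
  K-shift γ α β = K-cong (⊕-cancelˡ γ) (cong (γ ⊕_))

  E-ind : ∀ α (φ : Fin p → ℚ) → nat p * E (unif p) (λ s → [ α ≟ s ]-ind * φ s) ≡ φ α
  E-ind α φ = trans (p*E-unif p _) (sum-ind α φ)

  -- Leaving out the trivial character makes averaging against `K` the projection onto functions of
  -- mean zero.
  E-K* : ∀ α (φ : Fin p → ℚ) → E (unif p) (λ s → K α s * φ s) ≡ φ α - E (unif p) φ
  E-K* α φ = begin
    E (unif p) (λ s → K α s * φ s)
      ≡⟨ E-cong (unif p) (λ s → expand (nat p) _ (φ s)) ⟩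
    E (unif p) (λ s → nat p * ([ α ≟ s ]-ind * φ s) - φ s)
      ≡⟨ E-sub (unif p) _ φ ⟩
    E (unif p) (λ s → nat p * ([ α ≟ s ]-ind * φ s)) - E (unif p) φ
      ≡⟨ cong (_- E (unif p) φ) (trans (E-* (unif p) (nat p) _) (E-ind α φ)) ⟩
    φ α - E (unif p) φ ∎
    where
    open ≡-Reasoning
    expand : ∀ n d f → (n * d - 1ℚ) * f ≡ n * (d * f) - f
    expand = solve-∀ ℚ-ring

  E-K : ∀ α → E (unif p) (K α) ≡ 0ℚ
  E-K α = begin
    E (unif p) (K α)                   ≡⟨ E-cong (unif p) (λ s → sym (*-identityʳ (K α s))) ⟩
    E (unif p) (λ s → K α s * 1ℚ)      ≡⟨ E-K* α (λ _ → 1ℚ) ⟩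
    1ℚ - E (unif p) (λ _ → 1ℚ)         ≡⟨ cong (λ t → 1ℚ - t) (E-const (unif p) 1ℚ) ⟩
    0ℚ                                 ∎
    where open ≡-Reasoning

  E-K-K : ∀ α β → E (unif p) (λ s → K α s * K s β) ≡ K α β
  E-K-K α β = begin
    E (unif p) (λ s → K α s * K s β)   ≡⟨ E-K* α (λ s → K s β) ⟩
    K α β - E (unif p) (λ s → K s β)   ≡⟨ cong (λ t → K α β - t) (trans (E-cong (unif p) (λ s → K-symm s β)) (E-K β)) ⟩
    K α β - 0ℚ                         ≡⟨ +-identityʳ (K α β) ⟩
    K α β                              ∎
    where open ≡-Reasoning

  -- The equation is c(x - x′) = β - α, and x - x′ is invertible because `p` is prime.
  ⊙⊕-solution : ∀ {x x′} α β → x ≢ x′ → ∃[ c₀ ] (∀ c → c ⊙ x ⊕ α ≡ c ⊙ x′ ⊕ β → c₀ ≡ c) × (∀ c → c₀ ≡ c → c ⊙ x ⊕ α ≡ c ⊙ x′ ⊕ β)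
  ⊙⊕-solution {x} {x′} α β x≢x′ = (β ⊖ α) ⊙ y , unique , solves
    where
    open ≡-Reasoning
    δ = x ⊖ x′
    δ≢0 : δ ≢ 0ₚ
    δ≢0 δ≡0 = x≢x′ (trans (sym (x⊕[y⊖x]≡y x′ x)) (trans (cong (x′ ⊕_) δ≡0) (⊕-identityʳ x′)))
    y = proj₁ (inverse pr δ δ≢0)
    δy≡1 = proj₂ (inverse pr δ δ≢0)
    split : ∀ c → c ⊙ x ⊕ α ≡ c ⊙ x′ ⊕ (α ⊕ c ⊙ δ)
    split c = begin
      c ⊙ x ⊕ α                ≡⟨ cong (λ t → c ⊙ t ⊕ α) (x⊕[y⊖x]≡y x′ x) ⟨
      c ⊙ (x′ ⊕ δ) ⊕ α         ≡⟨ cong (_⊕ α) (⊙-distribˡ c x′ δ) ⟩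
      (c ⊙ x′ ⊕ c ⊙ δ) ⊕ α     ≡⟨ ⊕-assoc _ _ α ⟩
      c ⊙ x′ ⊕ (c ⊙ δ ⊕ α)     ≡⟨ cong (c ⊙ x′ ⊕_) (⊕-comm (c ⊙ δ) α) ⟩
      c ⊙ x′ ⊕ (α ⊕ c ⊙ δ)     ∎
    unique : ∀ c → c ⊙ x ⊕ α ≡ c ⊙ x′ ⊕ β → (β ⊖ α) ⊙ y ≡ c
    unique c eq = begin
      (β ⊖ α) ⊙ y              ≡⟨ cong (λ t → (t ⊖ α) ⊙ y) (⊕-cancelˡ (c ⊙ x′) (trans (sym (split c)) eq)) ⟨
      ((α ⊕ c ⊙ δ) ⊖ α) ⊙ y    ≡⟨ cong (λ t → (t ⊖ α) ⊙ y) (⊕-comm α (c ⊙ δ)) ⟩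
      ((c ⊙ δ ⊕ α) ⊖ α) ⊙ y    ≡⟨ cong (_⊙ y) ([x⊕y]⊖y≡x (c ⊙ δ) α) ⟩
      c ⊙ δ ⊙ y                ≡⟨ ⊙-assoc c δ y ⟩
      c ⊙ (δ ⊙ y)              ≡⟨ cong (c ⊙_) δy≡1 ⟩
      c ⊙ 1ₚ                   ≡⟨ ⊙-identityʳ c ⟩
      c                        ∎
    solves : ∀ c → (β ⊖ α) ⊙ y ≡ c → c ⊙ x ⊕ α ≡ c ⊙ x′ ⊕ β
    solves c refl = trans (split c) (cong (c ⊙ x′ ⊕_) (begin
      α ⊕ (β ⊖ α) ⊙ y ⊙ δ      ≡⟨ cong (α ⊕_) (⊙-assoc (β ⊖ α) y δ) ⟩
      α ⊕ (β ⊖ α) ⊙ (y ⊙ δ)    ≡⟨ cong (λ t → α ⊕ (β ⊖ α) ⊙ t) (trans (⊙-comm y δ) δy≡1) ⟩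
      α ⊕ (β ⊖ α) ⊙ 1ₚ         ≡⟨ cong (α ⊕_) (⊙-identityʳ (β ⊖ α)) ⟩
      α ⊕ (β ⊖ α)              ≡⟨ x⊕[y⊖x]≡y α β ⟩
      β                        ∎))

  -- For x ≠ x′ the two arguments agree for exactly one `c`, so the average runs over a full row of
  -- `K` and vanishes.
  E-K-affine : ∀ x x′ α β → E (unif p) (λ c → K (c ⊙ x ⊕ α) (c ⊙ x′ ⊕ β)) ≡ [ x ≟ x′ ]-ind * K α β
  E-K-affine x x′ α β with x Finₚ.≟ x′
  ... | yes refl = trans (E-cong (unif p) (λ c → K-shift (c ⊙ x) α β))
                         (trans (E-const (unif p) (K α β)) (sym (*-identityˡ (K α β))))
  ... | no x≢x′  = let c₀ , unique , solves = ⊙⊕-solution α β x≢x′ in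
    trans (E-cong (unif p) (λ c → K-cong (unique c) (solves c))) (trans (E-K c₀) (sym (*-zeroˡ (K α β))))

  -- Averaging over the coefficients of `ℓ` one by one forces r = r′. The offsets `α` and `β` carry
  -- the part of the dot products that has been peeled off, which is what makes the induction on
  -- coordinates go through.
  fourier-inversion : ∀ {k} (φ : Vec (Fin p) k → ℚ) r α β →
    nat (p ℕ.^ k) * E (U k) (λ ℓ → E (U k) (λ r′ → φ r′ * K (dot ℓ r ⊕ α) (dot ℓ r′ ⊕ β))) ≡ φ r * K α β
  fourier-inversion {zero} φ [] α β = begin
    nat 1 * E (U 0) (λ ℓ → E (U 0) (λ r′ → φ r′ * K (dot ℓ [] ⊕ α) (dot ℓ r′ ⊕ β)))
      ≡⟨ *-identityˡ (E (U 0) I) ⟩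
    E (U 0) I
      ≡⟨ trans (E-[] (unif p) I) (E-[] (unif p) (λ r′ → φ r′ * K (dot [] [] ⊕ α) (dot [] r′ ⊕ β))) ⟩
    φ [] * K (0ₚ ⊕ α) (0ₚ ⊕ β)
      ≡⟨ cong (φ [] *_) (K-shift 0ₚ α β) ⟩
    φ [] * K α β ∎
    where
    open ≡-Reasoning
    I : Vec (Fin p) 0 → ℚ
    I ℓ = E (U 0) (λ r′ → φ r′ * K (dot ℓ [] ⊕ α) (dot ℓ r′ ⊕ β))
  fourier-inversion {suc k} φ (x ∷ r) α β = begin
    nat (p ℕ.* p ℕ.^ k) * E (U (suc k)) (λ ℓ → E (U (suc k)) (λ r′ → φ r′ * K (dot ℓ (x ∷ r) ⊕ α) (dot ℓ r′ ⊕ β)))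
      ≡⟨ cong₂ _*_ (nat-* p (p ℕ.^ k)) (trans (E-∷ u k _) (E-cong u (λ c → E-cong (U k) (λ ℓ → E-∷ u k _)))) ⟩
    nat p * q * E u (λ c → E (U k) (λ ℓ → E u (λ x′ → E (U k) (λ r′ → φ (x′ ∷ r′) * K (dot (c ∷ ℓ) (x ∷ r) ⊕ α) (dot (c ∷ ℓ) (x′ ∷ r′) ⊕ β)))))
      ≡⟨ cong (nat p * q *_) (E-cong u (λ c → E-cong (U k) (λ ℓ → E-cong u (λ x′ → E-cong (U k) (λ r′ →
           cong (φ (x′ ∷ r′) *_) (cong₂ K (rotate c x (dot ℓ r) α) (rotate c x′ (dot ℓ r′) β))))))) ⟩
    nat p * q * E u (λ c → E (U k) (λ ℓ → E u (λ x′ → E (U k) (λ r′ → φ (x′ ∷ r′) * K (dot ℓ r ⊕ (c ⊙ x ⊕ α)) (dot ℓ r′ ⊕ (c ⊙ x′ ⊕ β))))))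
      ≡⟨ cong (nat p * q *_) (E-cong u (λ c → E-swap (U k) u _)) ⟩
    nat p * q * E u (λ c → E u (λ x′ → I c x′))
      ≡⟨ *-assoc (nat p) q _ ⟩
    nat p * (q * E u (λ c → E u (λ x′ → I c x′)))
      ≡⟨ cong (nat p *_) (trans (sym (E-* u q _)) (E-cong u (λ c → sym (E-* u q _)))) ⟩
    nat p * E u (λ c → E u (λ x′ → q * I c x′))
      ≡⟨ cong (nat p *_) (E-cong u (λ c → E-cong u (λ x′ →
           fourier-inversion (λ r′ → φ (x′ ∷ r′)) r (c ⊙ x ⊕ α) (c ⊙ x′ ⊕ β)))) ⟩
    nat p * E u (λ c → E u (λ x′ → φ (x′ ∷ r) * K (c ⊙ x ⊕ α) (c ⊙ x′ ⊕ β)))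
      ≡⟨ cong (nat p *_) (trans (E-swap u u _) (E-cong u (λ x′ → E-* u (φ (x′ ∷ r)) _))) ⟩
    nat p * E u (λ x′ → φ (x′ ∷ r) * E u (λ c → K (c ⊙ x ⊕ α) (c ⊙ x′ ⊕ β)))
      ≡⟨ cong (nat p *_) (E-cong u (λ x′ → trans (cong (φ (x′ ∷ r) *_) (E-K-affine x x′ α β)) (rearr (φ (x′ ∷ r)) [ x ≟ x′ ]-ind (K α β)))) ⟩
    nat p * E u (λ x′ → [ x ≟ x′ ]-ind * (φ (x′ ∷ r) * K α β))
      ≡⟨ E-ind x (λ x′ → φ (x′ ∷ r) * K α β) ⟩
    φ (x ∷ r) * K α β ∎
    where
    open ≡-Reasoning
    u = unif p
    q = nat (p ℕ.^ k)
    I : Fin p → Fin p → ℚ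
    I c x′ = E (U k) (λ ℓ → E (U k) (λ r′ → φ (x′ ∷ r′) * K (dot ℓ r ⊕ (c ⊙ x ⊕ α)) (dot ℓ r′ ⊕ (c ⊙ x′ ⊕ β))))
    rearr : ∀ a b c → a * (b * c) ≡ b * (a * c)
    rearr = solve-∀ ℚ-ring
    rotate : ∀ c x d α → (c ⊙ x ⊕ d) ⊕ α ≡ d ⊕ (c ⊙ x ⊕ α)
    rotate c x d α = trans (cong (_⊕ α) (⊕-comm (c ⊙ x) d)) (⊕-assoc d (c ⊙ x) α)

  K-within : ∀ α β → Within (nat p) (K α β)
  K-within α β with does (α Finₚ.≟ β)
  ... | true  = ≤-by 1ℚ (l₁ (nat p)) 0≤1 ,
                ≤-by (nat p + (nat p - 1ℚ)) (l₂ (nat p)) (0≤-+ (0≤nat p) (0≤-sub 1≤p))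
    where
    1≤p : 1ℚ ≤ nat p
    1≤p = ≤-trans (≤-reflexive (sym (+-identityʳ 1ℚ))) (nat-mono (ℕ.>-nonZero⁻¹ p))
    l₁ : ∀ n → n ≡ (n * 1ℚ - 1ℚ) + 1ℚ
    l₁ = solve-∀ ℚ-ring
    l₂ : ∀ n → n ≡ - (n * 1ℚ - 1ℚ) + (n + (n - 1ℚ))
    l₂ = solve-∀ ℚ-ring
  ... | false = ≤-by (nat p + 1ℚ) (l₁ (nat p)) (0≤-+ (0≤nat p) 0≤1) ,
                ≤-by (nat p - 1ℚ) (l₂ (nat p)) (0≤-sub 1≤p)
    where
    1≤p : 1ℚ ≤ nat p
    1≤p = ≤-trans (≤-reflexive (sym (+-identityʳ 1ℚ))) (nat-mono (ℕ.>-nonZero⁻¹ p))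
    l₁ : ∀ n → n ≡ (n * 0ℚ - 1ℚ) + (n + 1ℚ)
    l₁ = solve-∀ ℚ-ring
    l₂ : ∀ n → n ≡ - (n * 0ℚ - 1ℚ) + (n - 1ℚ)
    l₂ = solve-∀ ℚ-ring

-- Since |a| = 2 max(a, 0) - a, an upper bound for `a` bounds |a| by a quantity that is affine in
-- `a`, so its average needs only the mean of `a`.
within-abs : ∀ {κ a} → a ≤ κ → 0ℚ ≤ κ → Within (2ℚ * κ - a) a
within-abs {κ} {a} a≤κ 0≤κ =
  ≤-by ((κ - a) + (κ - a)) (l₁ κ a) (0≤-+ (0≤-sub a≤κ) (0≤-sub a≤κ)) ,
  ≤-by (2ℚ * κ) (l₂ κ a) (0≤-* 0≤2 0≤κ)
  where
  l₁ : ∀ κ a → 2ℚ * κ - a ≡ a + ((κ - a) + (κ - a))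
  l₁ = solve-∀ ℚ-ring
  l₂ : ∀ κ a → 2ℚ * κ - a ≡ - a + 2ℚ * κ
  l₂ = solve-∀ ℚ-ring

sq-within : ∀ {a} → Within 1ℚ a → sq a ≤ 1ℚ
sq-within {a} w = within-*-≤ {1ℚ} {a} {1ℚ} {a} w w

within-AM-GM : ∀ a b → Within (sq a + sq b) (2ℚ * (a * b))
within-AM-GM a b = ≤-by (sq (a - b)) (l₁ a b) (0≤sq (a - b)) , ≤-by (sq (a + b)) (l₂ a b) (0≤sq (a + b))
  where
  l₁ : ∀ a b → a * a + b * b ≡ 2ℚ * (a * b) + (a - b) * (a - b)
  l₁ = solve-∀ ℚ-ring
  l₂ : ∀ a b → a * a + b * b ≡ - (2ℚ * (a * b)) + (a + b) * (a + b)
  l₂ = solve-∀ ℚ-ring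

-- Autocorrelation and Fourier coefficients

module Correlation (p : ℕ) .{{_ : ℕ.NonZero p}} (pr : Prime p) where

  open Arithmetic p
  open Fourier p pr
  open ≡-Reasoning

  module _ {k : ℕ} where

    open IsCommutativeMonoid (⊞-isCommutativeMonoid {k}) using () renaming (assoc to ⊞-assoc; comm to ⊞-comm; identityʳ to ⊞-identityʳ)

    corr : (Vec (Fin p) k → ℚ) → Vec (Fin p) k → ℚ
    corr f r = E (U k) (λ u → f u * f (u ⊞ r))

    -- In Fourier terms, the sum of |f̂(ξ)|² |ĝ(ξ)|² over all frequencies ξ.
    crossEnergy : (Vec (Fin p) k → ℚ) → (Vec (Fin p) k → ℚ) → ℚ
    crossEnergy f g = E (U k) (λ s → sq (E (U k) (λ u → f u * g (u ⊞ s))))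

    U-invariantˡ : ∀ (g : Vec (Fin p) k) f → E (U k) (λ u → f (g ⊞ u)) ≡ E (U k) f
    U-invariantˡ g f = trans (E-cong (U k) (λ u → cong f (⊞-comm g u))) (U-invariant g f)

    -- Both sides average f(u) f(u + r) g(u + s) g(u + r + s) over u, r and s.
    crossEnergy-corr : ∀ f g → crossEnergy f g ≡ E (U k) (λ r → corr f r * corr g r)
    crossEnergy-corr f g = begin
      E (U k) (λ s → sq (E (U k) (λ u → f u * g (u ⊞ s))))
        ≡⟨ E-cong (U k) (λ s → sq-E (U k) (λ u → f u * g (u ⊞ s))) ⟩
      E (U k) (λ s → E (U k) (λ u → E (U k) (λ v → (f u * g (u ⊞ s)) * (f v * g (v ⊞ s)))))
        ≡⟨ trans (E-swap (U k) (U k) _) (E-cong (U k) (λ u → E-swap (U k) (U k) _)) ⟩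
      E (U k) (λ u → E (U k) (λ v → E (U k) (λ s → (f u * g (u ⊞ s)) * (f v * g (v ⊞ s)))))
        ≡⟨ E-cong (U k) (λ u → U-invariantˡ u (λ v → E (U k) (λ s → (f u * g (u ⊞ s)) * (f v * g (v ⊞ s))))) ⟨
      E (U k) (λ u → E (U k) (λ r → E (U k) (λ s → (f u * g (u ⊞ s)) * (f (u ⊞ r) * g ((u ⊞ r) ⊞ s)))))
        ≡⟨ E-cong (U k) (λ u → E-cong (U k) (λ r → trans
             (E-cong (U k) (λ s → trans (rearr (f u) (g (u ⊞ s)) (f (u ⊞ r)) (g ((u ⊞ r) ⊞ s)))
               (cong (λ t → (f u * f (u ⊞ r)) * (g (u ⊞ s) * g t)) (swap u r s))))
             (trans (E-* (U k) (f u * f (u ⊞ r)) _)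
               (cong ((f u * f (u ⊞ r)) *_) (U-invariantˡ u (λ s → g s * g (s ⊞ r))))))) ⟩
      E (U k) (λ u → E (U k) (λ r → (f u * f (u ⊞ r)) * corr g r))
        ≡⟨ E-swap (U k) (U k) _ ⟩
      E (U k) (λ r → E (U k) (λ u → (f u * f (u ⊞ r)) * corr g r))
        ≡⟨ E-cong (U k) (λ r → E-*ʳ (U k) (corr g r) _) ⟩
      E (U k) (λ r → corr f r * corr g r) ∎
      where
      rearr : ∀ a b c d → (a * b) * (c * d) ≡ (a * c) * (b * d)
      rearr = solve-∀ ℚ-ring
      swap : ∀ u r s → (u ⊞ r) ⊞ s ≡ (u ⊞ s) ⊞ r
      swap u r s = trans (⊞-assoc u r s) (trans (cong (u ⊞_) (⊞-comm r s)) (sym (⊞-assoc u s r)))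

    -- The sum over j ≠ 0 of |f̂(j ℓ)|² ζ^(−j c), with ζ a primitive p-th root of unity.
    spec : (Vec (Fin p) k → ℚ) → Vec (Fin p) k → Fin p → ℚ
    spec f ℓ c = E (U k) (λ r → corr f r * K (dot ℓ r) c)

    spec-expand : ∀ f ℓ c → spec f ℓ c ≡ E (U k) (λ v → f v * E (U k) (λ u → f u * K (dot ℓ v) (dot ℓ u ⊕ c)))
    spec-expand f ℓ c = begin
      E (U k) (λ r → corr f r * K (dot ℓ r) c)
        ≡⟨ E-cong (U k) (λ r → sym (E-*ʳ (U k) (K (dot ℓ r) c) _)) ⟩
      E (U k) (λ r → E (U k) (λ u → (f u * f (u ⊞ r)) * K (dot ℓ r) c))
        ≡⟨ E-swap (U k) (U k) _ ⟩
      E (U k) (λ u → E (U k) (λ r → (f u * f (u ⊞ r)) * K (dot ℓ r) c))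
        ≡⟨ E-cong (U k) (λ u → E-cong (U k) (λ r → cong ((f u * f (u ⊞ r)) *_)
             (trans (sym (K-shift (dot ℓ u) (dot ℓ r) c)) (cong (λ t → K t (dot ℓ u ⊕ c)) (sym (dot-⊞ ℓ u r)))))) ⟩
      E (U k) (λ u → E (U k) (λ r → (f u * f (u ⊞ r)) * K (dot ℓ (u ⊞ r)) (dot ℓ u ⊕ c)))
        ≡⟨ E-cong (U k) (λ u → U-invariantˡ u (λ v → (f u * f v) * K (dot ℓ v) (dot ℓ u ⊕ c))) ⟩
      E (U k) (λ u → E (U k) (λ v → (f u * f v) * K (dot ℓ v) (dot ℓ u ⊕ c)))
        ≡⟨ E-swap (U k) (U k) _ ⟩
      E (U k) (λ v → E (U k) (λ u → (f u * f v) * K (dot ℓ v) (dot ℓ u ⊕ c)))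
        ≡⟨ E-cong (U k) (λ v → trans (E-cong (U k) (λ u → rearr (f u) (f v) _)) (E-* (U k) (f v) _)) ⟩
      E (U k) (λ v → f v * E (U k) (λ u → f u * K (dot ℓ v) (dot ℓ u ⊕ c))) ∎
      where
      rearr : ∀ a b c → (a * b) * c ≡ b * (a * c)
      rearr = solve-∀ ℚ-ring

    -- For ℓ ≠ 0 this is the mean of `f` on the hyperplane where `ℓ` takes the value t, minus the
    -- mean of `f`.
    proj : (Vec (Fin p) k → ℚ) → Vec (Fin p) k → Fin p → ℚ
    proj f ℓ t = E (U k) (λ u → f u * K t (dot ℓ u))

    -- Averaging products of `K` reproduces `K` (`E-K-K`), so the kernel factors through a new
    -- variable t and `spec f ℓ` becomes the autocorrelation of `proj f ℓ`.
    spec-proj : ∀ f ℓ c → spec f ℓ c ≡ E (unif p) (λ t → proj f ℓ t * proj f ℓ (t ⊖ c))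
    spec-proj f ℓ c = begin
      spec f ℓ c
        ≡⟨ spec-expand f ℓ c ⟩
      E (U k) (λ v → f v * E (U k) (λ u → f u * K (dot ℓ v) (dot ℓ u ⊕ c)))
        ≡⟨ E-cong (U k) (λ v → cong (f v *_) (trans
             (E-cong (U k) (λ u → trans (cong (f u *_) (split v u)) (sym (E-* (unif p) (f u) _))))
             (E-swap (U k) (unif p) _))) ⟩
      E (U k) (λ v → f v * E (unif p) (λ t → E (U k) (λ u → f u * (K t (dot ℓ v) * K (t ⊖ c) (dot ℓ u)))))
        ≡⟨ E-cong (U k) (λ v → cong (f v *_) (E-cong (unif p) (λ t →
             trans (E-cong (U k) (λ u → rearr (f u) (K t (dot ℓ v)) _)) (E-* (U k) (K t (dot ℓ v)) _)))) ⟩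
      E (U k) (λ v → f v * E (unif p) (λ t → K t (dot ℓ v) * proj f ℓ (t ⊖ c)))
        ≡⟨ E-cong (U k) (λ v → sym (E-* (unif p) (f v) _)) ⟩
      E (U k) (λ v → E (unif p) (λ t → f v * (K t (dot ℓ v) * proj f ℓ (t ⊖ c))))
        ≡⟨ E-swap (U k) (unif p) _ ⟩
      E (unif p) (λ t → E (U k) (λ v → f v * (K t (dot ℓ v) * proj f ℓ (t ⊖ c))))
        ≡⟨ E-cong (unif p) (λ t → trans (E-cong (U k) (λ v → sym (*-assoc (f v) (K t (dot ℓ v)) (proj f ℓ (t ⊖ c)))))
             (E-*ʳ (U k) (proj f ℓ (t ⊖ c)) (λ v → f v * K t (dot ℓ v)))) ⟩
      E (unif p) (λ t → proj f ℓ t * proj f ℓ (t ⊖ c)) ∎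
      where
      rearr : ∀ a b c → a * (b * c) ≡ b * (a * c)
      rearr = solve-∀ ℚ-ring
      split : ∀ v u → K (dot ℓ v) (dot ℓ u ⊕ c) ≡ E (unif p) (λ t → K t (dot ℓ v) * K (t ⊖ c) (dot ℓ u))
      split v u = trans (sym (E-K-K (dot ℓ v) (dot ℓ u ⊕ c))) (E-cong (unif p) (λ t → cong₂ _*_
        (K-symm (dot ℓ v) t)
        (K-cong {t} {dot ℓ u ⊕ c} {t ⊖ c} {dot ℓ u}
          (λ eq → trans (cong (_⊖ c) eq) ([x⊕y]⊖y≡x (dot ℓ u) c))
          (λ eq → trans (sym ([x⊖y]⊕y≡x t c)) (cong (_⊕ c) eq)))))

    spec-0 : ∀ f ℓ → spec f ℓ 0ₚ ≡ E (unif p) (λ t → sq (proj f ℓ t))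
    spec-0 f ℓ = trans (spec-proj f ℓ 0ₚ) (E-cong (unif p) (λ t → cong (λ s → proj f ℓ t * proj f ℓ s) (t⊖0≡t t)))
      where
      t⊖0≡t : ∀ t → t ⊖ 0ₚ ≡ t
      t⊖0≡t t = trans (sym (⊕-identityʳ (t ⊖ 0ₚ))) ([x⊖y]⊕y≡x t 0ₚ)

    -- AM-GM applied to the products in `spec-proj`: translating by `c` does not change the mean
    -- square.
    spec-within-spec-0 : ∀ f ℓ c → Within (spec f ℓ 0ₚ) (spec f ℓ c)
    spec-within-spec-0 f ℓ c = 2*-cancel-≤ (subst₂ _≤_ lhs rhs (proj₁ w)) ,
      2*-cancel-≤ (subst₂ _≤_ (trans (cong -_ lhs) (neg-*ʳ (spec f ℓ c))) rhs (proj₂ w))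
      where
      P : Fin p → ℚ
      P = proj f ℓ
      w : Within (E (unif p) (λ t → sq (P t) + sq (P (t ⊖ c)))) (E (unif p) (λ t → 2ℚ * (P t * P (t ⊖ c))))
      w = within-E (unif p) (λ t → within-AM-GM (P t) (P (t ⊖ c)))
      lhs : E (unif p) (λ t → 2ℚ * (P t * P (t ⊖ c))) ≡ 2ℚ * spec f ℓ c
      lhs = trans (E-* (unif p) 2ℚ _) (cong (2ℚ *_) (sym (spec-proj f ℓ c)))
      neg-*ʳ : ∀ a → - (2ℚ * a) ≡ 2ℚ * (- a)
      neg-*ʳ = solve-∀ ℚ-ring
      doubling : ∀ a → a + a ≡ 2ℚ * a
      doubling = solve-∀ ℚ-ring
      rhs : E (unif p) (λ t → sq (P t) + sq (P (t ⊖ c))) ≡ 2ℚ * spec f ℓ 0ₚ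
      rhs = begin
        E (unif p) (λ t → sq (P t) + sq (P (t ⊖ c)))
          ≡⟨ E-+ (unif p) _ _ ⟩
        E (unif p) (λ t → sq (P t)) + E (unif p) (λ t → sq (P (t ⊖ c)))
          ≡⟨ cong (E (unif p) (λ t → sq (P t)) +_) (E-unif-permute p (λ t → sq (P t)) (_⊖ c) (_⊕ c)
               (λ x → [x⊕y]⊖y≡x x c) (λ x → [x⊖y]⊕y≡x x c)) ⟩
        E (unif p) (λ t → sq (P t)) + E (unif p) (λ t → sq (P t))
          ≡⟨ cong (λ t → t + t) (sym (spec-0 f ℓ)) ⟩
        spec f ℓ 0ₚ + spec f ℓ 0ₚ
          ≡⟨ doubling (spec f ℓ 0ₚ) ⟩
        2ℚ * spec f ℓ 0ₚ ∎

    E-translates : ∀ {N} (f : Vec (Fin p) k → ℚ) (ι : Vec (Fin p) N → Vec (Fin p) k) →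
      E (U k) (λ u → E (U N) (λ t → f (u ⊞ ι t))) ≡ E (U k) f
    E-translates {N} f ι = trans (E-swap (U k) (U N) _)
      (trans (E-cong (U N) (λ t → U-invariant (ι t) f)) (E-const (U N) _))

    -- As `ℓ` vanishes along `ι`, one copy of `f` may be replaced by its averages over translates of
    -- the image of `ι`. These are at most `κ` and have the same mean as `f`, so their mean absolute
    -- value is at most 2κ - E f by `within-abs`. The factor p bounds `K`.
    spec-within : ∀ {N} (f : Vec (Fin p) k → ℚ) κ ℓ c (ι : Vec (Fin p) N → Vec (Fin p) k) →
      (∀ x → Within 1ℚ (f x)) → 0ℚ ≤ κ → (∀ t → dot ℓ (ι t) ≡ 0ₚ) →
      (∀ u → E (U N) (λ t → f (u ⊞ ι t)) ≤ κ) →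
      Within (nat p * (2ℚ * κ - E (U k) f)) (spec f ℓ c)
    spec-within {N} f κ ℓ c ι bf 0≤κ dot-ι≡0 avg≤κ =
      subst₂ Within bound (sym spread) (within-E (U k) (λ v → within-* (avg-within v) (I-within v)))
      where
      avg : Vec (Fin p) k → ℚ
      avg u = E (U N) (λ t → f (u ⊞ ι t))

      I : Fin p → ℚ
      I s = E (U k) (λ u → f u * K s (dot ℓ u ⊕ c))

      avg-within : ∀ v → Within (2ℚ * κ - avg v) (avg v)
      avg-within v = within-abs (avg≤κ v) 0≤κ

      I-within : ∀ v → Within (nat p) (I (dot ℓ v))
      I-within v = within-E-const (U k) (λ u → subst (λ t → Within t (f u * K (dot ℓ v) (dot ℓ u ⊕ c))) (*-identityˡ (nat p))
        (within-* {1ℚ} {f u} {nat p} {K (dot ℓ v) (dot ℓ u ⊕ c)} (bf u) (K-within (dot ℓ v) (dot ℓ u ⊕ c))))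

      bound : E (U k) (λ v → (2ℚ * κ - avg v) * nat p) ≡ nat p * (2ℚ * κ - E (U k) f)
      bound = begin
        E (U k) (λ v → (2ℚ * κ - avg v) * nat p)       ≡⟨ E-*ʳ (U k) (nat p) _ ⟩
        E (U k) (λ v → 2ℚ * κ - avg v) * nat p         ≡⟨ *-comm _ (nat p) ⟩
        nat p * E (U k) (λ v → 2ℚ * κ - avg v)         ≡⟨ cong (nat p *_) (E-sub (U k) _ avg) ⟩
        nat p * (E (U k) (λ _ → 2ℚ * κ) - E (U k) avg) ≡⟨ cong₂ (λ s t → nat p * (s - t)) (E-const (U k) (2ℚ * κ)) (E-translates f ι) ⟩
        nat p * (2ℚ * κ - E (U k) f)                   ∎

      spread : spec f ℓ c ≡ E (U k) (λ v → avg v * I (dot ℓ v))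
      spread = begin
        spec f ℓ c
          ≡⟨ spec-expand f ℓ c ⟩
        E (U k) (λ v → f v * I (dot ℓ v))
          ≡⟨ E-const (U N) _ ⟨
        E (U N) (λ t → E (U k) (λ v → f v * I (dot ℓ v)))
          ≡⟨ E-cong (U N) (λ t → U-invariant (ι t) (λ v → f v * I (dot ℓ v))) ⟨
        E (U N) (λ t → E (U k) (λ v → f (v ⊞ ι t) * I (dot ℓ (v ⊞ ι t))))
          ≡⟨ E-cong (U N) (λ t → E-cong (U k) (λ v → cong (λ s → f (v ⊞ ι t) * I s)
               (trans (dot-⊞ ℓ v (ι t)) (trans (cong (dot ℓ v ⊕_) (dot-ι≡0 t)) (⊕-identityʳ (dot ℓ v)))))) ⟩
        E (U N) (λ t → E (U k) (λ v → f (v ⊞ ι t) * I (dot ℓ v)))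
          ≡⟨ E-swap (U N) (U k) _ ⟩
        E (U k) (λ v → E (U N) (λ t → f (v ⊞ ι t) * I (dot ℓ v)))
          ≡⟨ E-cong (U k) (λ v → E-*ʳ (U N) (I (dot ℓ v)) _) ⟩
        E (U k) (λ v → avg v * I (dot ℓ v)) ∎

    K-00 : 0ℚ < K 0ₚ 0ₚ
    K-00 = subst (0ℚ <_) (sym K≡) (helper p (ℕ.nonTrivial⇒n>1 p {{prime⇒nonTrivial pr}}))
      where
      K≡ : K 0ₚ 0ₚ ≡ nat p - 1ℚ
      K≡ = trans (cong (λ b → nat p * (if b then 1ℚ else 0ℚ) - 1ℚ) (dec-true (0ₚ Finₚ.≟ 0ₚ) refl))
                 (cong (_- 1ℚ) (*-identityʳ (nat p)))
      helper : ∀ n → 1 ℕ.< n → 0ℚ < nat n - 1ℚ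
      helper (suc zero)    (ℕ.s≤s ())
      helper (suc (suc n)) _ = subst (0ℚ <_) (l (nat (suc n))) (nat-pos n)
        where
        l : ∀ a → a ≡ (1ℚ + a) - 1ℚ
        l = solve-∀ ℚ-ring

    -- The sum of |f̂|² |ĝ|² is at most a uniform bound on the coefficients of `f` times Parseval's
    -- sum for `g`, which is at most 1. The factor `K 0ₚ 0ₚ` = p - 1 counts how often a frequency
    -- occurs as jℓ with j ≠ 0, and cancels.
    spectral-bound : ∀ f g B → (∀ ℓ c → Within B (spec f ℓ c)) → (∀ x → Within 1ℚ (g x)) → 0ℚ ≤ B →
                     crossEnergy f g ≤ B
    spectral-bound f g B spec-f bg 0≤B = *-cancelˡ-≤-pos (K 0ₚ 0ₚ) {{positive K-00}}
      (≤-trans (≤-reflexive expand) (≤-trans (*-monoˡ (0≤nat (p ℕ.^ k)) bounded) (≤-trans (≤-reflexive total) shrink)))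
      where
      q = nat (p ℕ.^ k)

      expand : K 0ₚ 0ₚ * crossEnergy f g ≡ q * E (U k) (λ ℓ → E (unif p) (λ c → spec f ℓ c * spec g ℓ c))
      expand = begin
        K 0ₚ 0ₚ * crossEnergy f g
          ≡⟨ cong (K 0ₚ 0ₚ *_) (crossEnergy-corr f g) ⟩
        K 0ₚ 0ₚ * E (U k) (λ r → corr f r * corr g r)
          ≡⟨ E-* (U k) (K 0ₚ 0ₚ) _ ⟨
        E (U k) (λ r → K 0ₚ 0ₚ * (corr f r * corr g r))
          ≡⟨ E-cong (U k) (λ r → trans (rearr₁ (K 0ₚ 0ₚ) (corr f r) (corr g r))
               (cong (corr f r *_) (sym (fourier-inversion (corr g) r 0ₚ 0ₚ)))) ⟩
        E (U k) (λ r → corr f r * (q * E (U k) (λ ℓ → E (U k) (λ r′ → corr g r′ * K (dot ℓ r ⊕ 0ₚ) (dot ℓ r′ ⊕ 0ₚ)))))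
          ≡⟨ E-cong (U k) (λ r → trans (rearr₂ (corr f r) q _) (cong (q *_) (sym (E-* (U k) (corr f r) _)))) ⟩
        E (U k) (λ r → q * E (U k) (λ ℓ → corr f r * E (U k) (λ r′ → corr g r′ * K (dot ℓ r ⊕ 0ₚ) (dot ℓ r′ ⊕ 0ₚ))))
          ≡⟨ trans (E-* (U k) q _) (cong (q *_) (E-swap (U k) (U k) _)) ⟩
        q * E (U k) (λ ℓ → E (U k) (λ r → corr f r * E (U k) (λ r′ → corr g r′ * K (dot ℓ r ⊕ 0ₚ) (dot ℓ r′ ⊕ 0ₚ))))
          ≡⟨ cong (q *_) (E-cong (U k) separate) ⟩
        q * E (U k) (λ ℓ → E (unif p) (λ c → spec f ℓ c * spec g ℓ c)) ∎
        where
        rearr₁ : ∀ a b c → a * (b * c) ≡ b * (c * a)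
        rearr₁ = solve-∀ ℚ-ring
        rearr₂ : ∀ a b c → a * (b * c) ≡ b * (a * c)
        rearr₂ = solve-∀ ℚ-ring
        split : ∀ ℓ r r′ → K (dot ℓ r ⊕ 0ₚ) (dot ℓ r′ ⊕ 0ₚ) ≡ E (unif p) (λ c → K (dot ℓ r) c * K (dot ℓ r′) c)
        split ℓ r r′ = trans (cong₂ K (⊕-identityʳ (dot ℓ r)) (⊕-identityʳ (dot ℓ r′)))
          (trans (sym (E-K-K (dot ℓ r) (dot ℓ r′))) (E-cong (unif p) (λ c → cong (K (dot ℓ r) c *_) (K-symm c (dot ℓ r′)))))
        separate : ∀ ℓ → E (U k) (λ r → corr f r * E (U k) (λ r′ → corr g r′ * K (dot ℓ r ⊕ 0ₚ) (dot ℓ r′ ⊕ 0ₚ)))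
                       ≡ E (unif p) (λ c → spec f ℓ c * spec g ℓ c)
        separate ℓ = begin
          E (U k) (λ r → corr f r * E (U k) (λ r′ → corr g r′ * K (dot ℓ r ⊕ 0ₚ) (dot ℓ r′ ⊕ 0ₚ)))
            ≡⟨ E-cong (U k) (λ r → cong (corr f r *_) (trans
                 (E-cong (U k) (λ r′ → trans (cong (corr g r′ *_) (split ℓ r r′)) (sym (E-* (unif p) (corr g r′) _))))
                 (E-swap (U k) (unif p) _))) ⟩
          E (U k) (λ r → corr f r * E (unif p) (λ c → E (U k) (λ r′ → corr g r′ * (K (dot ℓ r) c * K (dot ℓ r′) c))))
            ≡⟨ E-cong (U k) (λ r → cong (corr f r *_) (E-cong (unif p) (λ c →
                 trans (E-cong (U k) (λ r′ → rearr₂ (corr g r′) (K (dot ℓ r) c) (K (dot ℓ r′) c)))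
                       (E-* (U k) (K (dot ℓ r) c) _)))) ⟩
          E (U k) (λ r → corr f r * E (unif p) (λ c → K (dot ℓ r) c * spec g ℓ c))
            ≡⟨ E-cong (U k) (λ r → trans (sym (E-* (unif p) (corr f r) _))
                 (E-cong (unif p) (λ c → sym (*-assoc (corr f r) (K (dot ℓ r) c) (spec g ℓ c))))) ⟩
          E (U k) (λ r → E (unif p) (λ c → (corr f r * K (dot ℓ r) c) * spec g ℓ c))
            ≡⟨ E-swap (U k) (unif p) _ ⟩
          E (unif p) (λ c → E (U k) (λ r → (corr f r * K (dot ℓ r) c) * spec g ℓ c))
            ≡⟨ E-cong (unif p) (λ c → E-*ʳ (U k) (spec g ℓ c) _) ⟩
          E (unif p) (λ c → spec f ℓ c * spec g ℓ c) ∎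

      bounded : E (U k) (λ ℓ → E (unif p) (λ c → spec f ℓ c * spec g ℓ c)) ≤ B * E (U k) (λ ℓ → spec g ℓ 0ₚ)
      bounded = ≤-trans
        (E-mono (U k) (λ ℓ → E-≤-const (unif p) (λ c → within-*-≤ {B} {spec f ℓ c} (spec-f ℓ c) (spec-within-spec-0 g ℓ c))))
        (≤-reflexive (E-* (U k) B _))

      -- Parseval's identity for `g`, read off from inversion at the origin.
      total : q * (B * E (U k) (λ ℓ → spec g ℓ 0ₚ)) ≡ K 0ₚ 0ₚ * (B * corr g 0ᵥ)
      total = begin
        q * (B * E (U k) (λ ℓ → spec g ℓ 0ₚ))
          ≡⟨ rearr₁ q B _ ⟩
        B * (q * E (U k) (λ ℓ → spec g ℓ 0ₚ))
          ≡⟨ cong (λ t → B * (q * t)) (E-cong (U k) (λ ℓ → E-cong (U k) (λ r → cong (corr g r *_)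
               (trans (K-symm (dot ℓ r) 0ₚ) (cong₂ K (trans (sym (dot-0ᵥ ℓ)) (sym (⊕-identityʳ _))) (sym (⊕-identityʳ (dot ℓ r)))))))) ⟩
        B * (q * E (U k) (λ ℓ → E (U k) (λ r → corr g r * K (dot ℓ 0ᵥ ⊕ 0ₚ) (dot ℓ r ⊕ 0ₚ))))
          ≡⟨ cong (B *_) (fourier-inversion (corr g) 0ᵥ 0ₚ 0ₚ) ⟩
        B * (corr g 0ᵥ * K 0ₚ 0ₚ)
          ≡⟨ rearr₂ B (corr g 0ᵥ) (K 0ₚ 0ₚ) ⟩
        K 0ₚ 0ₚ * (B * corr g 0ᵥ) ∎
        where
        rearr₁ : ∀ a b c → a * (b * c) ≡ b * (a * c)
        rearr₁ = solve-∀ ℚ-ring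
        rearr₂ : ∀ a b c → a * (b * c) ≡ c * (a * b)
        rearr₂ = solve-∀ ℚ-ring

      shrink : K 0ₚ 0ₚ * (B * corr g 0ᵥ) ≤ K 0ₚ 0ₚ * B
      shrink = *-monoˡ (<⇒≤ K-00) (≤-trans (*-monoˡ 0≤B (E-≤-const (U k) (λ u →
        within-*-≤ {1ℚ} {g u} {1ℚ} {g (u ⊞ 0ᵥ)} (bg u) (bg (u ⊞ 0ᵥ))))) (≤-reflexive (*-identityʳ B)))

    crossEnergy-≤ : ∀ {N} (f g : Vec (Fin p) k → ℚ) κ →
      (∀ x → Within 1ℚ (f x)) → (∀ x → Within 1ℚ (g x)) → 0ℚ ≤ κ →
      (∀ ℓ → ∃[ ι ] (∀ t → dot ℓ (ι t) ≡ 0ₚ) × (∀ u → E (U N) (λ t → f (u ⊞ ι t)) ≤ κ)) →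
      crossEnergy f g ≤ nat p * (2ℚ * κ - E (U k) f)
    crossEnergy-≤ {N} f g κ bf bg 0≤κ sub = spectral-bound f g (nat p * (2ℚ * κ - E (U k) f))
      (λ ℓ c → let ι , dot-ι , avg = sub ℓ in spec-within f κ ℓ c ι bf 0≤κ dot-ι avg) bg
      (0≤-* (0≤nat p) (subst (0ℚ ≤_) (l κ (E (U k) f)) (0≤-+ 0≤κ (0≤-sub Ef≤κ))))
      where
      l : ∀ κ e → κ + (κ - e) ≡ 2ℚ * κ - e
      l = solve-∀ ℚ-ring
      -- Makes the bound nonnegative; it follows by averaging the means over translates for the form
      -- ℓ = 0.
      Ef≤κ : E (U k) f ≤ κ
      Ef≤κ = let ι , _ , avg = sub 0ᵥ in
        subst (_≤ κ) (E-translates f ι) (E-≤-const (U k) avg)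

-- Restricted progressions inside combinatorial subspaces

-- The arguments are cut points, of which there are k + 1: marked are the positions from `i` up to,
-- but excluding, `j`.
interval : ∀ {k} → Fin (suc k) → Fin (suc k) → Vec Bool k
interval {zero}  _           _           = []
interval {suc k} Fin.zero    Fin.zero    = replicate (suc k) false
interval {suc k} Fin.zero    (Fin.suc j) = true ∷ interval Fin.zero j
interval {suc k} (Fin.suc i) Fin.zero    = replicate (suc k) false
interval {suc k} (Fin.suc i) (Fin.suc j) = false ∷ interval i j

interval-nonempty : ∀ {k} {i j : Fin (suc k)} → i Fin.< j → interval i j ≢ replicate k false
interval-nonempty {zero}  {Fin.zero}  {Fin.zero}  ()
interval-nonempty {suc k} {Fin.zero}  {Fin.suc j} _ ()
interval-nonempty {suc k} {Fin.suc i} {Fin.suc j} (ℕ.s≤s i<j) eq = interval-nonempty i<j (Vecₚ.∷-injectiveʳ eq)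

select : {X : Set} → X → X → Bool → X
select z t b = if b then t else z

-- Each coordinate is copied to the marked places of its own block. Only the coefficients 0 and 1
-- occur, so entries in {0, 1, 2} stay there; the entry type is arbitrary in order to treat points
-- and differences alike.
blow : ∀ {X : Set} {N m} → X → Vec (Vec Bool m) N → Vec X N → Vec X (N ℕ.* m)
blow z []       []       = []
blow z (B ∷ Bs) (t ∷ ts) = Vec.map (select z t) B ++ blow z Bs ts

NonEmpty : ∀ {m} → Vec Bool m → Set
NonEmpty {m} B = B ≢ replicate m false

select-constant : ∀ {X : Set} {m} (z t : X) (B : Vec Bool m) → NonEmpty B →
                  Vec.map (select z t) B ≡ replicate m z → t ≡ z
select-constant z t []          B≢ eq = ⊥-elim (B≢ refl)
select-constant z t (true ∷ B)  B≢ eq = Vecₚ.∷-injectiveˡ eq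
select-constant z t (false ∷ B) B≢ eq = select-constant z t B (B≢ ∘ cong (false ∷_)) (Vecₚ.∷-injectiveʳ eq)

replicate-++ : ∀ {X : Set} m {n} (z : X) → replicate (m ℕ.+ n) z ≡ replicate m z ++ replicate n z
replicate-++ zero    z = refl
replicate-++ (suc m) z = cong (z ∷_) (replicate-++ m z)

-- Every block has a marked place at which its coordinate can be read off; hence nonzero differences
-- stay nonzero.
blow-constant : ∀ {X : Set} {N m} (z : X) {Bs : Vec (Vec Bool m) N} → Allᵥ.All NonEmpty Bs → ∀ ts →
                blow z Bs ts ≡ replicate (N ℕ.* m) z → ts ≡ replicate N z
blow-constant z []         []       eq = refl
blow-constant {m = m} z {B ∷ Bs} (B≢ ∷ Bs≢) (t ∷ ts) eq =
  cong₂ _∷_ (select-constant z t B B≢ (proj₁ both)) (blow-constant z Bs≢ ts (proj₂ both))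
  where
  both = Vecₚ.++-injective (Vec.map (select z t) B) (replicate m z) (trans eq (replicate-++ m z))

module Subspace (p : ℕ) .{{_ : ℕ.NonZero p}} (pr : Prime p) where

  open Arithmetic p
  open Fourier p pr

  private module ⊞ {k} = IsCommutativeMonoid (⊞-isCommutativeMonoid {k})

  embed : Fin 3 → Fin p
  embed a = toℕ a mod p

  embedᵥ : ∀ {n} → Vec (Fin 3) n → Vec (Fin p) n
  embedᵥ = Vec.map embed

  shift-⊞ : ∀ {n} (x : Vec (Fin p) n) a → shift p x a ≡ x ⊞ embedᵥ a
  shift-⊞ []       []       = refl
  shift-⊞ (x ∷ xs) (a ∷ as) = cong (x ⊕ embed a ∷_) (shift-⊞ xs as)

  shift-0 : ∀ {n} (x : Vec (Fin p) n) → shift p x (replicate n Fin.zero) ≡ x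
  shift-0 []       = refl
  shift-0 (x ∷ xs) = cong₂ _∷_ (⊕-identityʳ x) (shift-0 xs)

  partialSum : ∀ {k} → Vec (Fin p) k → Vec Bool k → Fin p
  partialSum []       []          = 0ₚ
  partialSum (c ∷ cs) (true ∷ B)  = c ⊕ partialSum cs B
  partialSum (c ∷ cs) (false ∷ B) = partialSum cs B

  partialSum-false : ∀ {k} (cs : Vec (Fin p) k) → partialSum cs (replicate k false) ≡ 0ₚ
  partialSum-false []       = refl
  partialSum-false (c ∷ cs) = partialSum-false cs

  partialSum-interval : ∀ {k} (cs : Vec (Fin p) k) {i j} → i Fin.< j →
    partialSum cs (interval Fin.zero j) ≡ partialSum cs (interval Fin.zero i) ⊕ partialSum cs (interval i j)
  partialSum-interval []       {Fin.zero}  {Fin.zero}  ()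
  partialSum-interval (c ∷ cs) {Fin.zero}  {Fin.suc j} _ =
    sym (trans (cong (_⊕ partialSum (c ∷ cs) (interval Fin.zero (Fin.suc j))) (partialSum-false cs)) (⊕-identityˡ _))
  partialSum-interval (c ∷ cs) {Fin.suc i} {Fin.suc j} (ℕ.s≤s i<j) =
    trans (cong (c ⊕_) (partialSum-interval cs i<j)) (sym (⊕-assoc c _ _))

  -- Two of the p + 1 prefix sums coincide.
  zero-sum : (cs : Vec (Fin p) p) → ∃[ B ] NonEmpty B × partialSum cs B ≡ 0ₚ
  zero-sum cs =
    let i , j , i<j , eq = Finₚ.pigeonhole (ℕₚ.n<1+n p) (λ i → partialSum cs (interval Fin.zero i)) in
    interval i j , interval-nonempty i<j ,
    ⊕-cancelˡ (partialSum cs (interval Fin.zero i))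
      (trans (sym (partialSum-interval cs i<j)) (trans (sym eq) (sym (⊕-identityʳ _))))

  dot-select : ∀ {k} (cs : Vec (Fin p) k) B t → dot cs (Vec.map (select 0ₚ t) B) ≡ partialSum cs B ⊙ t
  dot-select []       []          t = sym (⊙-zeroˡ t)
  dot-select (c ∷ cs) (true ∷ B)  t = trans (cong (c ⊙ t ⊕_) (dot-select cs B t)) (sym (⊙-distribʳ t c _))
  dot-select (c ∷ cs) (false ∷ B) t =
    trans (cong₂ _⊕_ (⊙-zeroʳ c) (dot-select cs B t)) (⊕-identityˡ (partialSum cs B ⊙ t))

  dot-++ : ∀ {k l} (c x : Vec (Fin p) k) (d y : Vec (Fin p) l) → dot (c ++ d) (x ++ y) ≡ dot c x ⊕ dot d y
  dot-++ []       []       d y = sym (⊕-identityˡ (dot d y))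
  dot-++ (c ∷ cs) (x ∷ xs) d y = trans (cong (c ⊙ x ⊕_) (dot-++ cs xs d y)) (sym (⊕-assoc (c ⊙ x) _ _))

  -- Every block of `p` coefficients contains a zero-sum interval, so each `p` coordinates yield one
  -- free direction.
  isotropic : ∀ N (ℓ : Vec (Fin p) (N ℕ.* p)) →
    ∃[ Bs ] Allᵥ.All (NonEmpty {p}) Bs × (∀ t → dot ℓ (blow {N = N} 0ₚ Bs t) ≡ 0ₚ)
  isotropic zero    []  = [] , [] , λ { [] → refl }
  isotropic (suc N) ℓ with Vec.splitAt p ℓ
  ... | c , ℓ′ , refl =
    let B  , B≢  , sum≡0 = zero-sum c
        Bs , Bs≢ , dot≡0 = isotropic N ℓ′
    in  B ∷ Bs , B≢ ∷ Bs≢ , λ { (t ∷ ts) →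
      trans (dot-++ c (Vec.map (select 0ₚ t) B) ℓ′ (blow 0ₚ Bs ts)) (trans (cong₂ _⊕_
        (trans (dot-select c B t) (trans (cong (_⊙ t) sum≡0) (⊙-zeroˡ t))) (dot≡0 ts)) (⊕-identityˡ 0ₚ)) }

  map-select-⊞ : ∀ {m} (B : Vec Bool m) s t →
    Vec.map (select 0ₚ (s ⊕ t)) B ≡ Vec.map (select 0ₚ s) B ⊞ Vec.map (select 0ₚ t) B
  map-select-⊞ []          s t = refl
  map-select-⊞ (true ∷ B)  s t = cong (s ⊕ t ∷_) (map-select-⊞ B s t)
  map-select-⊞ (false ∷ B) s t = cong₂ _∷_ (sym (⊕-identityˡ 0ₚ)) (map-select-⊞ B s t)

  ⊞-++ : ∀ {k l} (x y : Vec (Fin p) k) (x′ y′ : Vec (Fin p) l) → (x ++ x′) ⊞ (y ++ y′) ≡ (x ⊞ y) ++ (x′ ⊞ y′)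
  ⊞-++ []       []       x′ y′ = refl
  ⊞-++ (x ∷ xs) (y ∷ ys) x′ y′ = cong (x ⊕ y ∷_) (⊞-++ xs ys x′ y′)

  blow-⊞ : ∀ {N m} (Bs : Vec (Vec Bool m) N) s t → blow 0ₚ Bs (s ⊞ t) ≡ blow 0ₚ Bs s ⊞ blow 0ₚ Bs t
  blow-⊞ []       []       []       = refl
  blow-⊞ (B ∷ Bs) (s ∷ ss) (t ∷ ts) = trans (cong₂ _++_ (map-select-⊞ B s t) (blow-⊞ Bs ss ts))
    (sym (⊞-++ (Vec.map (select 0ₚ s) B) _ _ _))

  map-select-embed : ∀ {m} (B : Vec Bool m) a →
    Vec.map (select 0ₚ (embed a)) B ≡ embedᵥ (Vec.map (select Fin.zero a) B)
  map-select-embed []          a = refl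
  map-select-embed (true ∷ B)  a = cong (embed a ∷_) (map-select-embed B a)
  map-select-embed (false ∷ B) a = cong (0ₚ ∷_) (map-select-embed B a)

  blow-embed : ∀ {N m} (Bs : Vec (Vec Bool m) N) a → blow 0ₚ Bs (embedᵥ a) ≡ embedᵥ (blow Fin.zero Bs a)
  blow-embed []       []       = refl
  blow-embed (B ∷ Bs) (a ∷ as) = trans (cong₂ _++_ (map-select-embed B a) (blow-embed Bs as))
    (sym (Vecₚ.map-++ embed (Vec.map (select Fin.zero a) B) _))

  shift-blow : ∀ {N m} (u : Vec (Fin p) (N ℕ.* m)) (Bs : Vec (Vec Bool m) N) x a →
    u ⊞ blow 0ₚ Bs (shift p x a) ≡ shift p (u ⊞ blow 0ₚ Bs x) (blow Fin.zero Bs a)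
  shift-blow u Bs x a = begin
    u ⊞ blow 0ₚ Bs (shift p x a)                          ≡⟨ cong (λ t → u ⊞ blow 0ₚ Bs t) (shift-⊞ x a) ⟩
    u ⊞ blow 0ₚ Bs (x ⊞ embedᵥ a)                         ≡⟨ cong (u ⊞_) (blow-⊞ Bs x (embedᵥ a)) ⟩
    u ⊞ (blow 0ₚ Bs x ⊞ blow 0ₚ Bs (embedᵥ a))            ≡⟨ ⊞.assoc u _ _ ⟨
    (u ⊞ blow 0ₚ Bs x) ⊞ blow 0ₚ Bs (embedᵥ a)            ≡⟨ cong ((u ⊞ blow 0ₚ Bs x) ⊞_) (blow-embed Bs a) ⟩
    (u ⊞ blow 0ₚ Bs x) ⊞ embedᵥ (blow Fin.zero Bs a)      ≡⟨ shift-⊞ _ (blow Fin.zero Bs a) ⟨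
    shift p (u ⊞ blow 0ₚ Bs x) (blow Fin.zero Bs a)       ∎
    where open ≡-Reasoning

  -- Freeness with the coordinates split into the `k` already made uniform and the `n` still
  -- pending. The first premise says that the pair (a, b) is nonzero.
  APFree₂ : ∀ {k n} → (Vec (Fin p) k → Vec (Fin p) n → Bool) → Set
  APFree₂ {k} {n} A = ∀ x y (a : Vec (Fin 3) k) (b : Vec (Fin 3) n) →
    (a ≡ replicate k Fin.zero → b ≢ replicate n Fin.zero) →
    A x y ≡ true → A (shift p x a) (shift p y b) ≡ true →
    A (shift p (shift p x a) a) (shift p (shift p y b) b) ≢ true

  move : ∀ {k n} {X : Set} → (Vec (Fin p) k → Vec (Fin p) (suc n) → X) → Vec (Fin p) (suc k) → Vec (Fin p) n → X
  move f (v ∷ u) z = f u (v ∷ z)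

  module _ {k n} {A : Vec (Fin p) k → Vec (Fin p) (suc n) → Bool} (free : APFree₂ A) where

    move-free : APFree₂ (move A)
    move-free (v ∷ u) z (c ∷ a) b ab≢0 = free u (v ∷ z) a (c ∷ b)
      (λ a≡0 cb≡0 → ab≢0 (cong₂ _∷_ (Vecₚ.∷-injectiveˡ cb≡0) a≡0) (Vecₚ.∷-injectiveʳ cb≡0))

    -- A frozen coordinate receives the difference 0 and stays at v.
    fix-free : ∀ v → APFree₂ (λ u z → A u (v ∷ z))
    fix-free v u z a b ab≢0 A₀ A₁ A₂ = free u (v ∷ z) a (Fin.zero ∷ b)
      (λ a≡0 b≡0 → ab≢0 a≡0 (Vecₚ.∷-injectiveʳ b≡0)) A₀
      (subst (λ t → A (shift p u a) (t ∷ shift p z b) ≡ true) (sym (⊕-identityʳ v)) A₁)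
      (subst (λ t → A (shift p (shift p u a) a) (t ∷ shift p (shift p z b) b) ≡ true)
        (sym (trans (⊕-identityʳ (v ⊕ 0ₚ)) (⊕-identityʳ v))) A₂)

  subspace-free : ∀ {N n} {A : Vec (Fin p) (N ℕ.* p) → Vec (Fin p) n → Bool} → APFree₂ A →
    ∀ u z {Bs : Vec (Vec Bool p) N} → Allᵥ.All NonEmpty Bs → RestrictedAPFree p (λ t → A (u ⊞ blow 0ₚ Bs t) z)
  subspace-free {N} {n} {A} free u z {Bs} Bs≢ x a a≢0 (A₀ , A₁ , A₂) =
    free (u ⊞ blow 0ₚ Bs x) z (blow Fin.zero Bs a) (replicate n Fin.zero)
      (λ a≡0 _ → a≢0 (blow-constant Fin.zero Bs≢ a a≡0)) A₀
      (trans (sym (cong₂ A (shift-blow u Bs x a) (sym (shift-0 z)))) A₁)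
      (trans (sym (cong₂ A
        (trans (shift-blow u Bs (shift p x a) a) (cong (λ t → shift p t (blow Fin.zero Bs a)) (shift-blow u Bs x a)))
        (sym (trans (cong (λ t → shift p t (replicate n Fin.zero)) (shift-0 z)) (shift-0 z))))) A₂)

-- Random restriction to uniform coordinates

indicator : Bool → ℚ
indicator b = if b then 1ℚ else 0ℚ

power : ℚ → ℕ → ℚ
power x zero    = 1ℚ
power x (suc n) = x * power x n

0≤power : ∀ {x} n → 0ℚ ≤ x → 0ℚ ≤ power x n
0≤power zero    0≤x = 0≤1
0≤power (suc n) 0≤x = 0≤-* 0≤x (0≤power n 0≤x)

isNothing : {X : Set} → Maybe X → ℚ
isNothing = maybe (λ _ → 0ℚ) 1ℚ

-- A distribution on F_p that is uniform with probability ρ, the event being recorded as "nothing".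
record Mixture {p : ℕ} .{{_ : ℕ.NonZero p}} (μ : Prob (Fin p)) (ρ : ℚ) : Set where
  field
    hat    : Prob (Maybe (Fin p))
    split  : ∀ φ → E μ φ ≡ E hat (maybe φ (E (unif p) φ))
    weight : E hat isNothing ≡ ρ

module Restriction (p : ℕ) .{{_ : ℕ.NonZero p}} (pr : Prime p)
  {μ ν : Prob (Fin p)} {ρ : ℚ} (mixμ : Mixture μ ρ) (mixν : Mixture ν ρ) where

  open Arithmetic p
  open Fourier p pr
  open Correlation p pr
  open Subspace p pr
  open Mixture
  open ≤-Reasoning

  private u = unif p

  -- The shifts d ∼ μ and e ∼ ν live on the last n coordinates; the first k are already averaged uniformly.
  form : ∀ k n (f g : Vec (Fin p) k → Vec (Fin p) n → ℚ) → ℚ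
  form k n f g = E (U k) (λ s → E (μ ^ n) (λ d → E (U n) (λ z →
    sq (E (ν ^ n) (λ e → E (U k) (λ x → f x (z ⊞ e) * g (x ⊞ s) ((z ⊞ e) ⊞ d)))))))

  mean : ∀ k n (f : Vec (Fin p) k → Vec (Fin p) n → ℚ) → ℚ
  mean k n f = E (U k) (λ x → E (U n) (f x))

  -- What one coordinate contributes if it is frozen: its value is averaged outside the square. In
  -- `alive` both shifts are uniform, so the value is averaged inside the square and the difference
  -- outside.
  dead : (Fin p → Fin p → ℚ) → Fin p → ℚ
  dead g d = E u (λ v → sq (g v (v ⊕ d)))

  alive : (Fin p → Fin p → ℚ) → ℚ
  alive g = E u (λ s → sq (E u (λ v → g v (v ⊕ s))))

  -- Only two uniform shifts count as alive. If `e` alone is uniform, Jensen gives the inner average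
  -- away, so that all remaining outcomes reduce to `dead`.
  branch : (Fin p → Fin p → ℚ) → Maybe (Fin p) → Maybe (Fin p) → ℚ
  branch g _        (just d) = dead g d
  branch g (just _) nothing  = E u (dead g)
  branch g nothing  nothing  = alive g

  -- Convexity moves the mixture outside the square. A definite shift is then absorbed by the
  -- uniform z, and a uniform shift removes the dependence on z.
  split-e : ∀ (h : Fin p → ℚ) →
    E u (λ z → sq (E ν (λ e → h (z ⊕ e)))) ≤ E (hat mixν) (maybe (λ _ → E u (λ v → sq (h v))) (sq (E u h)))
  split-e h = begin
    E u (λ z → sq (E ν (λ e → h (z ⊕ e))))
      ≡⟨ E-cong u (λ z → cong sq (split mixν (λ e → h (z ⊕ e)))) ⟩
    E u (λ z → sq (E (hat mixν) (maybe (λ e → h (z ⊕ e)) (E u (λ e → h (z ⊕ e))))))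
      ≤⟨ E-mono u (λ z → jensen (hat mixν) _) ⟩
    E u (λ z → E (hat mixν) (λ m → sq (maybe (λ e → h (z ⊕ e)) (E u (λ e → h (z ⊕ e))) m)))
      ≡⟨ E-swap u (hat mixν) _ ⟩
    E (hat mixν) (λ m → E u (λ z → sq (maybe (λ e → h (z ⊕ e)) (E u (λ e → h (z ⊕ e))) m)))
      ≡⟨ E-cong (hat mixν) case ⟩
    E (hat mixν) (maybe (λ _ → E u (λ v → sq (h v))) (sq (E u h))) ∎
    where
    case : ∀ m → E u (λ z → sq (maybe (λ e → h (z ⊕ e)) (E u (λ e → h (z ⊕ e))) m))
               ≡ maybe (λ _ → E u (λ v → sq (h v))) (sq (E u h)) m
    case (just e) = unif-invariant e (λ v → sq (h v))
    case nothing  = trans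
      (E-cong u (λ z → cong sq (trans (E-cong u (λ e → cong h (⊕-comm z e))) (unif-invariant z h))))
      (E-const u (sq (E u h)))

  branch-≤ : ∀ g → E μ (λ d → E u (λ z → sq (E ν (λ e → g (z ⊕ e) ((z ⊕ e) ⊕ d)))))
                 ≤ E (hat mixν) (λ m → E (hat mixμ) (branch g m))
  branch-≤ g = begin
    E μ (λ d → E u (λ z → sq (E ν (λ e → g (z ⊕ e) ((z ⊕ e) ⊕ d)))))
      ≤⟨ E-mono μ (λ d → split-e (λ v → g v (v ⊕ d))) ⟩
    E μ (λ d → E (hat mixν) (λ m → B m d))
      ≡⟨ E-swap μ (hat mixν) _ ⟩
    E (hat mixν) (λ m → E μ (B m))
      ≡⟨ E-cong (hat mixν) (λ m → split mixμ (B m)) ⟩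
    E (hat mixν) (λ m → E (hat mixμ) (maybe (B m) (E u (B m))))
      ≤⟨ E-mono (hat mixν) (λ m → E-mono (hat mixμ) (case m)) ⟩
    E (hat mixν) (λ m → E (hat mixμ) (branch g m)) ∎
    where
    B : Maybe (Fin p) → Fin p → ℚ
    B m d = maybe (λ _ → dead g d) (sq (E u (λ v → g v (v ⊕ d)))) m
    case : ∀ m m′ → maybe (B m) (E u (B m)) m′ ≤ branch g m m′
    case (just _) (just d) = ≤-refl
    case nothing  (just d) = jensen u (λ v → g v (v ⊕ d))
    case (just _) nothing  = ≤-refl
    case nothing  nothing  = ≤-refl

  module Step {k n} (f g : Vec (Fin p) k → Vec (Fin p) (suc n) → ℚ) where

    slice : (Vec (Fin p) k → Vec (Fin p) (suc n) → ℚ) → Fin p → Vec (Fin p) k → Vec (Fin p) n → ℚ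
    slice f v x z = f x (v ∷ z)

    G : Vec (Fin p) k → Vec (Fin p) n → Vec (Fin p) n → Fin p → Fin p → ℚ
    G s d z v w = E (ν ^ n) (λ e → E (U k) (λ x → f x (v ∷ (z ⊞ e)) * g (x ⊞ s) (w ∷ ((z ⊞ e) ⊞ d))))

    Av : (Vec (Fin p) k → Vec (Fin p) n → Vec (Fin p) n → ℚ) → ℚ
    Av F = E (U k) (λ s → E (μ ^ n) (λ d → E (U n) (F s d)))

    Av-swap : ∀ {X : Set} (κ : Prob X) (F : Vec (Fin p) k → Vec (Fin p) n → Vec (Fin p) n → X → ℚ) →
      Av (λ s d z → E κ (F s d z)) ≡ E κ (λ m → Av (λ s d z → F s d z m))
    Av-swap κ F = trans
      (E-cong (U k) (λ s → trans (E-cong (μ ^ n) (λ d → E-swap (U n) κ _)) (E-swap (μ ^ n) κ _)))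
      (E-swap (U k) κ _)

    form-unfold : form k (suc n) f g ≡
      Av (λ s d z → E μ (λ d₀ → E u (λ z₀ → sq (E ν (λ e₀ → G s d z (z₀ ⊕ e₀) ((z₀ ⊕ e₀) ⊕ d₀))))))
    form-unfold = E-cong (U k) (λ s → begin-equality
      E (μ ^ suc n) (λ d → E (U (suc n)) (λ z → Q s d z))
        ≡⟨ E-∷ μ n _ ⟩
      E μ (λ d₀ → E (μ ^ n) (λ d → E (U (suc n)) (λ z → Q s (d₀ ∷ d) z)))
        ≡⟨ E-cong μ (λ d₀ → E-cong (μ ^ n) (λ d → trans (E-∷ u n _) (E-swap u (U n) _))) ⟩
      E μ (λ d₀ → E (μ ^ n) (λ d → E (U n) (λ z → E u (λ z₀ → Q s (d₀ ∷ d) (z₀ ∷ z)))))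
        ≡⟨ trans (E-swap μ (μ ^ n) _) (E-cong (μ ^ n) (λ d → E-swap μ (U n) _)) ⟩
      E (μ ^ n) (λ d → E (U n) (λ z → E μ (λ d₀ → E u (λ z₀ → Q s (d₀ ∷ d) (z₀ ∷ z)))))
        ≡⟨ E-cong (μ ^ n) (λ d → E-cong (U n) (λ z → E-cong μ (λ d₀ → E-cong u (λ z₀ → cong sq (E-∷ ν n _))))) ⟩
      E (μ ^ n) (λ d → E (U n) (λ z → E μ (λ d₀ → E u (λ z₀ → sq (E ν (λ e₀ → G s d z (z₀ ⊕ e₀) ((z₀ ⊕ e₀) ⊕ d₀))))))) ∎)
      where
      Q : Vec (Fin p) k → Vec (Fin p) (suc n) → Vec (Fin p) (suc n) → ℚ
      Q s d z = sq (E (ν ^ suc n) (λ e → E (U k) (λ x → f x (z ⊞ e) * g (x ⊞ s) ((z ⊞ e) ⊞ d))))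

    -- Freezing slices the two functions at the different values v and v + d₀, which is why `form`
    -- keeps `f` and `g` apart.
    Av-dead : ∀ d₀ → Av (λ s d z → dead (G s d z) d₀) ≡ E u (λ v → form k n (slice f v) (slice g (v ⊕ d₀)))
    Av-dead d₀ = Av-swap u (λ s d z v → sq (G s d z v (v ⊕ d₀)))

    Av-alive : Av (λ s d z → alive (G s d z)) ≡ form (suc k) n (move f) (move g)
    Av-alive = begin-equality
      Av (λ s d z → alive (G s d z))
        ≡⟨ Av-swap u (λ s d z s₀ → sq (E u (λ v → G s d z v (v ⊕ s₀)))) ⟩
      E u (λ s₀ → Av (λ s d z → sq (E u (λ v → G s d z v (v ⊕ s₀)))))
        ≡⟨ E-cong u (λ s₀ → E-cong (U k) (λ s → E-cong (μ ^ n) (λ d → E-cong (U n) (λ z → cong sq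
             (trans (E-swap u (ν ^ n) _) (E-cong (ν ^ n) (λ e → sym (E-∷ u k _)))))))) ⟩
      E u (λ s₀ → E (U k) (λ s → E (μ ^ n) (λ d → E (U n) (λ z → sq (E (ν ^ n) (λ e → E (U (suc k)) (λ x →
        move f x (z ⊞ e) * move′ s₀ s x ((z ⊞ e) ⊞ d))))))))
        ≡⟨ E-cong u (λ s₀ → E-cong (U k) (λ s → E-cong (μ ^ n) (λ d → E-cong (U n) (λ z → cong sq
             (E-cong (ν ^ n) (λ e → E-cong (U (suc k)) (λ x → cong (move f x (z ⊞ e) *_) (move′≡ s₀ s x _)))))))) ⟩
      E u (λ s₀ → E (U k) (λ s → E (μ ^ n) (λ d → E (U n) (λ z → sq (E (ν ^ n) (λ e → E (U (suc k)) (λ x →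
        move f x (z ⊞ e) * move g (x ⊞ (s₀ ∷ s)) ((z ⊞ e) ⊞ d))))))))
        ≡⟨ E-∷ u k _ ⟨
      form (suc k) n (move f) (move g) ∎
      where
      move′ : Fin p → Vec (Fin p) k → Vec (Fin p) (suc k) → Vec (Fin p) n → ℚ
      move′ s₀ s (v ∷ x) z = g (x ⊞ s) ((v ⊕ s₀) ∷ z)
      move′≡ : ∀ s₀ s x z → move′ s₀ s x z ≡ move g (x ⊞ (s₀ ∷ s)) z
      move′≡ s₀ s (v ∷ x) z = refl

    -- The two mixtures are independent, so both shifts are uniform with probability ρ²; the bound
    -- is the average ρ² a + (1 - ρ²) b.
    form-suc-≤ : ∀ (a b : ℚ) →
      form (suc k) n (move f) (move g) ≤ a →
      (∀ d₀ → E u (λ v → form k n (slice f v) (slice g (v ⊕ d₀))) ≤ b) →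
      form k (suc n) f g ≤ b + (ρ * ρ) * (a - b)
    form-suc-≤ a b alive≤ dead≤ = begin
      form k (suc n) f g
        ≡⟨ form-unfold ⟩
      Av (λ s d z → E μ (λ d₀ → E u (λ z₀ → sq (E ν (λ e₀ → G s d z (z₀ ⊕ e₀) ((z₀ ⊕ e₀) ⊕ d₀))))))
        ≤⟨ E-mono (U k) (λ s → E-mono (μ ^ n) (λ d → E-mono (U n) (λ z → branch-≤ (G s d z)))) ⟩
      Av (λ s d z → E (hat mixν) (λ m → E (hat mixμ) (branch (G s d z) m)))
        ≡⟨ trans (Av-swap (hat mixν) _) (E-cong (hat mixν) (λ m → Av-swap (hat mixμ) _)) ⟩
      E (hat mixν) (λ m → E (hat mixμ) (λ m′ → Av (λ s d z → branch (G s d z) m m′)))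
        ≤⟨ E-mono (hat mixν) (λ m → E-mono (hat mixμ) (case m)) ⟩
      E (hat mixν) (λ m → E (hat mixμ) (λ m′ → b + (isNothing m * isNothing m′) * (a - b)))
        ≡⟨ E-cong (hat mixν) (λ m → trans (E-+ (hat mixμ) _ _) (cong₂ _+_ (E-const (hat mixμ) b)
             (trans (E-*ʳ (hat mixμ) (a - b) _) (cong (_* (a - b))
               (trans (E-* (hat mixμ) (isNothing m) isNothing) (cong (isNothing m *_) (weight mixμ))))))) ⟩
      E (hat mixν) (λ m → b + (isNothing m * ρ) * (a - b))
        ≡⟨ trans (E-+ (hat mixν) _ _) (cong₂ _+_ (E-const (hat mixν) b)
             (trans (E-*ʳ (hat mixν) (a - b) _) (cong (_* (a - b))
               (trans (E-*ʳ (hat mixν) ρ isNothing) (cong (_* ρ) (weight mixν)))))) ⟩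
      b + (ρ * ρ) * (a - b) ∎
      where
      l₀ : ∀ c t → t ≡ t + (0ℚ * c) * (a - t)
      l₀ c t = lemma c t (a - t)
        where
        lemma : ∀ c t d → t ≡ t + (0ℚ * c) * d
        lemma = solve-∀ ℚ-ring
      l₁ : ∀ a b → a ≡ b + (1ℚ * 1ℚ) * (a - b)
      l₁ = solve-∀ ℚ-ring
      Av-dead-≤ : ∀ d₀ → Av (λ s d z → dead (G s d z) d₀) ≤ b
      Av-dead-≤ d₀ = ≤-trans (≤-reflexive (Av-dead d₀)) (dead≤ d₀)
      case : ∀ m m′ → Av (λ s d z → branch (G s d z) m m′) ≤ b + (isNothing m * isNothing m′) * (a - b)
      case nothing  nothing   = ≤-trans (≤-reflexive Av-alive) (≤-trans alive≤ (≤-reflexive (l₁ a b)))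
      case nothing  (just d₀) = ≤-trans (Av-dead-≤ d₀) (≤-reflexive (l₀ 1ℚ b))
      case (just _) (just d₀) = ≤-trans (Av-dead-≤ d₀) (≤-reflexive (l₀ 0ℚ b))
      case (just _) nothing   = ≤-trans (≤-reflexive (Av-swap u _))
        (≤-trans (E-≤-const u Av-dead-≤) (≤-reflexive (l₀ 1ℚ b)))

    mean-move : mean (suc k) n (move f) ≡ mean k (suc n) f
    mean-move = trans (E-∷ u k _) (trans (E-swap u (U k) _) (E-cong (U k) (λ x → sym (E-∷ u n (f x)))))

    mean-slice : E u (λ v → mean k n (slice f v)) ≡ mean k (suc n) f
    mean-slice = trans (E-swap u (U k) _) (E-cong (U k) (λ x → sym (E-∷ u n (f x))))

0≤½ : 0ℚ ≤ ½
0≤½ = nonNegative⁻¹ ½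

1≤power-2 : ∀ n → 1ℚ ≤ power 2ℚ n
1≤power-2 zero    = ≤-refl
1≤power-2 (suc n) = ≤-trans (1≤power-2 n) (≤-by (power 2ℚ n) (l (power 2ℚ n)) (0≤power n 0≤2))
  where
  l : ∀ a → 2ℚ * a ≡ a + a
  l = solve-∀ ℚ-ring

indicator-within : ∀ b {δ} → 0ℚ ≤ δ → δ ≤ 1ℚ → Within 1ℚ (indicator b - δ)
indicator-within true  {δ} 0≤δ δ≤1 = ≤-by δ (l₁ δ) 0≤δ , ≤-by (1ℚ + (1ℚ - δ)) (l₂ δ) (0≤-+ 0≤1 (0≤-sub δ≤1))
  where
  l₁ : ∀ δ → 1ℚ ≡ (1ℚ - δ) + δ
  l₁ = solve-∀ ℚ-ring
  l₂ : ∀ δ → 1ℚ ≡ - (1ℚ - δ) + (1ℚ + (1ℚ - δ))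
  l₂ = solve-∀ ℚ-ring
indicator-within false {δ} 0≤δ δ≤1 = ≤-by (1ℚ + δ) (l₁ δ) (0≤-+ 0≤1 0≤δ) , ≤-by (1ℚ - δ) (l₂ δ) (0≤-sub δ≤1)
  where
  l₁ : ∀ δ → 1ℚ ≡ (0ℚ - δ) + (1ℚ + δ)
  l₁ = solve-∀ ℚ-ring
  l₂ : ∀ δ → 1ℚ ≡ - (0ℚ - δ) + (1ℚ - δ)
  l₂ = solve-∀ ℚ-ring

-- Upper bound for the form in the absence of a density increment

module Increment (p : ℕ) .{{_ : ℕ.NonZero p}} (pr : Prime p)
  {μ ν : Prob (Fin p)} {ρ : ℚ} (mixμ : Mixture μ ρ) (mixν : Mixture ν ρ)
  (N : ℕ) {δ κ : ℚ} (0≤δ : 0ℚ ≤ δ) (δ≤1 : δ ≤ 1ℚ) (0≤κ : 0ℚ ≤ κ)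
  (dense : ∀ (A : Vec (Fin p) N → Bool) → RestrictedAPFree p A →
           E (Arithmetic.U p N) (λ x → indicator (A x)) ≤ δ + κ)
  where

  open Arithmetic p
  open Fourier p pr
  open Correlation p pr
  open Subspace p pr
  open Restriction p pr mixμ mixν
  open Mixture
  open ≤-Reasoning

  private u = unif p

  balanced : ∀ {k n} → (Vec (Fin p) k → Vec (Fin p) n → Bool) → Vec (Fin p) k → Vec (Fin p) n → ℚ
  balanced A x z = indicator (A x z) - δ

  shrink : ℚ
  shrink = 1ℚ - ½ * (ρ * ρ)

  0≤shrink : 0ℚ ≤ shrink
  0≤shrink = ≤-trans 0≤½ (≤-by (½ * (1ℚ - ρ * ρ)) (l (ρ * ρ)) (0≤-* 0≤½ (0≤-sub ρρ≤1)))
    where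
    l : ∀ r → 1ℚ - ½ * r ≡ ½ + ½ * (1ℚ - r)
    l = solve-∀ ℚ-ring
    0≤isNothing : ∀ (m : Maybe (Fin p)) → 0ℚ ≤ isNothing m
    0≤isNothing (just _) = ≤-refl
    0≤isNothing nothing  = 0≤1
    isNothing≤1 : ∀ (m : Maybe (Fin p)) → isNothing m ≤ 1ℚ
    isNothing≤1 (just _) = 0≤1
    isNothing≤1 nothing  = ≤-refl
    ρρ≤1 : ρ * ρ ≤ 1ℚ
    ρρ≤1 = sq-mono {ρ} {1ℚ}
      (subst (0ℚ ≤_) (weight mixμ) (0≤E (hat mixμ) 0≤isNothing))
      (subst (_≤ 1ℚ) (weight mixμ) (E-≤-const (hat mixμ) isNothing≤1))

  -- Being affine in the mean of `f`, this is preserved exactly when slices are averaged, even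
  -- though single slices need not have mean zero.
  main : ∀ k n → (Vec (Fin p) k → Vec (Fin p) n → ℚ) → ℚ
  main k n f = nat p * (2ℚ * κ - mean k n f)

  -- 2^j shrink^n dominates the probability that fewer than j of n coordinates become uniform for both shifts.
  tail : ℕ → ℕ → ℚ
  tail j n = (1ℚ + nat p) * (power 2ℚ j * power shrink n)

  0≤tail : ∀ j n → 0ℚ ≤ tail j n
  0≤tail j n = 0≤-* (0≤-+ 0≤1 (0≤nat p)) (0≤-* (0≤power j 0≤2) (0≤power n 0≤shrink))

  Bounded₂ : ∀ {k n} → (Vec (Fin p) k → Vec (Fin p) n → ℚ) → Set
  Bounded₂ g = ∀ x z → Within 1ℚ (g x z)

  balanced-bounded : ∀ {k n} (A : Vec (Fin p) k → Vec (Fin p) n → Bool) → Bounded₂ (balanced A)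
  balanced-bounded A x z = indicator-within (A x z) 0≤δ δ≤1

  -- Jensen moves the pending `e` outside the square, where z absorbs it; the pending `d` merely
  -- selects a slice of `g`.
  form-≤-crossEnergy : ∀ k n (f g : Vec (Fin p) k → Vec (Fin p) n → ℚ) →
    form k n f g ≤ E (μ ^ n) (λ d → E (U n) (λ z → crossEnergy (λ x → f x z) (λ x → g x (z ⊞ d))))
  form-≤-crossEnergy k n f g = begin
    form k n f g
      ≤⟨ E-mono (U k) (λ s → E-mono (μ ^ n) (λ d → E-mono (U n) (λ z → jensen (ν ^ n) _))) ⟩
    E (U k) (λ s → E (μ ^ n) (λ d → E (U n) (λ z → E (ν ^ n) (λ e → F s d (z ⊞ e)))))
      ≡⟨ E-cong (U k) (λ s → E-cong (μ ^ n) (λ d → trans (E-swap (U n) (ν ^ n) _)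
           (trans (E-cong (ν ^ n) (λ e → U-invariant e (F s d))) (E-const (ν ^ n) _)))) ⟩
    E (U k) (λ s → E (μ ^ n) (λ d → E (U n) (F s d)))
      ≡⟨ trans (E-swap (U k) (μ ^ n) _) (E-cong (μ ^ n) (λ d → E-swap (U k) (U n) _)) ⟩
    E (μ ^ n) (λ d → E (U n) (λ z → crossEnergy (λ x → f x z) (λ x → g x (z ⊞ d)))) ∎
    where
    F : Vec (Fin p) k → Vec (Fin p) n → Vec (Fin p) n → ℚ
    F s d z = sq (E (U k) (λ x → f x z * g (x ⊞ s) (z ⊞ d)))

  -- With N p uniform coordinates, every `ℓ` vanishes on some combinatorial copy of F_p^N, and
  -- `dense` applies to `A` on its translates. The function `g` enters through its bound alone, so
  -- slices at foreign values do no harm.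
  form-full-≤ : ∀ n (A : Vec (Fin p) (N ℕ.* p) → Vec (Fin p) n → Bool) g → APFree₂ A → Bounded₂ g →
                form (N ℕ.* p) n (balanced A) g ≤ main (N ℕ.* p) n (balanced A)
  form-full-≤ n A g free bg = begin
    form k n f g
      ≤⟨ form-≤-crossEnergy k n f g ⟩
    E (μ ^ n) (λ d → E (U n) (λ z → crossEnergy (λ x → f x z) (λ x → g x (z ⊞ d))))
      ≤⟨ E-mono (μ ^ n) (λ d → E-mono (U n) (λ z → crossEnergy-≤ (λ x → f x z) (λ x → g x (z ⊞ d)) κ
           (λ x → balanced-bounded A x z) (λ x → bg x (z ⊞ d)) 0≤κ (subspaces z))) ⟩
    E (μ ^ n) (λ d → E (U n) (λ z → nat p * (2ℚ * κ - E (U k) (λ x → f x z))))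
      ≡⟨ E-const (μ ^ n) _ ⟩
    E (U n) (λ z → nat p * (2ℚ * κ - E (U k) (λ x → f x z)))
      ≡⟨ trans (E-* (U n) (nat p) _) (cong (nat p *_) (trans (E-sub (U n) _ _)
           (cong₂ _-_ (E-const (U n) (2ℚ * κ)) (E-swap (U n) (U k) _)))) ⟩
    main k n f ∎
    where
    k = N ℕ.* p
    f = balanced A
    δ+κ-δ : ∀ δ κ → (δ + κ) - δ ≡ κ
    δ+κ-δ = solve-∀ ℚ-ring
    subspaces : ∀ z ℓ → ∃[ ι ] (∀ t → dot ℓ (ι t) ≡ 0ₚ) × (∀ x → E (U N) (λ t → f (x ⊞ ι t) z) ≤ κ)
    subspaces z ℓ = let Bs , Bs≢ , dot≡0 = isotropic N ℓ in
      blow 0ₚ Bs , dot≡0 , λ x → begin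
        E (U N) (λ t → indicator (A (x ⊞ blow 0ₚ Bs t) z) - δ)
          ≡⟨ trans (E-sub (U N) _ _) (cong (λ t → E (U N) (λ t → indicator (A (x ⊞ blow 0ₚ Bs t) z)) - t) (E-const (U N) δ)) ⟩
        E (U N) (λ t → indicator (A (x ⊞ blow 0ₚ Bs t) z)) - δ
          ≤⟨ +-monoˡ-≤ (- δ) (dense _ (subspace-free {N} {n} {A} free x z Bs≢)) ⟩
        (δ + κ) - δ
          ≡⟨ δ+κ-δ δ κ ⟩
        κ ∎

  form-within-1 : ∀ k n (f g : Vec (Fin p) k → Vec (Fin p) n → ℚ) → Bounded₂ f → Bounded₂ g → form k n f g ≤ 1ℚ
  form-within-1 k n f g bf bg =
    E-≤-const (U k) (λ s → E-≤-const (μ ^ n) (λ d → E-≤-const (U n) (λ z → sq-within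
      (within-E-const (ν ^ n) (λ e → within-E-const (U k) (λ x →
        within-* {1ℚ} {f x (z ⊞ e)} {1ℚ} {g (x ⊞ s) ((z ⊞ e) ⊞ d)} (bf x (z ⊞ e)) (bg (x ⊞ s) ((z ⊞ e) ⊞ d))))))))

  -- Induction along the pending coordinates, with `j` the number still to be made uniform. A
  -- coordinate either joins the uniform part and lowers `j`, or is frozen; `tail` pays for running
  -- out too early.
  form-≤ : ∀ j k n → j ℕ.+ k ≡ N ℕ.* p → (A : Vec (Fin p) k → Vec (Fin p) n → Bool) → ∀ g → APFree₂ A → Bounded₂ g →
           form k n (balanced A) g ≤ main k n (balanced A) + tail j n
  form-≤ zero .(N ℕ.* p) n refl A g free bg =
    ≤-trans (form-full-≤ n A g free bg) (≤-by (tail 0 n) refl (0≤tail 0 n))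
  -- No coordinate is left: the form is at most 1 while `main` may be as low as -p, whence the
  -- factor 1 + p in `tail`.
  form-≤ (suc j) k zero eq A g free bg = ≤-trans (form-within-1 k 0 f g (balanced-bounded A) bg)
    (≤-by (nat p * (2ℚ * κ + (1ℚ - mean k 0 f)) + (1ℚ + nat p) * (power 2ℚ (suc j) - 1ℚ))
      (l (nat p) (2ℚ * κ) (mean k 0 f) (power 2ℚ (suc j)))
      (0≤-+ (0≤-* (0≤nat p) (0≤-+ (0≤-* 0≤2 0≤κ) (0≤-sub mean≤1)))
            (0≤-* (0≤-+ 0≤1 (0≤nat p)) (0≤-sub (1≤power-2 (suc j))))))
    where
    f = balanced A
    mean≤1 : mean k 0 f ≤ 1ℚ
    mean≤1 = E-≤-const (U k) (λ x → E-≤-const (U 0) (λ z → proj₁ (balanced-bounded A x z)))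
    l : ∀ P K m T → P * (K - m) + (1ℚ + P) * (T * 1ℚ) ≡ 1ℚ + (P * (K + (1ℚ - m)) + (1ℚ + P) * (T - 1ℚ))
    l = solve-∀ ℚ-ring
  form-≤ (suc j) k (suc n) eq A g free bg = begin
    form k (suc n) f g
      ≤⟨ form-suc-≤ (main k (suc n) f + tail j n) (main k (suc n) f + tail (suc j) n) alive≤ dead≤ ⟩
    (main k (suc n) f + tail (suc j) n) + (ρ * ρ) * ((main k (suc n) f + tail j n) - (main k (suc n) f + tail (suc j) n))
      -- The recursion closes with equality, 2^(j+1) - ρ² 2^j = 2^(j+1) (1 - ρ²/2); this dictates
      -- the value of `shrink`.
      ≡⟨ l (main k (suc n) f) (1ℚ + nat p) (power 2ℚ j) (power shrink n) (ρ * ρ) ⟩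
    main k (suc n) f + tail (suc j) (suc n) ∎
    where
    f = balanced A
    open Step f g
    l : ∀ m c T S r → (m + c * (2ℚ * T * S)) + r * ((m + c * (T * S)) - (m + c * (2ℚ * T * S)))
                    ≡ m + c * (2ℚ * T * ((1ℚ - ½ * r) * S))
    l = solve-∀ ℚ-ring
    move-balanced : ∀ x z → move f x z ≡ balanced (move A) x z
    move-balanced (v ∷ x) z = refl
    move-bounded : Bounded₂ (move g)
    move-bounded (v ∷ x) z = bg x (v ∷ z)
    form-cong : form (suc k) n (move f) (move g) ≡ form (suc k) n (balanced (move A)) (move g)
    form-cong = E-cong (U (suc k)) (λ s → E-cong (μ ^ n) (λ d → E-cong (U n) (λ z → cong sq
      (E-cong (ν ^ n) (λ e → E-cong (U (suc k)) (λ x → cong (_* move g (x ⊞ s) ((z ⊞ e) ⊞ d)) (move-balanced x (z ⊞ e))))))))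
    mean-cong : mean (suc k) n (balanced (move A)) ≡ mean k (suc n) f
    mean-cong = trans (E-cong (U (suc k)) (λ x → E-cong (U n) (λ z → sym (move-balanced x z)))) mean-move
    alive≤ : form (suc k) n (move f) (move g) ≤ main k (suc n) f + tail j n
    alive≤ = begin
      form (suc k) n (move f) (move g)
        ≡⟨ form-cong ⟩
      form (suc k) n (balanced (move A)) (move g)
        ≤⟨ form-≤ j (suc k) n (trans (ℕₚ.+-suc j k) eq) (move A) (move g) (move-free free) move-bounded ⟩
      main (suc k) n (balanced (move A)) + tail j n
        ≡⟨ cong (λ m → nat p * (2ℚ * κ - m) + tail j n) mean-cong ⟩
      main k (suc n) f + tail j n ∎
    dead≤ : ∀ d₀ → E u (λ v → form k n (slice f v) (slice g (v ⊕ d₀))) ≤ main k (suc n) f + tail (suc j) n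
    dead≤ d₀ = begin
      E u (λ v → form k n (slice f v) (slice g (v ⊕ d₀)))
        ≤⟨ E-mono u (λ v → form-≤ (suc j) k n eq (λ x z → A x (v ∷ z)) (slice g (v ⊕ d₀)) (fix-free free v)
             (λ x z → bg x ((v ⊕ d₀) ∷ z))) ⟩
      E u (λ v → main k n (slice f v) + tail (suc j) n)
        ≡⟨ trans (E-+ u _ _) (cong₂ _+_ (trans (E-* u (nat p) _) (cong (nat p *_)
             (trans (E-sub u _ _) (cong₂ _-_ (E-const u (2ℚ * κ)) mean-slice)))) (E-const u (tail (suc j) n))) ⟩
      main k (suc n) f + tail (suc j) n ∎

E-sum : ∀ {X : Set} (μ : Prob X) {n} (F : X → Fin n → ℚ) → E μ (λ x → sum (F x)) ≡ sum (λ i → E μ (λ x → F x i))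
E-sum μ {zero}  F = E-const μ 0ℚ
E-sum μ {suc n} F = trans (E-+ μ _ _) (+-congˡ (E μ (λ x → F x Fin.zero)) (E-sum μ (λ x → F x ∘ Fin.suc)))

sum-sub : ∀ {n} (f g : Fin n → ℚ) → sum (λ i → f i - g i) ≡ sum f - sum g
sum-sub {zero}  f g = refl
sum-sub {suc n} f g = trans (+-congˡ (f Fin.zero - g Fin.zero) (sum-sub (f ∘ Fin.suc) (g ∘ Fin.suc)))
  (l (f Fin.zero) (g Fin.zero) (sum (f ∘ Fin.suc)) (sum (g ∘ Fin.suc)))
  where
  l : ∀ a b c d → (a - b) + (c - d) ≡ (a + c) - (b + d)
  l = solve-∀ ℚ-ring

-- Point masses

wt : ∀ {n} → Prob (Fin n) → Fin n → ℚ
wt μ x = E μ (λ y → [ y ≟ x ]-ind)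

E-wt : ∀ {n} (μ : Prob (Fin n)) φ → E μ φ ≡ sum (λ x → wt μ x * φ x)
E-wt μ φ = trans (E-cong μ (λ y → sym (sum-ind y φ)))
  (trans (E-sum μ (λ y x → [ y ≟ x ]-ind * φ x)) (sum-cong (λ x → E-*ʳ μ (φ x) (λ y → [ y ≟ x ]-ind))))

0≤ind : ∀ {n} (a b : Fin n) → 0ℚ ≤ [ a ≟ b ]-ind
0≤ind a b with does (a Finₚ.≟ b)
... | true  = 0≤1
... | false = ≤-refl

ind-refl : ∀ {n} (a : Fin n) → [ a ≟ a ]-ind ≡ 1ℚ
ind-refl a = cong (λ b → if b then 1ℚ else 0ℚ) (dec-true (a Finₚ.≟ a) refl)

-- Mass at least 1/h, with the denominator cleared.
AtLeast : ∀ {n} → Prob (Fin n) → ℕ → Fin n → Set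
AtLeast μ h x = 1ℚ ≤ nat h * wt μ x

AtLeast-mono : ∀ {n} (μ : Prob (Fin n)) x {h h′} → h ℕ.≤ h′ → AtLeast μ h x → AtLeast μ h′ x
AtLeast-mono μ x {h} {h′} h≤h′ at = ≤-trans at
  (*-monoʳ-≤-nonNeg (wt μ x) {{nonNegative (0≤E μ (λ y → 0≤ind y x))}} (nat-mono h≤h′))

Charged : ∀ {n} → Prob (Fin n) → Fin n → Set
Charged μ x = ∃[ h ] AtLeast μ h x

uniformly : ∀ {n} {P : Fin n → ℕ → Set} → (∀ i {h h′} → h ℕ.≤ h′ → P i h → P i h′) →
            (∀ i → ∃ (P i)) → ∃[ h ] (∀ i → P i h)
uniformly {zero}  mono ex = 0 , λ ()
uniformly {suc n} mono ex =
  let h₀ , p₀ = ex Fin.zero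
      h₁ , p₁ = uniformly (mono ∘ Fin.suc) (ex ∘ Fin.suc)
  in  h₀ ℕ.+ h₁ , λ { Fin.zero    → mono Fin.zero (ℕₚ.m≤m+n h₀ h₁) p₀
                    ; (Fin.suc i) → mono (Fin.suc i) (ℕₚ.m≤n+m h₁ h₀) (p₁ i) }

recip≤1 : ∀ n .{{_ : ℕ.NonZero n}} → recip n ≤ 1ℚ
recip≤1 n@(suc n-1) = ≤-by (nat n-1 * recip n) (trans (sym (nat*recip n)) (l (nat n-1) (recip n)))
  (0≤-* (0≤nat n-1) (0≤recip n))
  where
  l : ∀ a r → (1ℚ + a) * r ≡ r + a * r
  l = solve-∀ ℚ-ring

recip-≤ : ∀ n .{{_ : ℕ.NonZero n}} {w} → 1ℚ ≤ nat n * w → recip n ≤ w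
recip-≤ n {w} 1≤nw = begin
  recip n               ≡⟨ *-identityʳ (recip n) ⟨
  recip n * 1ℚ          ≤⟨ *-monoˡ (0≤recip n) 1≤nw ⟩
  recip n * (nat n * w) ≡⟨ *-assoc (recip n) (nat n) w ⟨
  recip n * nat n * w   ≡⟨ cong (_* w) (trans (*-comm (recip n) (nat n)) (nat*recip n)) ⟩
  1ℚ * w                ≡⟨ *-identityˡ w ⟩
  w                     ∎
  where open ≤-Reasoning

-- The uniform law scaled by 1/h has mass 1/(hp) at each point, no more than the 1/h available. That
-- share is recorded as `nothing` and `rest` keeps the remainder.
mixture : ∀ {p} .{{_ : ℕ.NonZero p}} {μ : Prob (Fin p)} h .{{_ : ℕ.NonZero h}} →
          (∀ x → AtLeast μ h x) → Mixture μ (recip h)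
mixture {p} {μ} h at = record
  { hat    = hat
  ; split  = split
  ; weight = trans (E-hat isNothing) (trans
      (cong (ρ * 1ℚ +_) (sum-zeros p _ (λ x → *-zeroʳ (rest x)))) (l₃ ρ))
  }
  where
  open ≡-Reasoning
  ρ = recip h
  rest : Fin p → ℚ
  rest x = wt μ x - ρ * recip p
  0≤rest : ∀ x → 0ℚ ≤ rest x
  0≤rest x = 0≤-sub (≤-trans (*-monoˡ (0≤recip h) (recip≤1 p))
    (≤-trans (≤-reflexive (*-identityʳ ρ)) (recip-≤ h (at x))))
  sum-rest : ∀ φ → sum (λ x → rest x * φ x) ≡ E μ φ - ρ * E (unif p) φ
  sum-rest φ = begin
    sum (λ x → rest x * φ x)
      ≡⟨ sum-cong (λ x → l₁ (wt μ x) ρ (recip p) (φ x)) ⟩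
    sum (λ x → wt μ x * φ x - ρ * (recip p * φ x))
      ≡⟨ sum-sub (λ x → wt μ x * φ x) (λ x → ρ * (recip p * φ x)) ⟩
    sum (λ x → wt μ x * φ x) - sum (λ x → ρ * (recip p * φ x))
      ≡⟨ cong₂ _-_ (sym (E-wt μ φ)) (trans (sum-* ρ (λ x → recip p * φ x)) (cong (ρ *_) (trans (sum-* (recip p) φ) (sym (E-unif p φ))))) ⟩
    E μ φ - ρ * E (unif p) φ ∎
    where
    l₁ : ∀ w ρ r f → (w - ρ * r) * f ≡ w * f - ρ * (r * f)
    l₁ = solve-∀ ℚ-ring
  ws : Atoms (Maybe (Fin p))
  ws = (ρ , nothing) ∷ List.tabulate (λ x → rest x , just x)
  ∑-ws : ∀ f → ∑ ws f ≡ ρ * f nothing + sum (λ x → rest x * f (just x))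
  ∑-ws f = +-congˡ (ρ * f nothing) (∑-tabulate rest just f)
  l₂ : ∀ ρ c e → ρ * c + (e - ρ * c) ≡ e
  l₂ = solve-∀ ℚ-ring
  l₃ : ∀ ρ → ρ * 1ℚ + 0ℚ ≡ ρ
  l₃ = solve-∀ ℚ-ring
  hat : Prob (Maybe (Fin p))
  hat = record
    { atoms  = ws
    ; nonneg = 0≤recip h ∷ tabulate-nonneg p rest just 0≤rest
    ; mass   = begin
        ∑ ws (λ _ → 1ℚ)
          ≡⟨ ∑-ws (λ _ → 1ℚ) ⟩
        ρ * 1ℚ + sum (λ x → rest x * 1ℚ)
          ≡⟨ cong (ρ * 1ℚ +_) (trans (sum-rest (λ _ → 1ℚ)) (cong₂ (λ s t → s - ρ * t) (E-const μ 1ℚ) (E-const (unif p) 1ℚ))) ⟩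
        ρ * 1ℚ + (1ℚ - ρ * 1ℚ)
          ≡⟨ l₂ ρ 1ℚ 1ℚ ⟩
        1ℚ ∎
    }
  E-hat : ∀ f → E hat f ≡ ρ * f nothing + sum (λ x → rest x * f (just x))
  E-hat f = trans (E-∑ hat f) (∑-ws f)
  split : ∀ φ → E μ φ ≡ E hat (maybe φ (E (unif p) φ))
  split φ = sym (trans (E-hat _) (trans (cong (ρ * E (unif p) φ +_) (sum-rest φ)) (l₂ ρ (E (unif p) φ) (E μ φ))))

-- Supports of iterated difference distributions

module Support (p : ℕ) .{{_ : ℕ.NonZero p}} (pr : Prime p) where

  open Arithmetic p

  Charged-diff : ∀ {μ x y} → Charged μ x → Charged μ y → Charged (diff _⊖_ μ) (y ⊖ x)
  Charged-diff {μ} {x} {y} (h , 1≤hx) (h′ , 1≤h′y) = h ℕ.* h′ , (begin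
    1ℚ
      ≤⟨ *-mono-≤ {1ℚ} {nat h * wt μ x} {1ℚ} {nat h′ * wt μ y} 0≤1 (≤-trans 0≤1 1≤h′y) 1≤hx 1≤h′y ⟩
    (nat h * wt μ x) * (nat h′ * wt μ y)
      ≡⟨ l (nat h) (wt μ x) (nat h′) (wt μ y) ⟩
    (nat h * nat h′) * (wt μ x * wt μ y)
      ≡⟨ cong₂ _*_ (sym (nat-* h h′)) (trans (sym (E-*ʳ μ (wt μ y) _)) (E-cong μ (λ x′ → sym (E-* μ [ x′ ≟ x ]-ind _)))) ⟩
    nat (h ℕ.* h′) * E μ (λ x′ → E μ (λ y′ → [ x′ ≟ x ]-ind * [ y′ ≟ y ]-ind))
      ≤⟨ *-monoˡ (0≤nat (h ℕ.* h′)) (E-mono μ (λ x′ → E-mono μ (λ y′ → pointwise x′ y′))) ⟩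
    nat (h ℕ.* h′) * E μ (λ x′ → E μ (λ y′ → [ y′ ⊖ x′ ≟ y ⊖ x ]-ind))
      ≡⟨ cong (nat (h ℕ.* h′) *_) (E-diff _⊖_ μ _) ⟨
    nat (h ℕ.* h′) * wt (diff _⊖_ μ) (y ⊖ x) ∎)
    where
    open ≤-Reasoning
    l : ∀ a b c d → (a * b) * (c * d) ≡ (a * c) * (b * d)
    l = solve-∀ ℚ-ring
    pointwise : ∀ x′ y′ → [ x′ ≟ x ]-ind * [ y′ ≟ y ]-ind ≤ [ y′ ⊖ x′ ≟ y ⊖ x ]-ind
    pointwise x′ y′ with x′ Finₚ.≟ x | y′ Finₚ.≟ y
    ... | yes refl | yes refl = ≤-reflexive (sym (ind-refl (y ⊖ x)))
    ... | yes _    | no _     = 0≤ind (y′ ⊖ x′) (y ⊖ x)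
    ... | no _     | yes _    = 0≤ind (y′ ⊖ x′) (y ⊖ x)
    ... | no _     | no _     = 0≤ind (y′ ⊖ x′) (y ⊖ x)

  diffs : ℕ → Prob (Fin p) → Prob (Fin p)
  diffs zero    μ = μ
  diffs (suc t) μ = diff _⊖_ (diffs t μ)

  x⊖0≡x : ∀ x → x ⊖ 0ₚ ≡ x
  x⊖0≡x x = trans (sym (⊕-identityʳ (x ⊖ 0ₚ))) ([x⊖y]⊕y≡x x 0ₚ)

  x⊖[0⊖g]≡g⊕x : ∀ x g → x ⊖ (0ₚ ⊖ g) ≡ g ⊕ x
  x⊖[0⊖g]≡g⊕x x g = ⊕-cancelˡ (0ₚ ⊖ g) (begin
    (0ₚ ⊖ g) ⊕ (x ⊖ (0ₚ ⊖ g)) ≡⟨ x⊕[y⊖x]≡y (0ₚ ⊖ g) x ⟩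
    x                         ≡⟨ ⊕-identityˡ x ⟨
    0ₚ ⊕ x                    ≡⟨ cong (_⊕ x) ([x⊖y]⊕y≡x 0ₚ g) ⟨
    ((0ₚ ⊖ g) ⊕ g) ⊕ x        ≡⟨ ⊕-assoc (0ₚ ⊖ g) g x ⟩
    (0ₚ ⊖ g) ⊕ (g ⊕ x)        ∎)
    where open ≡-Reasoning

  module _ {μ : Prob (Fin p)} {g : Fin p} (at-0 : Charged μ 0ₚ) (at-g : Charged μ g) where

    diffs-0 : ∀ t → Charged (diffs t μ) 0ₚ
    diffs-0 zero    = at-0
    diffs-0 (suc t) = subst (Charged (diffs (suc t) μ)) (x⊖0≡x 0ₚ) (Charged-diff {diffs t μ} (diffs-0 t) (diffs-0 t))

    diffs-suc : ∀ t {x} → Charged (diffs t μ) x → Charged (diffs (suc t) μ) x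
    diffs-suc t {x} at = subst (Charged (diffs (suc t) μ)) (x⊖0≡x x) (Charged-diff {diffs t μ} (diffs-0 t) at)

    diffs-g : ∀ t → Charged (diffs t μ) g
    diffs-g zero    = at-g
    diffs-g (suc t) = diffs-suc t (diffs-g t)

    -- One difference reaches 0 - g, and a second one reaches x - (0 - g) = g + x.
    diffs-+g : ∀ t {x} → Charged (diffs t μ) x → Charged (diffs (suc (suc t)) μ) (g ⊕ x)
    diffs-+g t {x} at = subst (Charged (diffs (suc (suc t)) μ)) (x⊖[0⊖g]≡g⊕x x g)
      (Charged-diff {diffs (suc t) μ} (Charged-diff {diffs t μ} (diffs-g t) (diffs-0 t)) (diffs-suc t at))

    diffs-multiple : ∀ t i → i ℕ.≤ t → Charged (diffs (t ℕ.+ t) μ) ([ i ] ⊙ g)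
    diffs-multiple t       zero    _           = subst (Charged (diffs (t ℕ.+ t) μ)) (sym (⊙-zeroˡ g)) (diffs-0 (t ℕ.+ t))
    diffs-multiple (suc t) (suc i) (ℕ.s≤s i≤t) =
      subst₂ (λ s x → Charged (diffs s μ) x) (cong suc (sym (ℕₚ.+-suc t t))) g+ig
        (diffs-+g (t ℕ.+ t) (diffs-multiple t i i≤t))
      where
      g+ig : g ⊕ [ i ] ⊙ g ≡ [ suc i ] ⊙ g
      g+ig = begin
        g ⊕ [ i ] ⊙ g          ≡⟨ cong (_⊕ [ i ] ⊙ g) (trans (⊙-comm 1ₚ g) (⊙-identityʳ g)) ⟨
        1ₚ ⊙ g ⊕ [ i ] ⊙ g     ≡⟨ ⊙-distribʳ g 1ₚ [ i ] ⟨
        (1ₚ ⊕ [ i ]) ⊙ g       ≡⟨ cong (_⊙ g) ([]-+ 1 i) ⟩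
        [ suc i ] ⊙ g          ∎
        where open ≡-Reasoning

    -- Every element is a multiple of the invertible `g` by some i < p, and each addition of `g`
    -- costs two differences, whence `p ℕ.+ p`.
    diffs-full : g ≢ 0ₚ → ∀ x → Charged (diffs (p ℕ.+ p) μ) x
    diffs-full g≢0 x = subst (Charged (diffs (p ℕ.+ p) μ)) ig≡x
      (diffs-multiple p (toℕ (x ⊙ y)) (ℕₚ.<⇒≤ (Finₚ.toℕ<n (x ⊙ y))))
      where
      y = proj₁ (inverse pr g g≢0)
      ig≡x : [ toℕ (x ⊙ y) ] ⊙ g ≡ x
      ig≡x = begin
        [ toℕ (x ⊙ y) ] ⊙ g ≡⟨ cong (_⊙ g) ([toℕ] (x ⊙ y)) ⟩
        x ⊙ y ⊙ g           ≡⟨ ⊙-assoc x y g ⟩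
        x ⊙ (y ⊙ g)         ≡⟨ cong (x ⊙_) (trans (⊙-comm y g) (proj₂ (inverse pr g g≢0))) ⟩
        x ⊙ 1ₚ              ≡⟨ ⊙-identityʳ x ⟩
        x                   ∎
        where open ≡-Reasoning

-- Counting progressions

coin : Prob Bool
coin = record
  { atoms  = (½ , false) ∷ (½ , true) ∷ []
  ; nonneg = 0≤½ ∷ 0≤½ ∷ []
  ; mass   = refl
  }

E-coin : ∀ f → E coin f ≡ ½ * f false + (½ * f true + 0ℚ)
E-coin = E-∑ coin

allFalse : ∀ {n} → Vec Bool n → ℚ
allFalse []          = 1ℚ
allFalse (true ∷ b)  = 0ℚ
allFalse (false ∷ b) = allFalse b

E-allFalse : ∀ n → E (coin ^ n) allFalse ≡ power ½ n
E-allFalse zero    = E-[] coin allFalse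
E-allFalse (suc n) = begin
  E (coin ^ suc n) allFalse
    ≡⟨ trans (E-∷ coin n allFalse) (E-coin _) ⟩
  ½ * E (coin ^ n) allFalse + (½ * E (coin ^ n) (λ _ → 0ℚ) + 0ℚ)
    ≡⟨ cong₂ (λ s t → ½ * s + (½ * t + 0ℚ)) (E-allFalse n) (E-const (coin ^ n) 0ℚ) ⟩
  ½ * power ½ n + (½ * 0ℚ + 0ℚ)
    ≡⟨ l (power ½ n) ⟩
  ½ * power ½ n ∎
  where
  open ≡-Reasoning
  l : ∀ a → ½ * a + (½ * 0ℚ + 0ℚ) ≡ ½ * a
  l = solve-∀ ℚ-ring

plus : Bool → Bool → Fin 3
plus false false = Fin.zero
plus false true  = Fin.suc Fin.zero
plus true  false = Fin.suc Fin.zero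
plus true  true  = Fin.suc (Fin.suc Fin.zero)

-- Without reduction modulo p, b + c vanishes only if `b` does. Trivial progressions are thus
-- confined to b = 0, an event of probability 2^(-n).
plus-dichotomy : ∀ {n} (b : Vec Bool n) →
  allFalse b ≡ 1ℚ ⊎ (allFalse b ≡ 0ℚ × ∀ c → zipWith plus b c ≢ replicate n Fin.zero)
plus-dichotomy []          = inj₁ refl
plus-dichotomy (true ∷ b)  = inj₂ (refl , λ { (false ∷ c) () ; (true ∷ c) () })
plus-dichotomy (false ∷ b) with plus-dichotomy b
... | inj₁ eq         = inj₁ eq
... | inj₂ (eq , neq) = inj₂ (eq , λ { (_ ∷ c) eq′ → neq c (Vecₚ.∷-injectiveʳ eq′) })

sqs : ℕ → ℚ → ℚ
sqs zero    x = x
sqs (suc t) x = sq (sqs t x)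

0≤sqs : ∀ t {x} → 0ℚ ≤ x → 0ℚ ≤ sqs t x
0≤sqs zero    0≤x = 0≤x
0≤sqs (suc t) {x} 0≤x = 0≤sq (sqs t x)

sqs-mono : ∀ t {x y} → 0ℚ ≤ x → x ≤ y → sqs t x ≤ sqs t y
sqs-mono zero    0≤x x≤y = x≤y
sqs-mono (suc t) 0≤x x≤y = sq-mono (0≤sqs t 0≤x) (sqs-mono t 0≤x x≤y)

sq-sq-≤ : ∀ {ε t} → 0ℚ < ε → t ≤ - ε → sq (sq ε) ≤ sq (sq t)
sq-sq-≤ {ε} {t} 0<ε t≤-ε = sq-mono (0≤sq ε) (subst (sq ε ≤_) (neg-*-neg t) (sq-mono (<⇒≤ 0<ε)
  (subst (_≤ - t) (l ε) (neg-antimono-≤ t≤-ε))))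
  where
  l : ∀ a → - (- a) ≡ a
  l = solve-∀ ℚ-ring

-- The hypotheses give 4ε ≤ δ³ ≤ ε - Λ - Pδ ≤ 3ε.
main-term-dominates : ∀ ε δ Λ P → 0ℚ ≤ ε → 0ℚ ≤ δ → δ ≤ 1ℚ → nat 4 * ε ≤ δ * (δ * δ) →
                      Λ + (P + δ * δ) * δ ≤ ε → - ε ≤ Λ → - ε ≤ P → ε ≤ 0ℚ
main-term-dominates ε δ Λ P 0≤ε 0≤δ δ≤1 4ε≤δ³ total≤ε -ε≤Λ -ε≤P = ≤-by r (l (nat 4) ε δ Λ P refl) 0≤r
  where
  r = ((δ * (δ * δ) - nat 4 * ε) + (ε - (Λ + (P + δ * δ) * δ))) + (((Λ - (- ε)) + δ * (P - (- ε))) + ε * (1ℚ - δ))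
  0≤r : 0ℚ ≤ r
  0≤r = 0≤-+ (0≤-+ (0≤-sub 4ε≤δ³) (0≤-sub total≤ε))
             (0≤-+ (0≤-+ (0≤-sub -ε≤Λ) (0≤-* 0≤δ (0≤-sub -ε≤P))) (0≤-* 0≤ε (0≤-sub δ≤1)))
  l′ : ∀ ε δ Λ P → 0ℚ ≡ ε + (((δ * (δ * δ) - (2ℚ + 2ℚ) * ε) + (ε - (Λ + (P + δ * δ) * δ))) + (((Λ - (- ε)) + δ * (P - (- ε))) + ε * (1ℚ - δ)))
  l′ = solve-∀ ℚ-ring
  l : ∀ q ε δ Λ P → q ≡ 2ℚ + 2ℚ → 0ℚ ≡ ε + (((δ * (δ * δ) - q * ε) + (ε - (Λ + (P + δ * δ) * δ))) + (((Λ - (- ε)) + δ * (P - (- ε))) + ε * (1ℚ - δ)))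
  l q ε δ Λ P refl = l′ ε δ Λ P

indicator-sq≤1 : ∀ b → sq (indicator b) ≤ 1ℚ
indicator-sq≤1 true  = ≤-refl
indicator-sq≤1 false = 0≤1

module Counting (p : ℕ) .{{_ : ℕ.NonZero p}} (pr : Prime p) where

  open Arithmetic p
  open Fourier p pr
  open Subspace p pr
  open Support p pr

  module CS {n} = CauchySchwarz (_⊞_ {n}) _⊟_ 0ᵥ ⊞-isCommutativeMonoid x⊞[y⊟x]≡y [x⊞y]⊟y≡x (U n) U-invariant

  bit : Bool → Fin p
  bit false = 0ₚ
  bit true  = 1ₚ

  bits : Prob (Fin p)
  bits = push bit coin

  bit₂ : Bool → Fin p
  bit₂ b = bit b ⊕ bit b

  bits₂ : Prob (Fin p)
  bits₂ = push bit₂ coin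

  embed-plus : ∀ b c → bit b ⊕ bit c ≡ embed (plus b c)
  embed-plus false false = []-+ 0 0
  embed-plus false true  = []-+ 0 1
  embed-plus true  false = []-+ 1 0
  embed-plus true  true  = []-+ 1 1

  embedᵥ-plus : ∀ {n} (b c : Vec Bool n) → Vec.map bit b ⊞ Vec.map bit c ≡ embedᵥ (zipWith plus b c)
  embedᵥ-plus []      []      = refl
  embedᵥ-plus (b ∷ bs) (c ∷ cs) = cong₂ _∷_ (embed-plus b c) (embedᵥ-plus bs cs)

  module _ {n : ℕ} where

    open CS {n} using (V; double; apCount; pairCount)
    open ≤-Reasoning

    V-cong : ∀ (γ γ′ β β′ : Prob (Vec (Fin p) n)) {f g} →
             (∀ φ → E γ φ ≡ E γ′ φ) → (∀ φ → E β φ ≡ E β′ φ) → V γ β f g ≡ V γ′ β′ f g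
    V-cong γ γ′ β β′ {f} {g} γ≗γ′ β≗β′ = trans (γ≗γ′ _) (E-cong γ′ (λ d → E-cong (U n) (λ z → cong sq (β≗β′ (λ e → f (z ⊞ e) * g ((z ⊞ e) ⊞ d))))))

    -- Independence of the coordinates makes differencing commute with powers, so the iteration can
    -- be carried out on a single coordinate.
    E-diff-^ : ∀ μ φ → E (diff _⊟_ (μ ^ n)) φ ≡ E (diff _⊖_ μ ^ n) φ
    E-diff-^ μ φ = begin-equality
      E (diff _⊟_ (μ ^ n)) φ
        ≡⟨ E-diff _⊟_ (μ ^ n) φ ⟩
      E (μ ^ n) (λ xs → E (μ ^ n) (λ ys → φ (ys ⊟ xs)))
        ≡⟨ E-cong (μ ^ n) (λ xs → E-cong (μ ^ n) (λ ys → cong φ (map-zip xs ys))) ⟨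
      E (μ ^ n) (λ xs → E (μ ^ n) (λ ys → φ (Vec.map (λ (x , y) → y ⊖ x) (Vec.zip xs ys))))
        ≡⟨ E-⊗-^ μ μ n _ ⟨
      E ((μ ⊗ μ) ^ n) (φ ∘ Vec.map (λ (x , y) → y ⊖ x))
        ≡⟨ E-map _ (μ ⊗ μ) n φ ⟨
      E (diff _⊖_ μ ^ n) φ ∎
      where
      map-zip : ∀ {m} (xs ys : Vec (Fin p) m) → Vec.map (λ (x , y) → y ⊖ x) (Vec.zip xs ys) ≡ ys ⊟ xs
      map-zip []       []       = refl
      map-zip (x ∷ xs) (y ∷ ys) = cong (y ⊖ x ∷_) (map-zip xs ys)

    E-double-^ : ∀ φ → E (push double (bits ^ n)) φ ≡ E (bits₂ ^ n) φ
    E-double-^ φ = begin-equality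
      E (push double (bits ^ n)) φ                    ≡⟨ E-push double (bits ^ n) φ ⟩
      E (bits ^ n) (λ x → φ (x ⊞ x))                  ≡⟨ E-map bit coin n (λ x → φ (x ⊞ x)) ⟩
      E (coin ^ n) (λ b → φ (Vec.map bit b ⊞ Vec.map bit b)) ≡⟨ E-cong (coin ^ n) (λ b → cong φ (double-map b)) ⟩
      E (coin ^ n) (λ b → φ (Vec.map bit₂ b))         ≡⟨ E-map bit₂ coin n φ ⟨
      E (bits₂ ^ n) φ                                 ∎
      where
      double-map : ∀ {m} (b : Vec Bool m) → Vec.map bit b ⊞ Vec.map bit b ≡ Vec.map bit₂ b
      double-map []       = refl
      double-map (b ∷ bs) = cong (bit₂ b ∷_) (double-map bs)

    module _ (f : Vec (Fin p) n → ℚ) where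

      energy : Prob (Fin p) → Prob (Fin p) → ℚ
      energy μ ν = V (μ ^ n) (ν ^ n) f f

      0≤energy : ∀ μ ν → 0ℚ ≤ energy μ ν
      0≤energy μ ν = 0≤E (μ ^ n) (λ d → 0≤E (U n) (λ z → 0≤sq (E (ν ^ n) (λ e → f (z ⊞ e) * f ((z ⊞ e) ⊞ d)))))

      module _ (bf : CS.Bounded f) where

        sqs-energy-≤ˡ : ∀ t μ ν → sqs t (energy μ ν) ≤ energy (diffs t μ) ν
        sqs-energy-≤ˡ zero    μ ν = ≤-refl
        sqs-energy-≤ˡ (suc t) μ ν = begin
          sq (sqs t (energy μ ν))                    ≤⟨ sq-mono (0≤sqs t (0≤energy μ ν)) (sqs-energy-≤ˡ t μ ν) ⟩
          sq (energy (diffs t μ) ν)                  ≤⟨ CS.sq-V-≤-diffˡ (diffs t μ ^ n) (ν ^ n) f bf ⟩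
          V (diff _⊟_ (diffs t μ ^ n)) (ν ^ n) f f   ≡⟨ V-cong (diff _⊟_ (diffs t μ ^ n)) (diff _⊖_ (diffs t μ) ^ n) (ν ^ n) (ν ^ n) {f} {f} (E-diff-^ (diffs t μ)) (λ _ → refl) ⟩
          energy (diffs (suc t) μ) ν                 ∎

        sqs-energy-≤ʳ : ∀ t μ ν → sqs t (energy μ ν) ≤ energy μ (diffs t ν)
        sqs-energy-≤ʳ zero    μ ν = ≤-refl
        sqs-energy-≤ʳ (suc t) μ ν = begin
          sq (sqs t (energy μ ν))                    ≤⟨ sq-mono (0≤sqs t (0≤energy μ ν)) (sqs-energy-≤ʳ t μ ν) ⟩
          sq (energy μ (diffs t ν))                  ≤⟨ CS.sq-V-≤-diffʳ (μ ^ n) (diffs t ν ^ n) f bf ⟩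
          V (μ ^ n) (diff _⊟_ (diffs t ν ^ n)) f f   ≡⟨ V-cong (μ ^ n) (μ ^ n) (diff _⊟_ (diffs t ν ^ n)) (diff _⊖_ (diffs t ν) ^ n) {f} {f} (λ _ → refl) (E-diff-^ (diffs t ν)) ⟩
          energy μ (diffs (suc t) ν)                 ∎

    module _ (A : Vec (Fin p) n → Bool) where

      a : Vec (Fin p) n → ℚ
      a x = indicator (A x)

      density : ℚ
      density = E (U n) a

      deviation : Vec (Fin p) n → ℚ
      deviation x = a x - density

      0≤density : 0ℚ ≤ density
      0≤density = 0≤E (U n) (λ x → 0≤indicator (A x))
        where
        0≤indicator : ∀ b → 0ℚ ≤ indicator b
        0≤indicator true  = 0≤1
        0≤indicator false = ≤-refl

      density≤1 : density ≤ 1ℚ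
      density≤1 = E-≤-const (U n) (λ x → indicator≤1 (A x))
        where
        indicator≤1 : ∀ b → indicator b ≤ 1ℚ
        indicator≤1 true  = ≤-refl
        indicator≤1 false = 0≤1

      private
        β = bits ^ n
        Λ = apCount β β a a deviation
        P = pairCount β β a deviation

      pairCount-expand : pairCount β β a a ≡ P + density * density
      pairCount-expand = begin-equality
        pairCount β β a a
          ≡⟨ E-cong (U n) (λ x → E-cong β (λ b → E-cong β (λ c → l (a x) (a (x ⊞ (b ⊞ c))) density))) ⟩
        E (U n) (λ x → E β (λ b → E β (λ c → a x * deviation (x ⊞ (b ⊞ c)) + a x * density)))
          ≡⟨ E-cong (U n) (λ x → trans (E-cong β (λ b → trans (E-+ β (D x b) _) (+-congˡ (E β (D x b)) (E-const β (a x * density)))))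
               (trans (E-+ β (λ b → E β (D x b)) _) (+-congˡ (E β (λ b → E β (D x b))) (E-const β (a x * density))))) ⟩
        E (U n) (λ x → E β (λ b → E β (λ c → a x * deviation (x ⊞ (b ⊞ c)))) + a x * density)
          ≡⟨ trans (E-+ (U n) (λ x → E β (λ b → E β (D x b))) _) (cong (P +_) (E-*ʳ (U n) density a)) ⟩
        P + density * density ∎
        where
        D : Vec (Fin p) n → Vec (Fin p) n → Vec (Fin p) n → ℚ
        D x b c = a x * deviation (x ⊞ (b ⊞ c))
        l : ∀ a b d → a * b ≡ a * (b - d) + a * d
        l = solve-∀ ℚ-ring

      -- The last indicator is written as `deviation` plus `density`, and then the middle one
      -- likewise. As the step is not uniform, the pair count does not factor and leaves its own
      -- error `P`.
      apCount-expand : apCount β β a a a ≡ Λ + (P + density * density) * density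
      apCount-expand = begin-equality
        apCount β β a a a
          ≡⟨ E-cong (U n) (λ x → E-cong β (λ b → E-cong β (λ c →
               l (a x * a (x ⊞ (b ⊞ c))) (a ((x ⊞ (b ⊞ c)) ⊞ (b ⊞ c))) density))) ⟩
        E (U n) (λ x → E β (λ b → E β (λ c → T x b c + S x b c * density)))
          ≡⟨ E-cong (U n) (λ x → trans (E-cong β (λ b → trans (E-+ β (T x b) _) (cong (E β (T x b) +_) (E-*ʳ β density (S x b)))))
               (trans (E-+ β (λ b → E β (T x b)) _) (cong (E β (λ b → E β (T x b)) +_) (E-*ʳ β density (λ b → E β (S x b)))))) ⟩
        E (U n) (λ x → E β (λ b → E β (T x b)) + E β (λ b → E β (S x b)) * density)
          ≡⟨ trans (E-+ (U n) (λ x → E β (λ b → E β (T x b))) _) (cong (Λ +_) (E-*ʳ (U n) density _)) ⟩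
        Λ + pairCount β β a a * density
          ≡⟨ cong (λ t → Λ + t * density) pairCount-expand ⟩
        Λ + (P + density * density) * density ∎
        where
        S T : Vec (Fin p) n → Vec (Fin p) n → Vec (Fin p) n → ℚ
        S x b c = a x * a (x ⊞ (b ⊞ c))
        T x b c = a x * a (x ⊞ (b ⊞ c)) * deviation ((x ⊞ (b ⊞ c)) ⊞ (b ⊞ c))
        l : ∀ s b d → s * b ≡ s * (b - d) + s * d
        l = solve-∀ ℚ-ring

      module _ (free : RestrictedAPFree p A) where

        progression-≤ : ∀ x (b c : Vec Bool n) → let s = Vec.map bit b ⊞ Vec.map bit c in
                        a x * a (x ⊞ s) * a ((x ⊞ s) ⊞ s) ≤ allFalse b
        progression-≤ x b c with plus-dichotomy b
        ... | inj₁ eq = ≤-trans (product≤1 (A x) _ _) (≤-reflexive (sym eq))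
          where
          product≤1 : ∀ b₁ b₂ b₃ → indicator b₁ * indicator b₂ * indicator b₃ ≤ 1ℚ
          product≤1 true  true  true  = ≤-refl
          product≤1 true  true  false = 0≤1
          product≤1 true  false true  = 0≤1
          product≤1 true  false false = 0≤1
          product≤1 false true  true  = 0≤1
          product≤1 false true  false = 0≤1
          product≤1 false false true  = 0≤1
          product≤1 false false false = 0≤1
        ... | inj₂ (eq , neq) = ≤-reflexive (trans (product≡0 (A x) _ _ not-all) (sym eq))
          where
          s = Vec.map bit b ⊞ Vec.map bit c
          t = zipWith plus b c
          x⊞s : ∀ x → shift p x t ≡ x ⊞ s
          x⊞s x = trans (shift-⊞ x t) (cong (x ⊞_) (sym (embedᵥ-plus b c)))
          product≡0 : ∀ b₁ b₂ b₃ → (b₁ ≡ true → b₂ ≡ true → b₃ ≢ true) → indicator b₁ * indicator b₂ * indicator b₃ ≡ 0ℚ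
          product≡0 true  true  true  h = ⊥-elim (h refl refl refl)
          product≡0 true  true  false _ = refl
          product≡0 true  false true  _ = refl
          product≡0 true  false false _ = refl
          product≡0 false true  true  _ = refl
          product≡0 false true  false _ = refl
          product≡0 false false true  _ = refl
          product≡0 false false false _ = refl
          not-all : A x ≡ true → A (x ⊞ s) ≡ true → A ((x ⊞ s) ⊞ s) ≢ true
          not-all A₀ A₁ A₂ = free x t (neq c)
            (A₀ , trans (cong A (x⊞s x)) A₁ , trans (cong A (trans (cong (λ y → shift p y t) (x⊞s x)) (x⊞s (x ⊞ s)))) A₂)

        apCount-≤ : apCount (bits ^ n) (bits ^ n) a a a ≤ power ½ n
        apCount-≤ = begin
          apCount (bits ^ n) (bits ^ n) a a a
            ≡⟨ E-cong (U n) (λ x → trans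
                 (E-map bit coin n (λ b → E (bits ^ n) (F x b)))
                 (E-cong (coin ^ n) (λ b → E-map bit coin n (F x (Vec.map bit b))))) ⟩
          E (U n) (λ x → E (coin ^ n) (λ b → E (coin ^ n) (λ c →
            let s = Vec.map bit b ⊞ Vec.map bit c in a x * a (x ⊞ s) * a ((x ⊞ s) ⊞ s))))
            ≤⟨ E-≤-const (U n) (λ x → E-mono (coin ^ n) (λ b → E-≤-const (coin ^ n) (λ c → progression-≤ x b c))) ⟩
          E (coin ^ n) allFalse
            ≡⟨ E-allFalse n ⟩
          power ½ n ∎
          where
          F : Vec (Fin p) n → Vec (Fin p) n → Vec (Fin p) n → ℚ
          F x b c = a x * a (x ⊞ (b ⊞ c)) * a ((x ⊞ (b ⊞ c)) ⊞ (b ⊞ c))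

        -- A free set has so few progressions that `Λ` or `P` must be at most -ε; in either case
        -- Cauchy-Schwarz leads to the same energy.
        energy-lower : ∀ ε → 0ℚ < ε → nat 4 * ε ≤ density * (density * density) → power ½ n ≤ ε →
                       sq (sq ε) ≤ V (diff _⊖_ bits ^ n) (bits₂ ^ n) deviation deviation
        energy-lower ε 0<ε 4ε≤δ³ ½ⁿ≤ε = go (≤-total Λ (- ε)) (≤-total P (- ε))
          where
          total≤ε : Λ + (P + density * density) * density ≤ ε
          total≤ε = ≤-trans (≤-reflexive (sym apCount-expand)) (≤-trans apCount-≤ ½ⁿ≤ε)

          from-V : V (diff _⊟_ β) (push double β) deviation deviation ≡ V (diff _⊖_ bits ^ n) (bits₂ ^ n) deviation deviation
          from-V = V-cong (diff _⊟_ β) (diff _⊖_ bits ^ n) (push double β) (bits₂ ^ n) {deviation} {deviation} (E-diff-^ bits) E-double-^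

          go : Λ ≤ - ε ⊎ - ε ≤ Λ → P ≤ - ε ⊎ - ε ≤ P →
               sq (sq ε) ≤ V (diff _⊖_ bits ^ n) (bits₂ ^ n) deviation deviation
          go (inj₁ Λ≤-ε) _ = begin
            sq (sq ε)                                              ≤⟨ sq-sq-≤ {ε} {Λ} 0<ε Λ≤-ε ⟩
            sq (sq Λ)                                              ≤⟨ CS.sq-sq-apCount-≤ β β a a deviation (λ x → indicator-sq≤1 (A x)) (λ x → indicator-sq≤1 (A x)) ⟩
            V (diff _⊟_ β) (push double β) deviation deviation     ≡⟨ from-V ⟩
            V (diff _⊖_ bits ^ n) (bits₂ ^ n) deviation deviation  ∎
          go (inj₂ _) (inj₁ P≤-ε) = begin
            sq (sq ε)                                              ≤⟨ sq-sq-≤ {ε} {P} 0<ε P≤-ε ⟩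
            sq (sq P)                                              ≤⟨ CS.sq-sq-pairCount-≤ β β a deviation (λ x → indicator-sq≤1 (A x)) ⟩
            V (diff _⊟_ β) (push double β) deviation deviation     ≡⟨ from-V ⟩
            V (diff _⊖_ bits ^ n) (bits₂ ^ n) deviation deviation  ∎
          go (inj₂ -ε≤Λ) (inj₂ -ε≤P) = ⊥-elim (<-irrefl refl (<-≤-trans 0<ε
            (main-term-dominates ε density Λ P (<⇒≤ 0<ε) 0≤density density≤1 4ε≤δ³ total≤ε -ε≤Λ -ε≤P)))

-- The density increment

module Odd (p : ℕ) .{{_ : ℕ.NonZero p}} (pr : Prime p) (2<p : 2 ℕ.< p) where

  open Arithmetic p
  open Subspace p pr
  open Support p pr
  open Counting p pr

  [_]≢0 : ∀ i .{{_ : ℕ.NonZero i}} → i ℕ.< p → [ i ] ≢ 0ₚ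
  [ i ]≢0 i<p eq = ℕ.≢-nonZero⁻¹ i (begin
    i          ≡⟨ m<n⇒m%n≡m i<p ⟨
    i ℕ.% p    ≡⟨ toℕ-[] i ⟨
    toℕ [ i ]  ≡⟨ cong toℕ eq ⟩
    toℕ [ 0 ]  ≡⟨ toℕ-[] 0 ⟩
    0 ℕ.% p    ≡⟨ m<n⇒m%n≡m (ℕ.>-nonZero⁻¹ p) ⟩
    0          ∎)
    where open ≡-Reasoning

  Charged-coin : ∀ (g : Bool → Fin p) b → Charged (push g coin) (g b)
  Charged-coin g b = 2 , ≤-trans (2E-≥1 b) (≤-reflexive (cong (nat 2 *_) (sym (trans (E-push g coin _) (E-coin _)))))
    where
    q : Bool → ℚ
    q b′ = [ g b′ ≟ g b ]-ind
    l₁ : ∀ a → (1ℚ + (1ℚ + 0ℚ)) * (½ * 1ℚ + (½ * a + 0ℚ)) ≡ 1ℚ + a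
    l₁ = solve-∀ ℚ-ring
    l₂ : ∀ a → (1ℚ + (1ℚ + 0ℚ)) * (½ * a + (½ * 1ℚ + 0ℚ)) ≡ 1ℚ + a
    l₂ = solve-∀ ℚ-ring
    2E-≥1 : ∀ c → 1ℚ ≤ nat 2 * (½ * [ g false ≟ g c ]-ind + (½ * [ g true ≟ g c ]-ind + 0ℚ))
    2E-≥1 false = ≤-by [ g true ≟ g false ]-ind
      (trans (cong (λ t → nat 2 * (½ * t + (½ * [ g true ≟ g false ]-ind + 0ℚ))) (ind-refl (g false))) (l₁ [ g true ≟ g false ]-ind)) (0≤ind (g true) (g false))
    2E-≥1 true  = ≤-by [ g false ≟ g true ]-ind
      (trans (cong (λ t → nat 2 * (½ * [ g false ≟ g true ]-ind + (½ * t + 0ℚ))) (ind-refl (g true))) (l₂ [ g false ≟ g true ]-ind)) (0≤ind (g false) (g true))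

  τ : ℕ
  τ = p ℕ.+ p

  -- The law of `d` starts from `diff _⊖_ bits` because Cauchy-Schwarz delivers c′ - c, that of `e`
  -- from `bits₂` because it delivers 2b.
  μ ν : Prob (Fin p)
  μ = diffs τ (diff _⊖_ bits)
  ν = diffs τ bits₂

  μ-full : ∀ x → Charged μ x
  μ-full = diffs-full {diff _⊖_ bits} {1ₚ} (at false) (at true) ([ 1 ]≢0 (ℕₚ.<-trans ℕₚ.≤-refl 2<p))
    where
    at : ∀ b → Charged (diff _⊖_ bits) (bit b)
    at b = subst (Charged (diff _⊖_ bits)) (x⊖0≡x (bit b)) (Charged-diff {bits} (Charged-coin bit false) (Charged-coin bit b))

  ν-full : ∀ x → Charged ν x
  ν-full = diffs-full {bits₂} {1ₚ ⊕ 1ₚ} (subst (Charged bits₂) (⊕-identityˡ 0ₚ) (Charged-coin bit₂ false)) (Charged-coin bit₂ true)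
    -- The generator is 2, and this is where p > 2 enters.
    (λ eq → [ 2 ]≢0 2<p (trans (sym ([]-+ 1 1)) eq))

  μ-bounded-below : ∃[ h ] (∀ x → AtLeast μ h x)
  μ-bounded-below = uniformly (AtLeast-mono μ) μ-full

  ν-bounded-below : ∃[ h ] (∀ x → AtLeast ν h x)
  ν-bounded-below = uniformly (AtLeast-mono ν) ν-full

  -- One positive denominator that serves both laws.
  h : ℕ
  h = suc (proj₁ μ-bounded-below ℕ.+ proj₁ ν-bounded-below)

  mixμ : Mixture μ (recip h)
  mixμ = mixture {μ = μ} h (λ x → AtLeast-mono μ x {h₁} (ℕₚ.m≤n⇒m≤1+n (ℕₚ.m≤m+n h₁ h₂)) (proj₂ μ-bounded-below x))
    where
    h₁ = proj₁ μ-bounded-below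
    h₂ = proj₁ ν-bounded-below

  mixν : Mixture ν (recip h)
  mixν = mixture {μ = ν} h (λ x → AtLeast-mono ν x {h₂} (ℕₚ.m≤n⇒m≤1+n (ℕₚ.m≤n+m h₂ h₁)) (proj₂ ν-bounded-below x))
    where
    h₁ = proj₁ μ-bounded-below
    h₂ = proj₁ ν-bounded-below

  open Restriction p pr mixμ mixν using (form; mean)
  open ≤-Reasoning

  -- The lower bound for the energy from counting meets the upper bound of `form-≤`, taken with no
  -- uniform coordinate yet, where the mean of `deviation` is zero.
  density-increment : ∀ N n {κ ε} → 0ℚ ≤ κ → 0ℚ < ε → power ½ n ≤ ε →
    (A : Vec (Fin p) n → Bool) (free : RestrictedAPFree p A) →
    nat 4 * ε ≤ density A * (density A * density A) →
    (∀ (A′ : Vec (Fin p) N → Bool) → RestrictedAPFree p A′ → density A′ ≤ density A + κ) →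
    sqs τ (sqs τ (sq (sq ε))) ≤
      nat p * (2ℚ * κ) + (1ℚ + nat p) * (power 2ℚ (N ℕ.* p) * power (1ℚ - ½ * (recip h * recip h)) n)
  density-increment N n {κ} {ε} 0≤κ 0<ε ½ⁿ≤ε A free 4ε≤δ³ dense = begin
    sqs τ (sqs τ (sq (sq ε)))
      ≤⟨ sqs-mono τ (0≤sqs τ (0≤sq (sq ε))) (sqs-mono τ (0≤sq (sq ε)) (energy-lower A free ε 0<ε 4ε≤δ³ ½ⁿ≤ε)) ⟩
    sqs τ (sqs τ (energy f (diff _⊖_ bits) bits₂))
      ≤⟨ sqs-mono τ (0≤sqs τ (0≤energy f (diff _⊖_ bits) bits₂)) (sqs-energy-≤ˡ f bf τ (diff _⊖_ bits) bits₂) ⟩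
    sqs τ (energy f μ bits₂)
      ≤⟨ sqs-energy-≤ʳ f bf τ μ bits₂ ⟩
    energy f μ ν
      ≡⟨ energy-form ⟨
    form 0 n (λ _ → f) (λ _ → f)
      ≤⟨ Inc.form-≤ (N ℕ.* p) 0 n (ℕₚ.+-identityʳ (N ℕ.* p)) (λ _ → A) (λ _ → f) free₂ (Inc.balanced-bounded (λ _ → A)) ⟩
    nat p * (2ℚ * κ - mean 0 n (λ _ → f)) + tail
      ≡⟨ cong (λ t → nat p * t + tail) (trans (cong (λ t → 2ℚ * κ - t) mean≡0) (+-identityʳ (2ℚ * κ))) ⟩
    nat p * (2ℚ * κ) + tail ∎
    where
    δ = density A
    f = deviation A
    tail = (1ℚ + nat p) * (power 2ℚ (N ℕ.* p) * power (1ℚ - ½ * (recip h * recip h)) n)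

    module Inc = Increment p pr mixμ mixν N (0≤density A) (density≤1 A) 0≤κ dense

    bf : CS.Bounded f
    bf x = sq-within (indicator-within (A x) (0≤density A) (density≤1 A))

    free₂ : APFree₂ {0} {n} (λ _ → A)
    free₂ [] y [] b b≢0 A₀ A₁ A₂ = free y b (b≢0 refl) (A₀ , A₁ , A₂)

    mean≡0 : mean 0 n (λ _ → f) ≡ 0ℚ
    mean≡0 = trans (E-const (U 0) _) (trans (E-sub (U n) (a A) (λ _ → δ))
      (trans (cong (λ t → δ - t) (E-const (U n) δ)) (+-inverseʳ δ)))

    energy-form : form 0 n (λ _ → f) (λ _ → f) ≡ energy f μ ν
    energy-form = trans (E-const (U 0) _) (E-cong (μ ^ n) (λ d → E-cong (U n) (λ z → cong sq
      (E-cong (ν ^ n) (λ e → E-const (U 0) (f (z ⊞ e) * f ((z ⊞ e) ⊞ d)))))))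

-- Quantitative bookkeeping

module _ {z : ℚ} (0≤z : 0ℚ ≤ z) (z≤1 : z ≤ 1ℚ) where

  private
    y = 1ℚ - z

    0≤y : 0ℚ ≤ y
    0≤y = 0≤-sub z≤1

  -- From (1 - z)(1 + (n + 1)z) ≤ 1 + nz.
  bernoulli : ∀ n → power y n * (1ℚ + nat n * z) ≤ 1ℚ
  bernoulli zero    = ≤-reflexive (l z)
    where
    l : ∀ z → 1ℚ * (1ℚ + 0ℚ * z) ≡ 1ℚ
    l = solve-∀ ℚ-ring
  bernoulli (suc n) = ≤-trans (≤-by (power y n * (z * z * (1ℚ + nat n))) (l (power y n) (nat n) z)
    (0≤-* (0≤power n 0≤y) (0≤-* (0≤-* 0≤z 0≤z) (0≤nat (suc n))))) (bernoulli n)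
    where
    l : ∀ t n z → t * (1ℚ + n * z) ≡ (1ℚ - z) * t * (1ℚ + (1ℚ + n) * z) + t * (z * z * (1ℚ + n))
    l = solve-∀ ℚ-ring

  power-+ : ∀ a b → power y (a ℕ.+ b) ≡ power y a * power y b
  power-+ zero    b = sym (*-identityˡ (power y b))
  power-+ (suc a) b = trans (cong (y *_) (power-+ a b)) (sym (*-assoc y (power y a) (power y b)))

  power-≤1 : ∀ n → power y n ≤ 1ℚ
  power-≤1 zero    = ≤-refl
  power-≤1 (suc n) = *-mono-≤ {y} {1ℚ} {power y n} {1ℚ} 0≤y 0≤1 (≤-by z (sym (l z)) 0≤z) (power-≤1 n)
    where
    l : ∀ z → 1ℚ - z + z ≡ 1ℚ
    l = solve-∀ ℚ-ring

  power-antimono : ∀ {a b} → a ℕ.≤ b → power y b ≤ power y a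
  power-antimono {a} {b} a≤b = begin
    power y b                          ≡⟨ cong (power y) (ℕₚ.m+[n∸m]≡n a≤b) ⟨
    power y (a ℕ.+ (b ℕ.∸ a))          ≡⟨ power-+ a (b ℕ.∸ a) ⟩
    power y a * power y (b ℕ.∸ a)      ≤⟨ *-monoˡ (0≤power a 0≤y) (power-≤1 (b ℕ.∸ a)) ⟩
    power y a * 1ℚ                     ≡⟨ *-identityʳ (power y a) ⟩
    power y a                          ∎
    where open ≤-Reasoning

  -- For q z = 1 Bernoulli's inequality reads 2 (1 - z)^q ≤ 1.
  power-halves : ∀ q → nat q * z ≡ 1ℚ → ∀ r → power y (r ℕ.* q) ≤ power ½ r
  power-halves q qz≡1 zero    = ≤-refl
  power-halves q qz≡1 (suc r) = begin
    power y (q ℕ.+ r ℕ.* q)              ≡⟨ power-+ q (r ℕ.* q) ⟩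
    power y q * power y (r ℕ.* q)        ≤⟨ *-mono-≤ (0≤power q 0≤y) (0≤power r 0≤½) half (power-halves q qz≡1 r) ⟩
    ½ * power ½ r                        ∎
    where
    open ≤-Reasoning
    l : ∀ a → a * (1ℚ + 1ℚ) ≡ 2ℚ * a
    l = solve-∀ ℚ-ring
    half : power y q ≤ ½
    half = 2*-cancel-≤ (subst (_≤ 1ℚ) (trans (cong (λ t → power y q * (1ℚ + t)) qz≡1) (l (power y q))) (bernoulli q))

power-2-½ : ∀ a b → power 2ℚ a * power ½ (a ℕ.+ b) ≡ power ½ b
power-2-½ zero    b = *-identityˡ (power ½ b)
power-2-½ (suc a) b = trans (l (power 2ℚ a) (power ½ (a ℕ.+ b))) (power-2-½ a b)
  where
  l : ∀ s t → 2ℚ * s * (½ * t) ≡ s * t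
  l = solve-∀ ℚ-ring

nat≤power-2 : ∀ n → nat n ≤ power 2ℚ n
nat≤power-2 zero    = 0≤1
nat≤power-2 (suc n) = ≤-trans (+-mono-≤ (1≤power-2 n) (nat≤power-2 n)) (≤-reflexive (l (power 2ℚ n)))
  where
  l : ∀ a → a + a ≡ 2ℚ * a
  l = solve-∀ ℚ-ring

nat*power-½≤1 : ∀ n → nat n * power ½ n ≤ 1ℚ
nat*power-½≤1 n = ≤-trans (*-monoʳ-≤-nonNeg (power ½ n) {{nonNegative (0≤power n 0≤½)}} (nat≤power-2 n))
  (≤-reflexive (trans (cong (λ t → power 2ℚ n * power ½ t) (sym (ℕₚ.+-identityʳ n))) (power-2-½ n 0)))

-- Tracks the denominator of an iterated square `sqs`.
sqn : ℕ → ℕ → ℕ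
sqn zero    a = a
sqn (suc t) a = sqn t a ℕ.* sqn t a

sqn-power : ∀ t a → sqn t a ≡ a ℕ.^ (2 ℕ.^ t)
sqn-power zero    a = sym (ℕₚ.^-identityʳ a)
sqn-power (suc t) a = begin
  sqn t a ℕ.* sqn t a                        ≡⟨ cong₂ ℕ._*_ (sqn-power t a) (sqn-power t a) ⟩
  a ℕ.^ (2 ℕ.^ t) ℕ.* a ℕ.^ (2 ℕ.^ t)        ≡⟨ ℕₚ.^-distribˡ-+-* a (2 ℕ.^ t) (2 ℕ.^ t) ⟨
  a ℕ.^ (2 ℕ.^ t ℕ.+ 2 ℕ.^ t)                ≡⟨ cong (λ s → a ℕ.^ (2 ℕ.^ t ℕ.+ s)) (ℕₚ.+-identityʳ (2 ℕ.^ t)) ⟨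
  a ℕ.^ (2 ℕ.^ suc t)                        ∎
  where open ≡-Reasoning

sqn-sqs : ∀ t a x → nat a * x ≡ 1ℚ → nat (sqn t a) * sqs t x ≡ 1ℚ
sqn-sqs zero    a x ax≡1 = ax≡1
sqn-sqs (suc t) a x ax≡1 = begin
  nat (sqn t a ℕ.* sqn t a) * (sqs t x * sqs t x)   ≡⟨ cong (_* (sqs t x * sqs t x)) (nat-* (sqn t a) (sqn t a)) ⟩
  nat (sqn t a) * nat (sqn t a) * (sqs t x * sqs t x) ≡⟨ l (nat (sqn t a)) (sqs t x) ⟩
  nat (sqn t a) * sqs t x * (nat (sqn t a) * sqs t x) ≡⟨ cong₂ _*_ (sqn-sqs t a x ax≡1) (sqn-sqs t a x ax≡1) ⟩
  1ℚ * 1ℚ                                           ≡⟨⟩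
  1ℚ                                                ∎
  where
  open ≡-Reasoning
  l : ∀ a b → a * a * (b * b) ≡ a * b * (a * b)
  l = solve-∀ ℚ-ring

n≤2^n : ∀ n → n ℕ.≤ 2 ℕ.^ n
n≤2^n zero    = ℕ.z≤n
n≤2^n (suc n) = begin
  1 ℕ.+ n                     ≤⟨ ℕₚ.+-mono-≤ (ℕₚ.m^n>0 2 n) (n≤2^n n) ⟩
  2 ℕ.^ n ℕ.+ 2 ℕ.^ n         ≡⟨ cong (2 ℕ.^ n ℕ.+_) (ℕₚ.+-identityʳ (2 ℕ.^ n)) ⟨
  2 ℕ.^ suc n                 ∎
  where open ℕₚ.≤-Reasoning

-- Cardinality as a mean

module Cardinality (p : ℕ) .{{_ : ℕ.NonZero p}} where

  open Arithmetic p using (U)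

  nat-sum-concatMap : ∀ {X : Set} {k} (φ : X → ℕ) {n} (f : Fin n → Fin k) (g : Fin k → List X) →
    nat (ListAction.sum (List.map φ (List.concatMap g (List.tabulate f)))) ≡
    sum (λ i → nat (ListAction.sum (List.map φ (g (f i)))))
  nat-sum-concatMap φ {zero}  f g = refl
  nat-sum-concatMap φ {suc n} f g = begin
    nat (ListAction.sum (List.map φ (g₀ List.++ gs)))
      ≡⟨ cong (nat ∘ ListAction.sum) (Listₚ.map-++ φ g₀ gs) ⟩
    nat (ListAction.sum (List.map φ g₀ List.++ List.map φ gs))
      ≡⟨ cong nat (ListActionₚ.sum-++ (List.map φ g₀) (List.map φ gs)) ⟩
    nat (ListAction.sum (List.map φ g₀) ℕ.+ ListAction.sum (List.map φ gs))
      ≡⟨ nat-+ (ListAction.sum (List.map φ g₀)) (ListAction.sum (List.map φ gs)) ⟩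
    nat (ListAction.sum (List.map φ g₀)) + nat (ListAction.sum (List.map φ gs))
      ≡⟨ +-congˡ (nat (ListAction.sum (List.map φ g₀))) (nat-sum-concatMap φ (f ∘ Fin.suc) g) ⟩
    sum (λ i → nat (ListAction.sum (List.map φ (g (f i))))) ∎
    where
    open ≡-Reasoning
    g₀ = g (f Fin.zero)
    gs = List.concatMap g (List.tabulate (f ∘ Fin.suc))

  nat-sum-allVecs : ∀ n (φ : Vec (Fin p) n → ℕ) →
    nat (ListAction.sum (List.map φ (allVecs p n))) ≡ nat (p ℕ.^ n) * E (U n) (nat ∘ φ)
  nat-sum-allVecs zero φ = begin
    nat (φ [] ℕ.+ 0)            ≡⟨ cong nat (ℕₚ.+-identityʳ (φ [])) ⟩
    nat (φ [])                  ≡⟨ E-[] (unif p) (nat ∘ φ) ⟨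
    E (U 0) (nat ∘ φ)           ≡⟨ *-identityˡ (E (U 0) (nat ∘ φ)) ⟨
    1ℚ * E (U 0) (nat ∘ φ)      ∎
    where open ≡-Reasoning
  nat-sum-allVecs (suc n) φ = begin
    nat (ListAction.sum (List.map φ (List.concatMap (λ i → List.map (i ∷_) (allVecs p n)) (List.allFin p))))
      ≡⟨ nat-sum-concatMap φ id (λ i → List.map (i ∷_) (allVecs p n)) ⟩
    sum (λ i → nat (ListAction.sum (List.map φ (List.map (i ∷_) (allVecs p n)))))
      ≡⟨ sum-cong (λ i → trans (cong (nat ∘ ListAction.sum) (sym (Listₚ.map-∘ (allVecs p n)))) (nat-sum-allVecs n (λ v → φ (i ∷ v)))) ⟩
    sum (λ i → nat (p ℕ.^ n) * F i)
      ≡⟨ sum-* (nat (p ℕ.^ n)) F ⟩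
    nat (p ℕ.^ n) * sum F
      ≡⟨ cong (nat (p ℕ.^ n) *_) (p*E-unif p F) ⟨
    nat (p ℕ.^ n) * (nat p * E (unif p) F)
      ≡⟨ l (nat (p ℕ.^ n)) (nat p) (E (unif p) F) ⟩
    nat p * nat (p ℕ.^ n) * E (unif p) F
      ≡⟨ cong₂ _*_ (sym (nat-* p (p ℕ.^ n))) (sym (E-∷ (unif p) n (nat ∘ φ))) ⟩
    nat (p ℕ.^ suc n) * E (U (suc n)) (nat ∘ φ) ∎
    where
    open ≡-Reasoning
    F : Fin p → ℚ
    F i = E (U n) (λ v → nat (φ (i ∷ v)))
    l : ∀ a b c → a * (b * c) ≡ b * a * c
    l = solve-∀ ℚ-ring

  nat-card : ∀ {n} (A : Vec (Fin p) n → Bool) → nat (card A) ≡ nat (p ℕ.^ n) * E (U n) (λ x → indicator (A x))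
  nat-card {n} A = trans (nat-sum-allVecs n (λ v → if A v then 1 else 0))
    (cong (nat (p ℕ.^ n) *_) (E-cong (U n) (λ v → nat-if (A v))))
    where
    nat-if : ∀ b → nat (if b then 1 else 0) ≡ indicator b
    nat-if true  = refl
    nat-if false = refl

  dense⇒1≤m*density : ∀ {n} (A : Vec (Fin p) n → Bool) m → p ℕ.^ n ℕ.≤ m ℕ.* card A →
                      1ℚ ≤ nat m * E (U n) (λ x → indicator (A x))
  dense⇒1≤m*density {n} A m pⁿ≤m|A| with p ℕ.^ n | nat-card A | ℕₚ.m^n>0 p n
  ... | suc q | eq | _ = *-cancelˡ-≤-pos (nat (suc q)) {{positive (nat-pos q)}} (begin
    nat (suc q) * 1ℚ                                      ≡⟨ *-identityʳ (nat (suc q)) ⟩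
    nat (suc q)                                           ≤⟨ nat-mono pⁿ≤m|A| ⟩
    nat (m ℕ.* card A)                                    ≡⟨ nat-* m (card A) ⟩
    nat m * nat (card A)                                  ≡⟨ cong (nat m *_) eq ⟩
    nat m * (nat (suc q) * E (U n) (λ x → indicator (A x))) ≡⟨ l (nat m) (nat (suc q)) _ ⟩
    nat (suc q) * (nat m * E (U n) (λ x → indicator (A x))) ∎)
    where
    open ≤-Reasoning
    l : ∀ a b c → a * (b * c) ≡ b * (a * c)
    l = solve-∀ ℚ-ring

-- Iterating the increment

module Iteration (p : ℕ) .{{_ : ℕ.NonZero p}} (pr : Prime p) (2<p : 2 ℕ.< p) (m : ℕ) .{{_ : ℕ.NonZero m}} where

  open Arithmetic p
  open Counting p pr using (density; 0≤density; density≤1)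
  open Odd p pr 2<p
  open ≤-Reasoning

  -- `M₀` is 1/ε, its value dictated by 4ε ≤ δ³ for δ ≥ 1/m. `M` is the reciprocal of the energy
  -- bound after two Cauchy-Schwarz steps and 2τ differences. `S` = 1/κ and `R` make the main term
  -- and the tail in `density-increment` at most 1/(4M) each. After `q` coordinates the power of
  -- `shrink` has halved, and `Z` is the factor by which one increment divides the dimension.
  M₀ M R q S Z : ℕ
  M₀ = 4 ℕ.* m ℕ.^ 3
  M  = sqn τ (sqn τ (sqn 2 M₀))
  R  = 4 ℕ.* M ℕ.* (1 ℕ.+ p)
  q  = 2 ℕ.* (h ℕ.* h)
  S  = 8 ℕ.* (p ℕ.* M)
  Z  = (p ℕ.+ R) ℕ.* q

  sqn-≥ : ∀ t a → 1 ℕ.≤ a → a ℕ.≤ sqn t a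
  sqn-≥ zero    a 1≤a = ℕₚ.≤-refl
  sqn-≥ (suc t) a 1≤a = ℕₚ.≤-trans (sqn-≥ t a 1≤a) (ℕₚ.m≤m*n (sqn t a) (sqn t a) {{ℕ.>-nonZero (ℕₚ.≤-trans 1≤a (sqn-≥ t a 1≤a))}})

  1≤M₀ : 1 ℕ.≤ M₀
  1≤M₀ = ℕₚ.≤-trans (ℕₚ.m^n>0 m 3) (ℕₚ.m≤n*m (m ℕ.^ 3) 4)

  M₀≤M : M₀ ℕ.≤ M
  M₀≤M = ℕₚ.≤-trans (sqn-≥ 2 M₀ 1≤M₀) (ℕₚ.≤-trans (sqn-≥ τ (sqn 2 M₀) 1≤M₁)
    (sqn-≥ τ (sqn τ (sqn 2 M₀)) (ℕₚ.≤-trans 1≤M₁ (sqn-≥ τ (sqn 2 M₀) 1≤M₁))))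
    where
    1≤M₁ : 1 ℕ.≤ sqn 2 M₀
    1≤M₁ = ℕₚ.≤-trans 1≤M₀ (sqn-≥ 2 M₀ 1≤M₀)

  1≤M : 1 ℕ.≤ M
  1≤M = ℕₚ.≤-trans 1≤M₀ M₀≤M

  M≤R : M ℕ.≤ R
  M≤R = ℕₚ.≤-trans (ℕₚ.m≤n*m M 4) (ℕₚ.m≤m*n (4 ℕ.* M) (1 ℕ.+ p))

  1≤q : 1 ℕ.≤ q
  1≤q = ℕₚ.≤-trans (ℕₚ.*-mono-≤ {1} {h} {1} {h} (ℕ.s≤s ℕ.z≤n) (ℕ.s≤s ℕ.z≤n)) (ℕₚ.m≤n*m (h ℕ.* h) 2)

  instance
    M₀-nonZero : ℕ.NonZero M₀
    M₀-nonZero = ℕ.>-nonZero 1≤M₀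

    S-nonZero : ℕ.NonZero S
    S-nonZero = ℕ.>-nonZero (ℕₚ.*-mono-≤ {1} {8} {1} {p ℕ.* M} (ℕ.s≤s ℕ.z≤n) (ℕₚ.*-mono-≤ {1} {p} {1} {M} (ℕ.>-nonZero⁻¹ p) 1≤M))

  ε κ z : ℚ
  ε = recip M₀
  κ = recip S
  z = ½ * (recip h * recip h)

  M₀ε≡1 : nat M₀ * ε ≡ 1ℚ
  M₀ε≡1 = nat*recip M₀

  0<ε : 0ℚ < ε
  0<ε = ≰⇒> (λ ε≤0 → <-irrefl refl (<-≤-trans (positive⁻¹ 1ℚ) (begin
    1ℚ            ≡⟨ M₀ε≡1 ⟨
    nat M₀ * ε    ≤⟨ *-monoˡ (0≤nat M₀) ε≤0 ⟩
    nat M₀ * 0ℚ   ≡⟨ *-zeroʳ (nat M₀) ⟩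
    0ℚ            ∎)))

  qz≡1 : nat q * z ≡ 1ℚ
  qz≡1 = begin-equality
    nat q * z                                        ≡⟨ cong (_* z) (trans (nat-* 2 (h ℕ.* h)) (cong (nat 2 *_) (nat-* h h))) ⟩
    nat 2 * (nat h * nat h) * (½ * (recip h * recip h)) ≡⟨ l (nat h) (recip h) ⟩
    nat h * recip h * (nat h * recip h)              ≡⟨ cong₂ _*_ (nat*recip h) (nat*recip h) ⟩
    1ℚ                                               ∎
    where
    l : ∀ a r → (1ℚ + (1ℚ + 0ℚ)) * (a * a) * (½ * (r * r)) ≡ a * r * (a * r)
    l = solve-∀ ℚ-ring

  0≤z : 0ℚ ≤ z
  0≤z = 0≤-* 0≤½ (0≤-* (0≤recip h) (0≤recip h))

  z≤1 : z ≤ 1ℚ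
  z≤1 = begin
    z            ≡⟨ *-identityˡ z ⟨
    1ℚ * z       ≤⟨ *-monoʳ-≤-nonNeg z {{nonNegative 0≤z}} (nat-mono 1≤q) ⟩
    nat q * z    ≡⟨ qz≡1 ⟩
    1ℚ           ∎

  4ε≤δ³ : ∀ {δ} → 1ℚ ≤ nat m * δ → 0ℚ ≤ δ → nat 4 * ε ≤ δ * (δ * δ)
  4ε≤δ³ {δ} 1≤mδ 0≤δ = begin
    nat 4 * ε                                  ≡⟨ *-identityʳ (nat 4 * ε) ⟨
    nat 4 * ε * 1ℚ                             ≤⟨ *-monoˡ (0≤-* (0≤nat 4) (<⇒≤ 0<ε)) cube ⟩
    nat 4 * ε * (t * (t * t))                  ≡⟨ l (nat 4) (nat m) ε δ ⟩
    nat 4 * (nat m * (nat m * (nat m * 1ℚ))) * ε * (δ * (δ * δ)) ≡⟨ cong (λ s → s * ε * (δ * (δ * δ))) nat-M₀ ⟨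
    nat M₀ * ε * (δ * (δ * δ))                 ≡⟨ cong (_* (δ * (δ * δ))) M₀ε≡1 ⟩
    1ℚ * (δ * (δ * δ))                         ≡⟨ *-identityˡ (δ * (δ * δ)) ⟩
    δ * (δ * δ)                                ∎
    where
    t = nat m * δ
    0≤t : 0ℚ ≤ t
    0≤t = ≤-trans 0≤1 1≤mδ
    cube : 1ℚ ≤ t * (t * t)
    cube = *-mono-≤ {1ℚ} {t} {1ℚ} {t * t} 0≤1 (0≤-* 0≤t 0≤t) 1≤mδ (*-mono-≤ {1ℚ} {t} {1ℚ} {t} 0≤1 0≤t 1≤mδ 1≤mδ)
    nat-M₀ : nat M₀ ≡ nat 4 * (nat m * (nat m * (nat m * 1ℚ)))
    nat-M₀ = trans (nat-* 4 (m ℕ.^ 3)) (cong (nat 4 *_) (trans (nat-* m (m ℕ.^ 2)) (cong (nat m *_)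
      (trans (nat-* m (m ℕ.^ 1)) (cong (nat m *_) (nat-* m 1))))))
    l : ∀ f m e d → f * e * (m * d * (m * d * (m * d))) ≡ f * (m * (m * (m * 1ℚ))) * e * (d * (d * d))
    l = solve-∀ ℚ-ring

  ½ⁿ≤ε : ∀ {n} → M₀ ℕ.≤ n → power ½ n ≤ ε
  ½ⁿ≤ε {n} M₀≤n = begin
    power ½ n                    ≡⟨ *-identityʳ (power ½ n) ⟨
    power ½ n * 1ℚ               ≡⟨ cong (power ½ n *_) M₀ε≡1 ⟨
    power ½ n * (nat M₀ * ε)     ≡⟨ l (power ½ n) (nat M₀) ε ⟩
    nat M₀ * power ½ n * ε       ≤⟨ *-monoʳ-≤-nonNeg ε {{nonNegative (<⇒≤ 0<ε)}} (≤-trans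
                                      (*-monoʳ-≤-nonNeg (power ½ n) {{nonNegative (0≤power n 0≤½)}} (nat-mono M₀≤n)) (nat*power-½≤1 n)) ⟩
    1ℚ * ε                       ≡⟨ *-identityˡ ε ⟩
    ε                            ∎
    where
    l : ∀ a b c → a * (b * c) ≡ b * a * c
    l = solve-∀ ℚ-ring

  -- An energy of at least 1/M cannot be at most 1/(4M) + 1/(4M). Multiplied by 4M,
  -- `density-increment` would read 4 ≤ 2.
  no-increment : ∀ N n → (N ℕ.* p ℕ.+ R) ℕ.* q ℕ.≤ n → (A : Vec (Fin p) n → Bool) → RestrictedAPFree p A →
    1ℚ ≤ nat m * density A →
    ¬ (∀ (A′ : Vec (Fin p) N → Bool) → RestrictedAPFree p A′ → density A′ ≤ density A + κ)
  no-increment N n large A free 1≤mδ dense = <-irrefl refl (<-≤-trans 2<4 4≤2)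
    where
    y = 1ℚ - z
    D = sqs τ (sqs τ (sq (sq ε)))
    T = power 2ℚ (N ℕ.* p) * power y n

    R≤n : R ℕ.≤ n
    R≤n = ℕₚ.≤-trans (ℕₚ.m≤n+m R (N ℕ.* p)) (ℕₚ.≤-trans (ℕₚ.m≤m*n _ q {{ℕ.>-nonZero 1≤q}}) large)

    MD≡1 : nat M * D ≡ 1ℚ
    MD≡1 = sqn-sqs τ (sqn τ (sqn 2 M₀)) _ (sqn-sqs τ (sqn 2 M₀) _ (sqn-sqs 2 M₀ ε M₀ε≡1))

    D≤ : D ≤ nat p * (2ℚ * κ) + (1ℚ + nat p) * T
    D≤ = density-increment N n (0≤recip S) 0<ε (½ⁿ≤ε (ℕₚ.≤-trans M₀≤M (ℕₚ.≤-trans M≤R R≤n))) A free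
      (4ε≤δ³ 1≤mδ (0≤density A)) dense

    -- The `n` factors contain Np + R groups of `q`, each worth 1/2; Np of these halvings cancel
    -- 2^(Np).
    T≤ : T ≤ power ½ R
    T≤ = begin
      power 2ℚ (N ℕ.* p) * power y n                                  ≤⟨ *-monoˡ (0≤power (N ℕ.* p) 0≤2) (≤-trans
                                                                          (power-antimono 0≤z z≤1 large)
                                                                          (power-halves 0≤z z≤1 q qz≡1 (N ℕ.* p ℕ.+ R))) ⟩
      power 2ℚ (N ℕ.* p) * power ½ (N ℕ.* p ℕ.+ R)                    ≡⟨ power-2-½ (N ℕ.* p) R ⟩
      power ½ R                                                       ∎

    nat-R : nat 4 * nat M * (1ℚ + nat p) ≡ nat R
    nat-R = sym (trans (nat-* (4 ℕ.* M) (1 ℕ.+ p)) (cong (_* (1ℚ + nat p)) (nat-* 4 M)))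

    nat-S : nat 8 * (nat p * nat M) ≡ nat S
    nat-S = sym (trans (nat-* 8 (p ℕ.* M)) (cong (nat 8 *_) (nat-* p M)))

    4ℚ : ℚ
    4ℚ = 2ℚ + 2ℚ

    2<4 : 2ℚ < 4ℚ
    2<4 = *<* (ℤ.+<+ (ℕ.s≤s (ℕ.s≤s (ℕ.s≤s ℕ.z≤n))))
      where import Data.Integer as ℤ

    4≤2 : 4ℚ ≤ 2ℚ
    4≤2 = begin
      4ℚ * 1ℚ                                          ≡⟨ cong (4ℚ *_) MD≡1 ⟨
      4ℚ * (nat M * D)                                 ≤⟨ *-monoˡ {4ℚ} (nonNegative⁻¹ 4ℚ) (*-monoˡ (0≤nat M) D≤) ⟩
      4ℚ * (nat M * (nat p * (2ℚ * κ) + (1ℚ + nat p) * T)) ≡⟨ l (nat M) (nat p) κ T ⟩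
      nat 8 * (nat p * nat M) * κ + nat 4 * nat M * (1ℚ + nat p) * T ≡⟨ cong₂ (λ s t → s * κ + t * T) nat-S nat-R ⟩
      nat S * κ + nat R * T                            ≤⟨ +-mono-≤ (≤-reflexive (nat*recip S)) (≤-trans (*-monoˡ (0≤nat R) T≤) (nat*power-½≤1 R)) ⟩
      2ℚ                                               ∎
      where
      l : ∀ M p k T → (2ℚ + 2ℚ) * (M * (p * (2ℚ * k) + (1ℚ + p) * T)) ≡
        (1ℚ + (1ℚ + (1ℚ + (1ℚ + (1ℚ + (1ℚ + (1ℚ + (1ℚ + 0ℚ)))))))) * (p * M) * k + (1ℚ + (1ℚ + (1ℚ + (1ℚ + 0ℚ)))) * M * (1ℚ + p) * T
      l = solve-∀ ℚ-ring

  1≤Z^ : ∀ s → 1 ℕ.≤ Z ℕ.^ s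
  1≤Z^ s = ℕₚ.m^n>0 Z {{ℕ.>-nonZero (ℕₚ.*-mono-≤ (ℕₚ.≤-trans (ℕₚ.≤-trans 1≤M M≤R) (ℕₚ.m≤n+m R p)) 1≤q)}} s

  -- As Z^s is at least 1, Z^s p + R is at most Z^s (p + R).
  threshold : ∀ s → (Z ℕ.^ s ℕ.* p ℕ.+ R) ℕ.* q ℕ.≤ Z ℕ.^ suc s
  threshold s = ℕₚ.≤-trans
    (ℕₚ.*-monoˡ-≤ q (ℕₚ.+-monoʳ-≤ (N ℕ.* p) (ℕₚ.m≤n*m R N {{ℕ.>-nonZero (1≤Z^ s)}})))
    (ℕₚ.≤-reflexive (trans (cong (ℕ._* q) (sym (ℕₚ.*-distribˡ-+ N p R))) (trans (ℕₚ.*-assoc N (p ℕ.+ R) q) (ℕₚ.*-comm N Z))))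
    where
    N = Z ℕ.^ s

  -- Dimension Z^s leaves room for s increments. Were δ + (s + 1)κ at least 1, the induction
  -- hypothesis would cap the densities in dimension Z^s by 1 - sκ ≤ δ + κ, contradicting
  -- `no-increment`.
  descent : ∀ s n → Z ℕ.^ s ℕ.≤ n → (A : Vec (Fin p) n → Bool) → RestrictedAPFree p A →
            1ℚ ≤ nat m * density A → density A + nat s * κ ≤ 1ℚ
  descent zero    n large A free 1≤mδ = ≤-trans (≤-reflexive (l (density A) κ)) (density≤1 A)
    where
    l : ∀ d k → d + 0ℚ * k ≡ d
    l = solve-∀ ℚ-ring
  descent (suc s) n large A free 1≤mδ = go (≤-total (density A + nat (suc s) * κ) 1ℚ)
    where
    δ = density A
    l : ∀ d s k → d + (1ℚ + s) * k - s * k ≡ d + k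
    l = solve-∀ ℚ-ring
    l′ : ∀ d t → d + t - t ≡ d
    l′ = solve-∀ ℚ-ring
    go : δ + nat (suc s) * κ ≤ 1ℚ ⊎ 1ℚ ≤ δ + nat (suc s) * κ → δ + nat (suc s) * κ ≤ 1ℚ
    go (inj₁ ≤1) = ≤1
    go (inj₂ 1≤) = ⊥-elim (no-increment (Z ℕ.^ s) n (ℕₚ.≤-trans (threshold s) large) A free 1≤mδ dense)
      where
      dense : ∀ (A′ : Vec (Fin p) (Z ℕ.^ s) → Bool) → RestrictedAPFree p A′ → density A′ ≤ δ + κ
      dense A′ free′ = compare (≤-total 1ℚ (nat m * density A′))
        where
        compare : 1ℚ ≤ nat m * density A′ ⊎ nat m * density A′ ≤ 1ℚ → density A′ ≤ δ + κ
        compare (inj₁ 1≤mδ′) = begin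
          density A′                                  ≡⟨ l′ (density A′) (nat s * κ) ⟨
          density A′ + nat s * κ - nat s * κ          ≤⟨ +-monoˡ-≤ (- (nat s * κ)) (≤-trans (descent s (Z ℕ.^ s) ℕₚ.≤-refl A′ free′ 1≤mδ′) 1≤) ⟩
          δ + nat (suc s) * κ - nat s * κ             ≡⟨ l δ (nat s) κ ⟩
          δ + κ                                       ∎
        -- The induction hypothesis does not cover a sparse `A′`, but then its density is at most
        -- 1/m ≤ δ.
        compare (inj₂ mδ′≤1) = ≤-trans (cancel-m (≤-trans mδ′≤1 1≤mδ)) (≤-by κ refl (0≤recip S))
          where
          cancel-m : nat m * density A′ ≤ nat m * δ → density A′ ≤ δ
          cancel-m = *-cancelˡ-≤-pos (nat m) {{positive (nat>0 m)}}
            where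
            nat>0 : ∀ k .{{_ : ℕ.NonZero k}} → 0ℚ < nat k
            nat>0 (suc k) = nat-pos k

  -- After `S` increments of κ = 1/S the density could only be 0, against δ ≥ 1/m.
  dimension-< : ∀ n (A : Vec (Fin p) n → Bool) → RestrictedAPFree p A → 1ℚ ≤ nat m * density A → n ℕ.< Z ℕ.^ S
  dimension-< n A free 1≤mδ = ℕₚ.≰⇒> (λ large → <-irrefl refl (<-≤-trans (positive⁻¹ 1ℚ) (begin
    1ℚ                             ≤⟨ 1≤mδ ⟩
    nat m * δ                      ≤⟨ *-monoˡ (0≤nat m) (δ≤0 large) ⟩
    nat m * 0ℚ                     ≡⟨ *-zeroʳ (nat m) ⟩
    0ℚ                             ∎)))
    where
    δ = density A
    l : ∀ d → d + 1ℚ - 1ℚ ≡ d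
    l = solve-∀ ℚ-ring
    δ≤0 : Z ℕ.^ S ℕ.≤ n → δ ≤ 0ℚ
    δ≤0 large = begin
      δ                      ≡⟨ l δ ⟨
      δ + 1ℚ - 1ℚ            ≡⟨ cong (λ t → δ + t - 1ℚ) (nat*recip S) ⟨
      δ + nat S * κ - 1ℚ     ≤⟨ +-monoˡ-≤ (- 1ℚ) (descent S n large A free 1≤mδ) ⟩
      1ℚ - 1ℚ                ≡⟨⟩
      0ℚ                     ∎

-- The prime 2 and the explicit bound

^-distribʳ-* : ∀ a b n → (a ℕ.* b) ℕ.^ n ≡ a ℕ.^ n ℕ.* b ℕ.^ n
^-distribʳ-* a b zero    = refl
^-distribʳ-* a b (suc n) = trans (cong (a ℕ.* b ℕ.*_) (^-distribʳ-* a b n)) (l a b (a ℕ.^ n) (b ℕ.^ n))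
  where
  l : ∀ a b s t → a ℕ.* b ℕ.* (s ℕ.* t) ≡ a ℕ.* s ℕ.* (b ℕ.* t)
  l = solveℕ-∀

-- Modulo 2 the difference (2, 0, …, 0) acts trivially, so only the empty set is restricted 3-AP free.
no-free-set-mod-2 : Prime 2 → ∀ n (A : Vec (Fin 2) (suc n) → Bool) → RestrictedAPFree 2 A → ∀ x → A x ≡ false
no-free-set-mod-2 pr n A free (x ∷ xs) = go (A (x ∷ xs)) refl
  where
  open Arithmetic 2
  open Subspace 2 pr
  a : Vec (Fin 3) (suc n)
  a = Fin.suc (Fin.suc Fin.zero) ∷ replicate n Fin.zero
  fixed : shift 2 (x ∷ xs) a ≡ x ∷ xs
  fixed = cong₂ _∷_ (⊕-identityʳ x) (shift-0 xs)
  go : ∀ b → A (x ∷ xs) ≡ b → b ≡ false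
  go false _  = refl
  go true  eq = ⊥-elim (free (x ∷ xs) a (λ ())
    (eq , trans (cong A fixed) eq , trans (cong A (trans (cong (λ y → shift 2 y a) fixed) fixed)) eq))

dimension-mod-2 : Prime 2 → ∀ n (A : Vec (Fin 2) n → Bool) → RestrictedAPFree 2 A →
                  ∀ m → 2 ℕ.^ n ℕ.≤ m ℕ.* card A → n ≡ 0
dimension-mod-2 pr zero    A free m _   = refl
dimension-mod-2 pr (suc n) A free m big = ⊥-elim (<-irrefl refl (<-≤-trans (positive⁻¹ 1ℚ) (begin
  1ℚ                                                            ≤⟨ Cardinality.dense⇒1≤m*density 2 A m big ⟩
  nat m * E (Arithmetic.U 2 (suc n)) (λ x → indicator (A x))    ≡⟨ cong (nat m *_) empty ⟩
  nat m * 0ℚ                                                    ≡⟨ *-zeroʳ (nat m) ⟩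
  0ℚ                                                            ∎)))
  where
  open ≤-Reasoning
  empty : E (Arithmetic.U 2 (suc n)) (λ x → indicator (A x)) ≡ 0ℚ
  empty = trans (E-cong (Arithmetic.U 2 (suc n)) (λ x → cong indicator (no-free-set-mod-2 pr n A free x)))
                (E-const (Arithmetic.U 2 (suc n)) 0ℚ)

module Bound (p : ℕ) .{{_ : ℕ.NonZero p}} (pr : Prime p) (2<p : 2 ℕ.< p) where

  open Odd p pr 2<p using (h; τ)

  -- The exponent Z S is at most L M², where M = M₀^e and `L` is independent of m. Expanding M₀ = 4
  -- m³ in M₀^(2e) gives `K` and `k`.
  e L : ℕ
  e = 4 ℕ.* 2 ℕ.^ τ ℕ.* 2 ℕ.^ τ
  L = (p ℕ.+ 4 ℕ.* (1 ℕ.+ p)) ℕ.* (2 ℕ.* (h ℕ.* h)) ℕ.* (8 ℕ.* p)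

  K k : ℕ
  K = L ℕ.* 4 ℕ.^ (e ℕ.+ e)
  k = 3 ℕ.* (e ℕ.+ e)

  module _ (m : ℕ) .{{_ : ℕ.NonZero m}} where

    open Iteration p pr 2<p m using (M₀; M; R; q; S; Z; 1≤M)
    open ℕₚ.≤-Reasoning

    M≡M₀^e : M ≡ M₀ ℕ.^ e
    M≡M₀^e = begin-equality
      M
        ≡⟨ trans (sqn-power τ _) (cong (ℕ._^ (2 ℕ.^ τ)) (trans (sqn-power τ _) (cong (ℕ._^ (2 ℕ.^ τ)) (sqn-power 2 M₀)))) ⟩
      ((M₀ ℕ.^ 4) ℕ.^ (2 ℕ.^ τ)) ℕ.^ (2 ℕ.^ τ)
        ≡⟨ trans (cong (ℕ._^ (2 ℕ.^ τ)) (ℕₚ.^-*-assoc M₀ 4 (2 ℕ.^ τ))) (ℕₚ.^-*-assoc M₀ (4 ℕ.* 2 ℕ.^ τ) (2 ℕ.^ τ)) ⟩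
      M₀ ℕ.^ e ∎

    Z*S≤K*m^k : Z ℕ.* S ℕ.≤ K ℕ.* m ℕ.^ k
    Z*S≤K*m^k = begin
      (p ℕ.+ 4 ℕ.* M ℕ.* (1 ℕ.+ p)) ℕ.* q ℕ.* (8 ℕ.* (p ℕ.* M))
        -- Bounding p by p M makes the expression homogeneous in `M`.
        ≤⟨ ℕₚ.*-monoˡ-≤ S (ℕₚ.*-monoˡ-≤ q (ℕₚ.+-monoˡ-≤ (4 ℕ.* M ℕ.* (1 ℕ.+ p)) (ℕₚ.m≤m*n p M {{ℕ.>-nonZero 1≤M}}))) ⟩
      (p ℕ.* M ℕ.+ 4 ℕ.* M ℕ.* (1 ℕ.+ p)) ℕ.* q ℕ.* (8 ℕ.* (p ℕ.* M))
        ≡⟨ l p M q ⟩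
      L ℕ.* (M ℕ.* M)
        ≡⟨ cong (L ℕ.*_) (trans (cong₂ ℕ._*_ M≡M₀^e M≡M₀^e) (sym (ℕₚ.^-distribˡ-+-* M₀ e e))) ⟩
      L ℕ.* (4 ℕ.* m ℕ.^ 3) ℕ.^ (e ℕ.+ e)
        ≡⟨ cong (L ℕ.*_) (trans (^-distribʳ-* 4 (m ℕ.^ 3) (e ℕ.+ e)) (cong (4 ℕ.^ (e ℕ.+ e) ℕ.*_) (ℕₚ.^-*-assoc m 3 (e ℕ.+ e)))) ⟩
      L ℕ.* (4 ℕ.^ (e ℕ.+ e) ℕ.* m ℕ.^ k)
        ≡⟨ ℕₚ.*-assoc L (4 ℕ.^ (e ℕ.+ e)) (m ℕ.^ k) ⟨
      K ℕ.* m ℕ.^ k ∎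
      where
      l : ∀ p M q → (p ℕ.* M ℕ.+ 4 ℕ.* M ℕ.* (1 ℕ.+ p)) ℕ.* q ℕ.* (8 ℕ.* (p ℕ.* M))
                  ≡ (p ℕ.+ 4 ℕ.* (1 ℕ.+ p)) ℕ.* q ℕ.* (8 ℕ.* p) ℕ.* (M ℕ.* M)
      l = solveℕ-∀

    dimension-≤ : ∀ n (A : Vec (Fin p) n → Bool) → RestrictedAPFree p A → p ℕ.^ n ℕ.≤ m ℕ.* card A →
                  n ℕ.≤ 2 ℕ.^ (K ℕ.* m ℕ.^ k)
    dimension-≤ n A free big = begin
      n                        ≤⟨ ℕₚ.<⇒≤ (Iteration.dimension-< p pr 2<p m n A free (Cardinality.dense⇒1≤m*density p A m big)) ⟩
      Z ℕ.^ S                  ≤⟨ ℕₚ.^-monoˡ-≤ S (n≤2^n Z) ⟩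
      (2 ℕ.^ Z) ℕ.^ S          ≡⟨ ℕₚ.^-*-assoc 2 Z S ⟩
      2 ℕ.^ (Z ℕ.* S)          ≤⟨ ℕₚ.^-monoʳ-≤ 2 Z*S≤K*m^k ⟩
      2 ℕ.^ (K ℕ.* m ℕ.^ k)    ∎

-- The density bound in inverted form, `m` being an integer with μ(A) ≥ 1/m. For p > 2, taking m to
-- be the ceiling of 1/μ(A), which is at most 2/μ(A), and logarithms to base 2, it yields μ(A) ≤ 2
-- (K / log log log n)^(1/k) whenever log log log n is defined and positive.
theorem1p1 : ∀ (p : ℕ) .{{_ : ℕ.NonZero p}} → Prime p →
    ∃[ K ] ∃[ k ]
    (∀ (n : ℕ) (A : Vec (Fin p) n → Bool) → RestrictedAPFree p A →
    ∀ (m : ℕ) → p ℕ.^ n ℕ.≤ m ℕ.* card A →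
    n ℕ.≤ 2 ℕ.^ (2 ℕ.^ (2 ℕ.^ (K ℕ.* m ℕ.^ k))))
theorem1p1 p pr with p ℕ.≟ 2
-- Modulo 2 positive density and freeness force dimension 0, so any constants serve.
... | yes refl = 0 , 0 , λ n A free m big → subst (ℕ._≤ _) (sym (dimension-mod-2 pr n A free m big)) ℕ.z≤n
... | no p≢2   = K , k , λ
  { n A free zero    big → ⊥-elim (ℕₚ.<-irrefl refl (ℕₚ.≤-trans (ℕₚ.m^n>0 p n) big))
  -- Two uses of `n≤2^n` in the exponent turn the single exponential into the triple one.
  ; n A free (suc m) big → ℕₚ.≤-trans (dimension-≤ (suc m) n A free big)
      (ℕₚ.^-monoʳ-≤ 2 (ℕₚ.≤-trans (n≤2^n (K ℕ.* suc m ℕ.^ k)) (n≤2^n (2 ℕ.^ (K ℕ.* suc m ℕ.^ k))))) }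
  where
  open Bound p pr (ℕₚ.≤∧≢⇒< (ℕ.nonTrivial⇒n>1 p {{prime⇒nonTrivial pr}}) (p≢2 ∘ sym))
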